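{- For any $d$-dimensional $k$-Fourier-sparse signal $x:\mathbb{R}^d\to\mathbb{C}$ and any duration $T>0$, $$\max_{t\in[0,T]^d}|x(t)|^2\le k^{O(d)}\|x\|_T^2,$$ where $\|x\|_T^2=\frac{1}{T^d}\int_{[0,T]^d}|x(t)|^2\,dt$.
   Context: A $d$-dimensional $k$-Fourier-sparse signal is a function of the form $x(t)=\sum_{j=1}^k v_je^{2\pi i\langle f_j,t\rangle}$ with $v_j\in\mathbb{C}$, $f_j\in\mathbb{R}^d$. The $O(\cdot)$ hides an absolute constant. -}

module Defs where

open import Data.Nat as ℕ using (ℕ; zero; suc)
import Data.Nat.Properties as ℕP
open import Data.Integer as ℤ using (+_)
import Data.Integer.Properties as ℤP
open import Data.Rational as ℚ using (ℚ; 0ℚ; 1ℚ; ½)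
import Data.Rational.Properties as ℚP
import Data.Rational.Unnormalised as ℚᵘ
import Data.Rational.Unnormalised.Properties as ℚᵘP
open import Data.Rational.Solver using (module +-*-Solver)
open import Data.Fin using (Fin; toℕ)
open import Data.Vec using (Vec; []; _∷_; zipWith; foldr′)
open import Data.Vec.Relation.Unary.All using (All)
open import Data.Vec.Relation.Binary.Pointwise.Inductive using (Pointwise)
import Data.Vec.Functional as F
open import Data.Product using (Σ; Σ-syntax; ∃-syntax; _×_; _,_; proj₁; proj₂)
open import Data.Sum using (inj₁; inj₂)
open import Relation.Binary.PropositionalEquality
  using (_≡_; refl; sym; trans; cong; cong₂; subst; subst₂)

IsCauchy : (ℕ → ℚ) → Set
IsCauchy s = ∀ ε → 0ℚ ℚ.< ε →
  ∃[ N ] (∀ m n → N ℕ.≤ m → N ℕ.≤ n → ℚ.∣ s m ℚ.- s n ∣ ℚ.≤ ε)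

partialSum : (ℕ → ℚ) → ℕ → ℚ
partialSum a zero    = 0ℚ
partialSum a (suc n) = partialSum a n ℚ.+ a n

1/suc : ℕ → ℚ
1/suc m = + 1 ℚ./ suc m

-- expTerm q m = q ^ m / m !
expTerm : ℚ → ℕ → ℚ
expTerm q zero    = 1ℚ
expTerm q (suc m) = expTerm q m ℚ.* (q ℚ.* 1/suc m)

-- cosCoeff m and sinCoeff m are the real and imaginary parts of i ^ m.
cosCoeff sinCoeff : ℕ → ℚ
cosCoeff 0                         = 1ℚ
cosCoeff 1                         = 0ℚ
cosCoeff 2                         = ℚ.- 1ℚ
cosCoeff 3                         = 0ℚ
cosCoeff (suc (suc (suc (suc m)))) = cosCoeff m
sinCoeff 0                         = 0ℚ
sinCoeff 1                         = 1ℚ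
sinCoeff 2                         = 0ℚ
sinCoeff 3                         = ℚ.- 1ℚ
sinCoeff (suc (suc (suc (suc m)))) = sinCoeff m

-- Euler's series  π = 2 Σₘ m! / (2m+1)!!,
-- that is  2 (1 + 1/3 + (1·2)/(3·5) + (1·2·3)/(3·5·7) + …).
πTerm : ℕ → ℚ
πTerm zero    = + 2 ℚ./ 1
πTerm (suc m) = πTerm m ℚ.* (+ suc m ℚ./ (3 ℕ.+ 2 ℕ.* m))

module CauchyLemmas where
  open import Data.Rational hiding (1/_)
  open import Data.Rational.Properties
  open ≤-Reasoning
  open +-*-Solver

  *-mono-≤ : ∀ {a b c d} → 0ℚ ≤ b → 0ℚ ≤ c → a ≤ b → c ≤ d → a * c ≤ b * d
  *-mono-≤ {a} {b} {c} {d} 0≤b 0≤c a≤b c≤d = ≤-trans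
    (*-monoʳ-≤-nonNeg c {{nonNegative 0≤c}} a≤b)
    (*-monoˡ-≤-nonNeg b {{nonNegative 0≤b}} c≤d)

  0≤* : ∀ {a b} → 0ℚ ≤ a → 0ℚ ≤ b → 0ℚ ≤ a * b
  0≤* {a} {b} 0≤a 0≤b =
    subst (_≤ a * b) (*-zeroˡ 0ℚ) (*-mono-≤ 0≤a ≤-refl 0≤a 0≤b)

  0≤+ : ∀ {a b} → 0ℚ ≤ a → 0ℚ ≤ b → 0ℚ ≤ a + b
  0≤+ {a} {b} p q = subst (_≤ a + b) (+-identityˡ 0ℚ) (+-mono-≤ p q)

  0<* : ∀ {a b} → 0ℚ < a → 0ℚ < b → 0ℚ < a * b
  0<* {a} {b} 0<a 0<b =
    positive⁻¹ (a * b) {{pos*pos⇒pos a {{positive 0<a}} b {{positive 0<b}}}}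

  0≤½ : 0ℚ ≤ ½
  0≤½ = nonNegative⁻¹ ½

  0<½ : 0ℚ < ½
  0<½ = positive⁻¹ ½

  0<1 : 0ℚ < 1ℚ
  0<1 = positive⁻¹ 1ℚ

  recip : ∀ p → 0ℚ < p → ℚ
  recip p 0<p = ℚ.1/_ p {{pos⇒nonZero p {{positive 0<p}}}}

  0<recip : ∀ p 0<p → 0ℚ < recip p 0<p
  0<recip p 0<p = positive⁻¹ (recip p 0<p) {{1/pos⇒pos p {{positive 0<p}}}}

  p*recip : ∀ p 0<p → p * recip p 0<p ≡ 1ℚ
  p*recip p 0<p = *-inverseʳ p {{pos⇒nonZero p {{positive 0<p}}}}

  ∣-∣-sym : ∀ a b → ∣ a - b ∣ ≡ ∣ b - a ∣
  ∣-∣-sym a b = trans (cong ∣_∣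
    (solve 2 (λ a b → a :- b := :- (b :- a)) refl a b)) (∣-p∣≡∣p∣ (b - a))

  ∣-∣-triangle : ∀ a b c → ∣ a - c ∣ ≤ ∣ a - b ∣ + ∣ b - c ∣
  ∣-∣-triangle a b c = begin
    ∣ a - c ∣             ≡⟨ cong ∣_∣ (solve 3 (λ a b c →
                              a :- c := (a :- b) :+ (b :- c)) refl a b c) ⟩
    ∣ (a - b) + (b - c) ∣ ≤⟨ ∣p+q∣≤∣p∣+∣q∣ (a - b) (b - c) ⟩
    ∣ a - b ∣ + ∣ b - c ∣ ∎

  ∣∣≤∣-∣+ : ∀ a b → ∣ a ∣ ≤ ∣ a - b ∣ + ∣ b ∣
  ∣∣≤∣-∣+ a b = begin
    ∣ a ∣             ≡⟨ cong ∣_∣ (solve 2 (λ a b → a := (a :- b) :+ b) refl a b) ⟩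
    ∣ (a - b) + b ∣   ≤⟨ ∣p+q∣≤∣p∣+∣q∣ (a - b) b ⟩
    ∣ a - b ∣ + ∣ b ∣ ∎

  cauchy-dominated : ∀ r s t K → 0ℚ < K →
    (∀ m n → ∣ r m - r n ∣ ≤ K * (∣ s m - s n ∣ + ∣ t m - t n ∣)) →
    IsCauchy s → IsCauchy t → IsCauchy r
  cauchy-dominated r s t K 0<K dom cs ct ε 0<ε = N , bound
    where
    δ : ℚ
    δ = ½ * ε * recip K 0<K
    0<δ : 0ℚ < δ
    0<δ = 0<* (0<* 0<½ 0<ε) (0<recip K 0<K)
    N : ℕ
    N = proj₁ (cs δ 0<δ) ℕ.⊔ proj₁ (ct δ 0<δ)
    K[δ+δ]≡ε : K * (δ + δ) ≡ ε
    K[δ+δ]≡ε = begin-equality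
      K * (δ + δ)
        ≡⟨ solve 4 (λ K h e r → K :* ((h :* e :* r) :+ (h :* e :* r))
                     := (K :* r) :* ((h :+ h) :* e)) refl K ½ ε (recip K 0<K) ⟩
      (K * recip K 0<K) * ((½ + ½) * ε)
        ≡⟨ cong (_* ((½ + ½) * ε)) (p*recip K 0<K) ⟩
      1ℚ * (1ℚ * ε)
        ≡⟨ trans (*-identityˡ (1ℚ * ε)) (*-identityˡ ε) ⟩
      ε ∎
    bound : ∀ m n → N ℕ.≤ m → N ℕ.≤ n → ∣ r m - r n ∣ ≤ ε
    bound m n N≤m N≤n = begin
      ∣ r m - r n ∣                         ≤⟨ dom m n ⟩
      K * (∣ s m - s n ∣ + ∣ t m - t n ∣)   ≤⟨ *-monoˡ-≤-nonNeg K {{nonNegative (<⇒≤ 0<K)}}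
                                               (+-mono-≤
                                                 (proj₂ (cs δ 0<δ) m n (lo N≤m) (lo N≤n))
                                                 (proj₂ (ct δ 0<δ) m n (hi N≤m) (hi N≤n))) ⟩
      K * (δ + δ)                           ≡⟨ K[δ+δ]≡ε ⟩
      ε                                     ∎
      where
      lo : ∀ {j} → N ℕ.≤ j → proj₁ (cs δ 0<δ) ℕ.≤ j
      lo = ℕP.≤-trans (ℕP.m≤m⊔n (proj₁ (cs δ 0<δ)) (proj₁ (ct δ 0<δ)))
      hi : ∀ {j} → N ℕ.≤ j → proj₁ (ct δ 0<δ) ℕ.≤ j
      hi = ℕP.≤-trans (ℕP.m≤n⊔m (proj₁ (cs δ 0<δ)) (proj₁ (ct δ 0<δ)))

  cauchy-const : ∀ q → IsCauchy (λ _ → q)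
  cauchy-const q ε 0<ε = 0 , λ _ _ _ _ →
    ≤-trans (≤-reflexive (cong ∣_∣ (+-inverseʳ q))) (<⇒≤ 0<ε)

  runningMax : (ℕ → ℚ) → ℕ → ℚ
  runningMax s zero    = ∣ s 0 ∣
  runningMax s (suc n) = runningMax s n ⊔ ∣ s (suc n) ∣

  ≤runningMax : ∀ s {m n} → m ℕ.≤′ n → ∣ s m ∣ ≤ runningMax s n
  ≤runningMax s {zero}  {.zero}  (ℕ.≤′-reflexive refl) = ≤-refl
  ≤runningMax s {suc m} {.(suc m)} (ℕ.≤′-reflexive refl) =
    p≤q⊔p (runningMax s m) ∣ s (suc m) ∣
  ≤runningMax s {m} {suc n} (ℕ.≤′-step m≤n) =
    ≤-trans (≤runningMax s m≤n) (p≤p⊔q (runningMax s n) ∣ s (suc n) ∣)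

  cauchy-bounded : ∀ s → IsCauchy s → Σ[ K ∈ ℚ ] 0ℚ < K × (∀ n → ∣ s n ∣ ≤ K)
  cauchy-bounded s cs = K , 0<K , bound
    where
    N = proj₁ (cs 1ℚ 0<1)
    M = runningMax s N
    K = 1ℚ + M
    0≤M : 0ℚ ≤ M
    0≤M = ≤-trans (0≤∣p∣ (s N)) (≤runningMax s (ℕ.≤′-reflexive refl))
    0<K : 0ℚ < K
    0<K = subst (_< K) (+-identityˡ 0ℚ) (+-mono-<-≤ 0<1 0≤M)
    bound : ∀ n → ∣ s n ∣ ≤ K
    bound n with ℕP.≤-total n N
    ... | inj₁ n≤N = begin
      ∣ s n ∣   ≤⟨ ≤runningMax s (ℕP.≤⇒≤′ n≤N) ⟩
      M         ≡⟨ +-identityˡ M ⟨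
      0ℚ + M    ≤⟨ +-monoˡ-≤ M (<⇒≤ 0<1) ⟩
      K         ∎
    ... | inj₂ N≤n = begin
      ∣ s n ∣                 ≤⟨ ∣∣≤∣-∣+ (s n) (s N) ⟩
      ∣ s n - s N ∣ + ∣ s N ∣ ≤⟨ +-mono-≤ (proj₂ (cs 1ℚ 0<1) n N N≤n ℕP.≤-refl)
                                         (≤runningMax s (ℕ.≤′-reflexive refl)) ⟩
      K                       ∎

  cauchy-+ : ∀ s t → IsCauchy s → IsCauchy t → IsCauchy (λ n → s n + t n)
  cauchy-+ s t = cauchy-dominated (λ n → s n + t n) s t 1ℚ 0<1 λ m n → begin
    ∣ (s m + t m) - (s n + t n) ∣
      ≡⟨ cong ∣_∣ (solve 4 (λ a b c d → (a :+ b) :- (c :+ d) := (a :- c) :+ (b :- d))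
           refl (s m) (t m) (s n) (t n)) ⟩
    ∣ (s m - s n) + (t m - t n) ∣
      ≤⟨ ∣p+q∣≤∣p∣+∣q∣ (s m - s n) (t m - t n) ⟩
    ∣ s m - s n ∣ + ∣ t m - t n ∣
      ≡⟨ *-identityˡ (∣ s m - s n ∣ + ∣ t m - t n ∣) ⟨
    1ℚ * (∣ s m - s n ∣ + ∣ t m - t n ∣) ∎

  cauchy-neg : ∀ s → IsCauchy s → IsCauchy (λ n → - s n)
  cauchy-neg s cs = cauchy-dominated (λ n → - s n) s (λ _ → 0ℚ) 1ℚ 0<1 (λ m n → begin
    ∣ - s m - - s n ∣
      ≡⟨ cong ∣_∣ (solve 2 (λ a b → (:- a) :- (:- b) := :- (a :- b)) refl (s m) (s n)) ⟩
    ∣ - (s m - s n) ∣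
      ≡⟨ ∣-p∣≡∣p∣ (s m - s n) ⟩
    ∣ s m - s n ∣
      ≡⟨ trans (*-identityˡ (∣ s m - s n ∣ + 0ℚ)) (+-identityʳ ∣ s m - s n ∣) ⟨
    1ℚ * (∣ s m - s n ∣ + 0ℚ) ∎) cs (cauchy-const 0ℚ)

  cauchy-* : ∀ s t → IsCauchy s → IsCauchy t → IsCauchy (λ n → s n * t n)
  cauchy-* s t cs ct
    with K , 0<K , s≤K ← cauchy-bounded s cs
       | L , 0<L , t≤L ← cauchy-bounded t ct
    = cauchy-dominated (λ n → s n * t n) s t (K + L) 0<K+L dom cs ct
    where
    0<K+L : 0ℚ < K + L
    0<K+L = subst (_< K + L) (+-identityˡ 0ℚ) (+-mono-< 0<K 0<L)
    dom : ∀ m n → ∣ s m * t m - s n * t n ∣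
                    ≤ (K + L) * (∣ s m - s n ∣ + ∣ t m - t n ∣)
    dom m n = begin
      ∣ s m * t m - s n * t n ∣
        ≡⟨ cong ∣_∣ (solve 4 (λ a b c d → a :* b :- c :* d
             := a :* (b :- d) :+ d :* (a :- c)) refl (s m) (t m) (s n) (t n)) ⟩
      ∣ s m * (t m - t n) + t n * (s m - s n) ∣
        ≤⟨ ∣p+q∣≤∣p∣+∣q∣ (s m * (t m - t n)) (t n * (s m - s n)) ⟩
      ∣ s m * (t m - t n) ∣ + ∣ t n * (s m - s n) ∣
        ≡⟨ cong₂ _+_ (∣p*q∣≡∣p∣*∣q∣ (s m) (t m - t n)) (∣p*q∣≡∣p∣*∣q∣ (t n) (s m - s n)) ⟩
      ∣ s m ∣ * y + ∣ t n ∣ * x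
        ≤⟨ +-mono-≤ (*-monoʳ-≤-nonNeg y {{nonNegative 0≤y}} (s≤K m))
                    (*-monoʳ-≤-nonNeg x {{nonNegative 0≤x}} (t≤L n)) ⟩
      K * y + L * x
        ≡⟨ +-identityʳ (K * y + L * x) ⟨
      K * y + L * x + 0ℚ
        ≤⟨ +-monoʳ-≤ (K * y + L * x)
             (0≤+ (0≤* (<⇒≤ 0<K) 0≤x) (0≤* (<⇒≤ 0<L) 0≤y)) ⟩
      K * y + L * x + (K * x + L * y)
        ≡⟨ solve 4 (λ K L x y → K :* y :+ L :* x :+ (K :* x :+ L :* y)
             := (K :+ L) :* (x :+ y)) refl K L x y ⟩
      (K + L) * (x + y) ∎
      where
      x = ∣ s m - s n ∣
      y = ∣ t m - t n ∣
      0≤x = 0≤∣p∣ (s m - s n)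
      0≤y = 0≤∣p∣ (t m - t n)

  0<p⊔ε : ∀ p {ε} → 0ℚ < ε → 0ℚ < p ⊔ ε
  0<p⊔ε p {ε} 0<ε = <-≤-trans 0<ε (p≤q⊔p p ε)

  -- Truncating s n below at ε makes the inverse total and Lipschitz.
  cauchy-recip : ∀ s {ε} (0<ε : 0ℚ < ε) (N : ℕ) → (∀ n → N ℕ.≤ n → ε ≤ s n) →
    IsCauchy s → IsCauchy (λ n → recip (s n ⊔ ε) (0<p⊔ε (s n) 0<ε))
  cauchy-recip s {ε} 0<ε N ε≤s cs η 0<η = N ℕ.⊔ N′ , bound
    where
    u : ℕ → ℚ
    u n = recip (s n ⊔ ε) (0<p⊔ε (s n) 0<ε)
    δ = η * (ε * ε)
    0<δ : 0ℚ < δ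
    0<δ = 0<* 0<η (0<* 0<ε 0<ε)
    N′ = proj₁ (cs δ 0<δ)
    c = recip ε 0<ε
    0≤c : 0ℚ ≤ c
    0≤c = <⇒≤ (0<recip ε 0<ε)
    0≤u : ∀ n → 0ℚ ≤ u n
    0≤u n = <⇒≤ (0<recip (s n ⊔ ε) (0<p⊔ε (s n) 0<ε))
    su≡1 : ∀ n → N ℕ.≤ n → s n * u n ≡ 1ℚ
    su≡1 n N≤n = trans (cong (_* u n) (sym (p≥q⇒p⊔q≡p (ε≤s n N≤n))))
                       (p*recip (s n ⊔ ε) (0<p⊔ε (s n) 0<ε))
    u≤c : ∀ n → N ℕ.≤ n → u n ≤ c
    u≤c n N≤n = begin
      u n             ≡⟨ *-identityʳ (u n) ⟨
      u n * 1ℚ        ≡⟨ cong (u n *_) (p*recip ε 0<ε) ⟨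
      u n * (ε * c)   ≤⟨ *-monoˡ-≤-nonNeg (u n) {{nonNegative (0≤u n)}}
                           (*-monoʳ-≤-nonNeg c {{nonNegative 0≤c}} (ε≤s n N≤n)) ⟩
      u n * (s n * c) ≡⟨ solve 3 (λ u s c → u :* (s :* c) := (s :* u) :* c) refl
                           (u n) (s n) c ⟩
      (s n * u n) * c ≡⟨ cong (_* c) (su≡1 n N≤n) ⟩
      1ℚ * c          ≡⟨ *-identityˡ c ⟩
      c               ∎
    bound : ∀ m n → N ℕ.⊔ N′ ℕ.≤ m → N ℕ.⊔ N′ ℕ.≤ n → ∣ u m - u n ∣ ≤ η
    bound m n p q = begin
      ∣ u m - u n ∣
        ≡⟨ cong ∣_∣ (cong₂ _-_ (trans (sym (*-identityʳ (u m))) (cong (u m *_) (sym (su≡1 n N≤n))))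
                               (trans (sym (*-identityʳ (u n))) (cong (u n *_) (sym (su≡1 m N≤m))))) ⟩
      ∣ u m * (s n * u n) - u n * (s m * u m) ∣
        ≡⟨ cong ∣_∣ (solve 4 (λ a b x y → a :* (y :* b) :- b :* (x :* a)
             := (y :- x) :* (a :* b)) refl (u m) (u n) (s m) (s n)) ⟩
      ∣ (s n - s m) * (u m * u n) ∣
        ≡⟨ ∣p*q∣≡∣p∣*∣q∣ (s n - s m) (u m * u n) ⟩
      ∣ s n - s m ∣ * ∣ u m * u n ∣
        ≡⟨ cong (λ z → ∣ s n - s m ∣ * z) (0≤p⇒∣p∣≡p (0≤* (0≤u m) (0≤u n))) ⟩
      ∣ s n - s m ∣ * (u m * u n)
        ≤⟨ *-mono-≤ (<⇒≤ 0<δ) (0≤* (0≤u m) (0≤u n))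
             (proj₂ (cs δ 0<δ) n m (hi q) (hi p))
             (*-mono-≤ 0≤c (0≤u n) (u≤c m N≤m) (u≤c n N≤n)) ⟩
      (η * (ε * ε)) * (c * c)
        ≡⟨ solve 3 (λ h e c → (h :* (e :* e)) :* (c :* c) := h :* ((e :* c) :* (e :* c)))
             refl η ε c ⟩
      η * ((ε * c) * (ε * c))
        ≡⟨ cong (η *_) (cong₂ _*_ (p*recip ε 0<ε) (p*recip ε 0<ε)) ⟩
      η * 1ℚ
        ≡⟨ *-identityʳ η ⟩
      η ∎
      where
      hi : ∀ {j} → N ℕ.⊔ N′ ℕ.≤ j → N′ ℕ.≤ j
      hi = ℕP.≤-trans (ℕP.m≤n⊔m N N′)
      N≤m = ℕP.≤-trans (ℕP.m≤m⊔n N N′) p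
      N≤n = ℕP.≤-trans (ℕP.m≤m⊔n N N′) q

  frac-≤ : ∀ {a b c d} .{{_ : ℕ.NonZero b}} .{{_ : ℕ.NonZero d}} →
           a ℕ.* d ℕ.≤ c ℕ.* b → + a / b ≤ + c / d
  frac-≤ {a} {suc b} {c} {suc d} ad≤cb = toℚᵘ-cancel-≤
    (ℚᵘP.≤-trans (ℚᵘP.≤-reflexive (toℚᵘ-fromℚᵘ (ℚᵘ.mkℚᵘ (+ a) b)))
    (ℚᵘP.≤-trans (ℚᵘ.*≤* (subst₂ ℤ._≤_ (ℤP.pos-* a (suc d)) (ℤP.pos-* c (suc b)) (ℤ.+≤+ ad≤cb)))
    (ℚᵘP.≤-reflexive (ℚᵘP.≃-sym (toℚᵘ-fromℚᵘ (ℚᵘ.mkℚᵘ (+ c) d))))))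

  frac-* : ∀ {a b c d} →
           (+ a / suc b) * (+ c / suc d) ≡ + (a ℕ.* c) / (suc b ℕ.* suc d)
  frac-* {a} {b} {c} {d} = toℚᵘ-injective
    (ℚᵘP.≃-trans (toℚᵘ-homo-* (+ a / suc b) (+ c / suc d))
    (ℚᵘP.≃-trans (ℚᵘP.*-cong (toℚᵘ-fromℚᵘ (ℚᵘ.mkℚᵘ (+ a) b)) (toℚᵘ-fromℚᵘ (ℚᵘ.mkℚᵘ (+ c) d)))
    (ℚᵘP.≃-trans (ℚᵘP.≃-reflexive (cong (λ z → ℚᵘ.mkℚᵘ z (d ℕ.+ b ℕ.* suc d)) (sym (ℤP.pos-* a c))))
    (ℚᵘP.≃-sym (toℚᵘ-fromℚᵘ (ℚᵘ.mkℚᵘ (+ (a ℕ.* c)) (d ℕ.+ b ℕ.* suc d)))))))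

  0≤frac : ∀ a b .{{_ : ℕ.NonZero b}} → 0ℚ ≤ + a / b
  0≤frac a b = frac-≤ {0} {1} {a} {b} ℕ.z≤n

  archimedean : ∀ p → ∃[ J ] p ≤ + J / 1
  archimedean p@(mkℚ n d _) = ℤ.∣ n ∣ , toℚᵘ-cancel-≤
    (ℚᵘP.≤-trans {j = ℚᵘ.mkℚᵘ (+ ℤ.∣ n ∣) 0}
      (ℚᵘ.*≤* (ℤP.≤-trans (ℤP.≤-reflexive (ℤP.*-identityʳ n))
              (ℤP.≤-trans (i≤+∣i∣ n)
              (subst (+ ℤ.∣ n ∣ ℤ.≤_) (ℤP.pos-* ℤ.∣ n ∣ (suc d))
                (ℤ.+≤+ (ℕP.m≤m*n ℤ.∣ n ∣ (suc d)))))))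
      (ℚᵘP.≤-reflexive (ℚᵘP.≃-sym (toℚᵘ-fromℚᵘ (ℚᵘ.mkℚᵘ (+ ℤ.∣ n ∣) 0)))))
    where
    i≤+∣i∣ : ∀ i → i ℤ.≤ + ℤ.∣ i ∣
    i≤+∣i∣ (+ _)      = ℤP.≤-refl
    i≤+∣i∣ (ℤ.-[1+ _ ]) = ℤ.-≤+

  archimedean-1/suc : ∀ p {ε} → 0ℚ < ε → ∃[ J ] (∀ j → J ℕ.≤ j → p * 1/suc j ≤ ε)
  archimedean-1/suc p {ε} 0<ε with J , le ← archimedean (p * recip ε 0<ε) = J , bound
    where
    bound : ∀ j → J ℕ.≤ j → p * 1/suc j ≤ ε
    bound j J≤j = begin
      p * 1/suc j
        ≡⟨ cong (_* 1/suc j) (trans (sym (*-identityʳ p)) (cong (p *_) (sym (p*recip ε 0<ε)))) ⟩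
      p * (ε * r) * 1/suc j
        ≡⟨ solve 4 (λ p e r j → p :* (e :* r) :* j := (p :* r) :* (j :* e)) refl p ε r (1/suc j) ⟩
      (p * r) * (1/suc j * ε)
        ≤⟨ *-monoʳ-≤-nonNeg (1/suc j * ε) {{nonNegative (0≤* (0≤frac 1 (suc j)) (<⇒≤ 0<ε))}} le ⟩
      (+ J / 1) * (1/suc j * ε)
        ≡⟨ *-assoc (+ J / 1) (1/suc j) ε ⟨
      (+ J / 1) * 1/suc j * ε
        ≡⟨ cong (_* ε) (frac-* {J} {0} {1} {j}) ⟩
      (+ (J ℕ.* 1) / (1 ℕ.* suc j)) * ε
        ≤⟨ *-monoʳ-≤-nonNeg ε {{nonNegative (<⇒≤ 0<ε)}} (frac-≤ {J ℕ.* 1} {1 ℕ.* suc j} {1} {1} nat) ⟩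
      1ℚ * ε
        ≡⟨ *-identityˡ ε ⟩
      ε ∎
      where
      r = recip ε 0<ε
      nat : J ℕ.* 1 ℕ.* 1 ℕ.≤ 1 ℕ.* (1 ℕ.* suc j)
      nat rewrite ℕP.*-identityʳ J | ℕP.*-identityʳ J | ℕP.+-identityʳ j | ℕP.+-identityʳ j =
        ℕP.m≤n⇒m≤1+n J≤j

  partialSum-shift : ∀ a b → (∀ n → ∣ a n ∣ ≤ b n) → ∀ j n →
    ∣ partialSum a (j ℕ.+ n) - partialSum a n ∣ ≤ partialSum b (j ℕ.+ n) - partialSum b n
  partialSum-shift a b a≤b zero n =
    ≤-reflexive (trans (cong ∣_∣ (+-inverseʳ (partialSum a n))) (sym (+-inverseʳ (partialSum b n))))
  partialSum-shift a b a≤b (suc j) n = begin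
    ∣ A + x - A₀ ∣
      ≡⟨ cong ∣_∣ (solve 3 (λ A x A₀ → A :+ x :- A₀ := (A :- A₀) :+ x) refl A x A₀) ⟩
    ∣ (A - A₀) + x ∣     ≤⟨ ∣p+q∣≤∣p∣+∣q∣ (A - A₀) x ⟩
    ∣ A - A₀ ∣ + ∣ x ∣   ≤⟨ +-mono-≤ (partialSum-shift a b a≤b j n) (a≤b (j ℕ.+ n)) ⟩
    (B - B₀) + y         ≡⟨ solve 3 (λ A x A₀ → (A :- A₀) :+ x := A :+ x :- A₀) refl B y B₀ ⟩
    B + y - B₀           ∎
    where
    A = partialSum a (j ℕ.+ n)
    B = partialSum b (j ℕ.+ n)
    A₀ = partialSum a n
    B₀ = partialSum b n
    x = a (j ℕ.+ n)
    y = b (j ℕ.+ n)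

  partialSum-∣-∣ : ∀ a b → (∀ n → ∣ a n ∣ ≤ b n) → ∀ m n →
    ∣ partialSum a m - partialSum a n ∣ ≤ ∣ partialSum b m - partialSum b n ∣
  partialSum-∣-∣ a b a≤b m n with ℕP.≤-total n m
  ... | inj₁ n≤m = subst (λ k → ∣ partialSum a k - partialSum a n ∣
                                ≤ ∣ partialSum b k - partialSum b n ∣)
      (ℕP.m∸n+n≡m n≤m)
      (≤-trans le (≤-reflexive (sym (0≤p⇒∣p∣≡p (≤-trans (0≤∣p∣ _) le)))))
      where le = partialSum-shift a b a≤b (m ℕ.∸ n) n
  ... | inj₂ m≤n = subst₂ _≤_
      (∣-∣-sym (partialSum a n) (partialSum a m))
      (∣-∣-sym (partialSum b n) (partialSum b m))
      (subst (λ k → ∣ partialSum a k - partialSum a m ∣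
                     ≤ ∣ partialSum b k - partialSum b m ∣)
        (ℕP.m∸n+n≡m m≤n)
        (≤-trans le (≤-reflexive (sym (0≤p⇒∣p∣≡p (≤-trans (0≤∣p∣ _) le))))))
      where le = partialSum-shift a b a≤b (n ℕ.∸ m) m

  half+half : ∀ p → ½ * p + ½ * p ≡ p
  half+half p = trans (sym (*-distribʳ-+ p ½ ½)) (*-identityˡ p)

  cauchy-ratio : ∀ t N → (∀ n → 0ℚ ≤ t n) →
    (∀ n → N ℕ.≤ n → t (suc n) ≤ ½ * t n) → IsCauchy (partialSum t)
  cauchy-ratio t N 0≤t ratio ε 0<ε = L , bound
    where
    S = partialSum t

    decay : ∀ j → t (j ℕ.+ N) ≤ t N * 1/suc j
    decay zero    = ≤-reflexive (sym (*-identityʳ (t N)))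
    decay (suc j) = begin
      t (suc (j ℕ.+ N))      ≤⟨ ratio (j ℕ.+ N) (ℕP.m≤n+m N j) ⟩
      ½ * t (j ℕ.+ N)        ≤⟨ *-monoˡ-≤-nonNeg ½ (decay j) ⟩
      ½ * (t N * 1/suc j)    ≡⟨ solve 3 (λ h t r → h :* (t :* r) := t :* (h :* r)) refl ½ (t N) (1/suc j) ⟩
      t N * (½ * 1/suc j)    ≤⟨ *-monoˡ-≤-nonNeg (t N) {{nonNegative (0≤t N)}} half ⟩
      t N * 1/suc (suc j)    ∎
      where
      half : ½ * 1/suc j ≤ 1/suc (suc j)
      half = ≤-trans (≤-reflexive (frac-* {1} {1} {1} {j})) (frac-≤ {1} {2 ℕ.* suc j} {1} {2 ℕ.+ j} nat)
        where
        nat : 1 ℕ.* (2 ℕ.+ j) ℕ.≤ 1 ℕ.* (2 ℕ.* suc j)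
        nat rewrite ℕP.+-identityʳ j | ℕP.+-identityʳ (j ℕ.+ suc j) | ℕP.+-suc j j =
          ℕ.s≤s (ℕ.s≤s (ℕP.m≤m+n j j))

    upper : ∀ n → N ℕ.≤ n → ∀ j →
            S (j ℕ.+ n) + (t (j ℕ.+ n) + t (j ℕ.+ n)) ≤ S n + (t n + t n)
    upper n N≤n zero    = ≤-refl
    upper n N≤n (suc j) = begin
      (S k + t k) + (t (suc k) + t (suc k))
        ≤⟨ +-monoʳ-≤ (S k + t k) (≤-trans (+-mono-≤ r r) (≤-reflexive (half+half (t k)))) ⟩
      (S k + t k) + t k
        ≡⟨ +-assoc (S k) (t k) (t k) ⟩
      S k + (t k + t k)
        ≤⟨ upper n N≤n j ⟩
      S n + (t n + t n) ∎
      where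
      k = j ℕ.+ n
      r = ratio k (ℕP.≤-trans N≤n (ℕP.m≤n+m n j))

    tail : ∀ n → N ℕ.≤ n → ∀ m → n ℕ.≤ m → ∣ S m - S n ∣ ≤ t n + t n
    tail n N≤n m n≤m = subst (λ k → ∣ S k - S n ∣ ≤ t n + t n) (ℕP.m∸n+n≡m n≤m) (begin
      ∣ S k - S n ∣
        ≤⟨ partialSum-shift t t (λ i → ≤-reflexive (0≤p⇒∣p∣≡p (0≤t i))) (m ℕ.∸ n) n ⟩
      S k - S n
        ≡⟨ +-identityʳ (S k - S n) ⟨
      S k - S n + 0ℚ
        ≤⟨ +-monoʳ-≤ (S k - S n) (0≤+ (0≤t k) (0≤t k)) ⟩
      S k - S n + (t k + t k)
        ≡⟨ solve 3 (λ a b c → a :- b :+ c := (a :+ c) :- b) refl (S k) (S n) (t k + t k) ⟩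
      (S k + (t k + t k)) - S n
        ≤⟨ +-monoˡ-≤ (- S n) (upper n N≤n (m ℕ.∸ n)) ⟩
      (S n + (t n + t n)) - S n
        ≡⟨ solve 2 (λ a b → (a :+ b) :- a := b) refl (S n) (t n + t n) ⟩
      t n + t n ∎)
      where k = m ℕ.∸ n ℕ.+ n

    J = proj₁ (archimedean-1/suc (t N) (0<* 0<½ (0<* 0<½ 0<ε)))
    L = J ℕ.+ N
    small : t L ≤ ½ * (½ * ε)
    small = ≤-trans (decay J)
      (proj₂ (archimedean-1/suc (t N) (0<* 0<½ (0<* 0<½ 0<ε))) J ℕP.≤-refl)

    tailL : ∀ m → L ℕ.≤ m → ∣ S m - S L ∣ ≤ ½ * ε
    tailL m L≤m = ≤-trans (tail L (ℕP.m≤n+m N J) m L≤m)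
      (≤-trans (+-mono-≤ small small) (≤-reflexive (half+half (½ * ε))))

    bound : ∀ m n → L ℕ.≤ m → L ℕ.≤ n → ∣ S m - S n ∣ ≤ ε
    bound m n L≤m L≤n = begin
      ∣ S m - S n ∣                 ≤⟨ ∣-∣-triangle (S m) (S L) (S n) ⟩
      ∣ S m - S L ∣ + ∣ S L - S n ∣ ≡⟨ cong (λ z → ∣ S m - S L ∣ + z) (∣-∣-sym (S L) (S n)) ⟩
      ∣ S m - S L ∣ + ∣ S n - S L ∣ ≤⟨ +-mono-≤ (tailL m L≤m) (tailL n L≤n) ⟩
      ½ * ε + ½ * ε                 ≡⟨ half+half ε ⟩
      ε                             ∎

  0≤πTerm : ∀ n → 0ℚ ≤ πTerm n
  0≤πTerm zero    = 0≤frac 2 1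
  0≤πTerm (suc n) = 0≤* (0≤πTerm n) (0≤frac (suc n) (3 ℕ.+ 2 ℕ.* n))

  cauchy-π : IsCauchy (partialSum πTerm)
  cauchy-π = cauchy-ratio πTerm 0 0≤πTerm λ n _ → ≤-trans
    (*-monoˡ-≤-nonNeg (πTerm n) {{nonNegative (0≤πTerm n)}}
      (frac-≤ {suc n} {3 ℕ.+ 2 ℕ.* n} {1} {2} (nat n)))
    (≤-reflexive (*-comm (πTerm n) ½))
    where
    nat : ∀ n → suc n ℕ.* 2 ℕ.≤ 1 ℕ.* (3 ℕ.+ 2 ℕ.* n)
    nat n rewrite ℕP.+-identityʳ (2 ℕ.* n) | ℕP.*-comm n 2 = ℕP.n≤1+n (2 ℕ.+ 2 ℕ.* n)

  0≤expTerm : ∀ M → 0ℚ ≤ M → ∀ n → 0ℚ ≤ expTerm M n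
  0≤expTerm M 0≤M zero    = <⇒≤ 0<1
  0≤expTerm M 0≤M (suc n) = 0≤* {expTerm M n} {M * 1/suc n}
    (0≤expTerm M 0≤M n) (0≤* {M} {1/suc n} 0≤M (0≤frac 1 (suc n)))

  cauchy-exp : ∀ M → 0ℚ ≤ M → IsCauchy (partialSum (expTerm M))
  cauchy-exp M 0≤M = cauchy-ratio (expTerm M) J (0≤expTerm M 0≤M) ratio
    where
    J : ℕ
    J = proj₁ (archimedean-1/suc M 0<½)
    ratio : ∀ n → J ℕ.≤ n → expTerm M n * (M * 1/suc n) ≤ ½ * expTerm M n
    ratio n J≤n = begin
      expTerm M n * (M * 1/suc n)
        ≤⟨ *-monoˡ-≤-nonNeg (expTerm M n) {{nonNegative (0≤expTerm M 0≤M n)}}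
             {M * 1/suc n} {½} (proj₂ (archimedean-1/suc M 0<½) n J≤n) ⟩
      expTerm M n * ½
        ≡⟨ *-comm (expTerm M n) ½ ⟩
      ½ * expTerm M n ∎

  expTerm-bound : ∀ q M → ∣ q ∣ ≤ M → ∀ n → ∣ expTerm q n ∣ ≤ expTerm M n
  expTerm-bound q M q≤M zero = ≤-refl
  expTerm-bound q M q≤M (suc n) = begin
    ∣ expTerm q n * (q * r) ∣     ≡⟨ ∣p*q∣≡∣p∣*∣q∣ (expTerm q n) (q * r) ⟩
    ∣ expTerm q n ∣ * ∣ q * r ∣   ≡⟨ cong (∣ expTerm q n ∣ *_) (trans (∣p*q∣≡∣p∣*∣q∣ q r)
                                      (cong (∣ q ∣ *_) (0≤p⇒∣p∣≡p 0≤r))) ⟩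
    ∣ expTerm q n ∣ * (∣ q ∣ * r) ≤⟨ *-mono-≤ (0≤expTerm M 0≤M n) (0≤* (0≤∣p∣ q) 0≤r)
                                      (expTerm-bound q M q≤M n)
                                      (*-monoʳ-≤-nonNeg r {{nonNegative 0≤r}} q≤M) ⟩
    expTerm M n * (M * r)         ∎
    where
    r = 1/suc n
    0≤r = 0≤frac 1 (suc n)
    0≤M = ≤-trans (0≤∣p∣ q) q≤M

  expTerm-lipschitz : ∀ p q M → ∣ p ∣ + 1ℚ ≤ M → ∣ q ∣ ≤ M → ∀ n →
    ∣ expTerm p n - expTerm q n ∣ ≤ ∣ p - q ∣ * expTerm M n
  expTerm-lipschitz p q M p+1≤M q≤M zero =
    ≤-trans (≤-reflexive (cong ∣_∣ (+-inverseʳ 1ℚ))) (0≤* (0≤∣p∣ (p - q)) (<⇒≤ 0<1))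
  expTerm-lipschitz p q M p+1≤M q≤M (suc n) = begin
    ∣ P * (p * r) - Q * (q * r) ∣
      ≡⟨ cong ∣_∣ (solve 5 (λ P Q p q r → P :* (p :* r) :- Q :* (q :* r)
           := ((P :- Q) :* p :+ Q :* (p :- q)) :* r) refl P Q p q r) ⟩
    ∣ ((P - Q) * p + Q * (p - q)) * r ∣
      ≡⟨ trans (∣p*q∣≡∣p∣*∣q∣ ((P - Q) * p + Q * (p - q)) r)
           (cong (λ z → ∣ (P - Q) * p + Q * (p - q) ∣ * z) (0≤p⇒∣p∣≡p 0≤r)) ⟩
    ∣ (P - Q) * p + Q * (p - q) ∣ * r
      ≤⟨ *-monoʳ-≤-nonNeg r {{nonNegative 0≤r}} (∣p+q∣≤∣p∣+∣q∣ ((P - Q) * p) (Q * (p - q))) ⟩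
    (∣ (P - Q) * p ∣ + ∣ Q * (p - q) ∣) * r
      ≡⟨ cong (_* r) (cong₂ _+_ (∣p*q∣≡∣p∣*∣q∣ (P - Q) p) (∣p*q∣≡∣p∣*∣q∣ Q (p - q))) ⟩
    (∣ P - Q ∣ * ∣ p ∣ + ∣ Q ∣ * D) * r
      ≤⟨ *-monoʳ-≤-nonNeg r {{nonNegative 0≤r}} (+-mono-≤
           (*-monoʳ-≤-nonNeg ∣ p ∣ {{nonNegative (0≤∣p∣ p)}} (expTerm-lipschitz p q M p+1≤M q≤M n))
           (*-monoʳ-≤-nonNeg D {{nonNegative (0≤∣p∣ (p - q))}} (expTerm-bound q M q≤M n))) ⟩
    (D * E * ∣ p ∣ + E * D) * r
      ≡⟨ cong (λ z → (D * E * ∣ p ∣ + z) * r) (sym (*-identityʳ (E * D))) ⟩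
    (D * E * ∣ p ∣ + E * D * 1ℚ) * r
      ≡⟨ solve 5 (λ D E p o r → (D :* E :* p :+ E :* D :* o) :* r
           := (D :* E :* r) :* (p :+ o)) refl D E ∣ p ∣ 1ℚ r ⟩
    (D * E * r) * (∣ p ∣ + 1ℚ)
      ≤⟨ *-monoˡ-≤-nonNeg (D * E * r) {{nonNegative (0≤* (0≤* (0≤∣p∣ (p - q)) 0≤E) 0≤r)}} p+1≤M ⟩
    (D * E * r) * M
      ≡⟨ solve 4 (λ D E r M → (D :* E :* r) :* M := D :* (E :* (M :* r))) refl D E r M ⟩
    D * (E * (M * r)) ∎
    where
    P = expTerm p n
    Q = expTerm q n
    r = 1/suc n
    D = ∣ p - q ∣
    E = expTerm M n
    0≤r = 0≤frac 1 (suc n)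
    0≤E = 0≤expTerm M (≤-trans (0≤∣p∣ q) q≤M) n

  cauchy-powerSeries : ∀ (c s : ℕ → ℚ) → (∀ m → ∣ c m ∣ ≤ 1ℚ) → IsCauchy s →
    IsCauchy (λ n → partialSum (λ m → c m * expTerm (s n) m) n)
  cauchy-powerSeries c s c≤1 cs = bounded (cauchy-bounded s cs)
    where
    module _ (K : ℚ) (0<K : 0ℚ < K) (s≤K : ∀ n → ∣ s n ∣ ≤ K) where
      M : ℚ
      M = K + 1ℚ
      0≤M : 0ℚ ≤ M
      0≤M = 0≤+ (<⇒≤ 0<K) (<⇒≤ 0<1)
      K≤M : K ≤ M
      K≤M = ≤-trans (≤-reflexive (sym (+-identityʳ K))) (+-monoʳ-≤ K (<⇒≤ 0<1))
      S : ℕ → ℚ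
      S = partialSum (expTerm M)
      C : ℚ → ℕ → ℚ
      C q = partialSum (λ m → c m * expTerm q m)

      scale : ∀ m x y → ∣ x ∣ ≤ y → ∣ c m * x ∣ ≤ y
      scale m x y x≤y = begin
        ∣ c m * x ∣     ≡⟨ ∣p*q∣≡∣p∣*∣q∣ (c m) x ⟩
        ∣ c m ∣ * ∣ x ∣ ≤⟨ *-mono-≤ {∣ c m ∣} {1ℚ} {∣ x ∣} {y} (<⇒≤ 0<1) (0≤∣p∣ x) (c≤1 m) x≤y ⟩
        1ℚ * y          ≡⟨ *-identityˡ y ⟩
        y               ∎

      lipschitz : ∀ p q → ∣ p ∣ ≤ K → ∣ q ∣ ≤ K → ∀ n → ∣ C p n - C q n ∣ ≤ ∣ p - q ∣ * S n
      lipschitz p q p≤K q≤K zero    = ≤-reflexive (sym (*-zeroʳ ∣ p - q ∣))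
      lipschitz p q p≤K q≤K (suc n) = begin
        ∣ (C p n + c n * expTerm p n) - (C q n + c n * expTerm q n) ∣
          ≡⟨ cong ∣_∣ (solve 5 (λ A B c x y → (A :+ c :* x) :- (B :+ c :* y)
               := (A :- B) :+ c :* (x :- y)) refl (C p n) (C q n) (c n) (expTerm p n) (expTerm q n)) ⟩
        ∣ (C p n - C q n) + c n * (expTerm p n - expTerm q n) ∣
          ≤⟨ ∣p+q∣≤∣p∣+∣q∣ (C p n - C q n) (c n * (expTerm p n - expTerm q n)) ⟩
        ∣ C p n - C q n ∣ + ∣ c n * (expTerm p n - expTerm q n) ∣
          ≤⟨ +-mono-≤ (lipschitz p q p≤K q≤K n)
               (scale n (expTerm p n - expTerm q n) (∣ p - q ∣ * expTerm M n)
                 (expTerm-lipschitz p q M (+-monoˡ-≤ 1ℚ p≤K) (≤-trans q≤K K≤M) n)) ⟩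
        ∣ p - q ∣ * S n + ∣ p - q ∣ * expTerm M n
          ≡⟨ *-distribˡ-+ ∣ p - q ∣ (S n) (expTerm M n) ⟨
        ∣ p - q ∣ * (S n + expTerm M n) ∎

      dom : ∀ B → 0ℚ < B → (∀ n → ∣ S n ∣ ≤ B) → ∀ m n →
        ∣ C (s m) m - C (s n) n ∣ ≤ (B + 1ℚ) * (∣ s m - s n ∣ + ∣ S m - S n ∣)
      dom B 0<B S≤B m n = begin
        ∣ C (s m) m - C (s n) n ∣
          ≤⟨ ∣-∣-triangle (C (s m) m) (C (s n) m) (C (s n) n) ⟩
        ∣ C (s m) m - C (s n) m ∣ + ∣ C (s n) m - C (s n) n ∣
          ≤⟨ +-mono-≤
               (≤-trans (lipschitz (s m) (s n) (s≤K m) (s≤K n) m)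
                 (*-monoˡ-≤-nonNeg x {{nonNegative 0≤x}} {S m} {B} (≤-trans (p≤∣p∣ (S m)) (S≤B m))))
               (partialSum-∣-∣ (λ i → c i * expTerm (s n) i) (expTerm M)
                 (λ i → scale i (expTerm (s n) i) (expTerm M i)
                          (expTerm-bound (s n) M (≤-trans (s≤K n) K≤M) i)) m n) ⟩
        x * B + y
          ≡⟨ +-identityʳ (x * B + y) ⟨
        x * B + y + 0ℚ
          ≤⟨ +-monoʳ-≤ (x * B + y) (0≤+ 0≤x (0≤* (<⇒≤ 0<B) 0≤y)) ⟩
        x * B + y + (x + B * y)
          ≡⟨ cong₂ (λ a b → x * B + a + (b + B * y)) (*-identityˡ y) (*-identityˡ x) ⟨
        x * B + 1ℚ * y + (1ℚ * x + B * y)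
          ≡⟨ solve 4 (λ x y B o → x :* B :+ o :* y :+ (o :* x :+ B :* y)
               := (B :+ o) :* (x :+ y)) refl x y B 1ℚ ⟩
        (B + 1ℚ) * (x + y) ∎
        where
        x = ∣ s m - s n ∣
        y = ∣ S m - S n ∣
        0≤x = 0≤∣p∣ (s m - s n)
        0≤y = 0≤∣p∣ (S m - S n)
        p≤∣p∣ : ∀ p → p ≤ ∣ p ∣
        p≤∣p∣ p with ≤-total 0ℚ p
        ... | inj₁ 0≤p = ≤-reflexive (sym (0≤p⇒∣p∣≡p 0≤p))
        ... | inj₂ p≤0 = ≤-trans p≤0 (0≤∣p∣ p)

    bounded : Σ[ K ∈ ℚ ] 0ℚ < K × (∀ n → ∣ s n ∣ ≤ K) →
      IsCauchy (λ n → partialSum (λ m → c m * expTerm (s n) m) n)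
    bounded (K , 0<K , s≤K) = conclude (cauchy-bounded (S K 0<K s≤K) cS)
      where
      cS : IsCauchy (S K 0<K s≤K)
      cS = cauchy-exp (M K 0<K s≤K) (0≤M K 0<K s≤K)
      conclude : Σ[ B ∈ ℚ ] 0ℚ < B × (∀ n → ∣ S K 0<K s≤K n ∣ ≤ B) →
        IsCauchy (λ n → partialSum (λ m → c m * expTerm (s n) m) n)
      conclude (B , 0<B , S≤B) = cauchy-dominated
        (λ n → partialSum (λ m → c m * expTerm (s n) m) n) s (S K 0<K s≤K) (B + 1ℚ)
        (subst (_< B + 1ℚ) (+-identityˡ 0ℚ) (+-mono-< 0<B 0<1))
        (dom K 0<K s≤K B 0<B S≤B) cs cS

  ∣cosCoeff∣≤1 : ∀ m → ∣ cosCoeff m ∣ ≤ 1ℚ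
  ∣cosCoeff∣≤1 0                         = ≤-refl
  ∣cosCoeff∣≤1 1                         = <⇒≤ 0<1
  ∣cosCoeff∣≤1 2                         = ≤-refl
  ∣cosCoeff∣≤1 3                         = <⇒≤ 0<1
  ∣cosCoeff∣≤1 (suc (suc (suc (suc m)))) = ∣cosCoeff∣≤1 m

  ∣sinCoeff∣≤1 : ∀ m → ∣ sinCoeff m ∣ ≤ 1ℚ
  ∣sinCoeff∣≤1 0                         = <⇒≤ 0<1
  ∣sinCoeff∣≤1 1                         = ≤-refl
  ∣sinCoeff∣≤1 2                         = <⇒≤ 0<1
  ∣sinCoeff∣≤1 3                         = ≤-refl
  ∣sinCoeff∣≤1 (suc (suc (suc (suc m)))) = ∣sinCoeff∣≤1 m

record ℝ : Set where
  constructor mkℝ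
  field
    seq    : ℕ → ℚ
    cauchy : IsCauchy seq

open ℝ public

infix  4 _≤_ _<_ _≈_
infixl 6 _+_ _-_
infixl 7 _*_
infixr 8 _^_

_≤_ : ℝ → ℝ → Set
x ≤ y = ∀ ε → 0ℚ ℚ.< ε → ∃[ N ] (∀ n → N ℕ.≤ n → seq x n ℚ.≤ seq y n ℚ.+ ε)

_<_ : ℝ → ℝ → Set
x < y = Σ[ ε ∈ ℚ ] 0ℚ ℚ.< ε × ∃[ N ] (∀ n → N ℕ.≤ n → seq x n ℚ.+ ε ℚ.≤ seq y n)

_≈_ : ℝ → ℝ → Set
x ≈ y = x ≤ y × y ≤ x

fromℚ : ℚ → ℝ
fromℚ q = mkℝ (λ _ → q) (CauchyLemmas.cauchy-const q)

fromℕ : ℕ → ℝ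
fromℕ n = fromℚ (+ n ℚ./ 1)

0ℝ 1ℝ : ℝ
0ℝ = fromℚ 0ℚ
1ℝ = fromℚ 1ℚ

_+_ : ℝ → ℝ → ℝ
x + y = mkℝ (λ n → seq x n ℚ.+ seq y n)
            (CauchyLemmas.cauchy-+ (seq x) (seq y) (cauchy x) (cauchy y))

-_ : ℝ → ℝ
- x = mkℝ (λ n → ℚ.- seq x n) (CauchyLemmas.cauchy-neg (seq x) (cauchy x))

_-_ : ℝ → ℝ → ℝ
x - y = x + (- y)

_*_ : ℝ → ℝ → ℝ
x * y = mkℝ (λ n → seq x n ℚ.* seq y n)
            (CauchyLemmas.cauchy-* (seq x) (seq y) (cauchy x) (cauchy y))

_^_ : ℝ → ℕ → ℝ
x ^ zero  = 1ℝ
x ^ suc n = x * x ^ n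

-- The n-th approximant is 1 / max (xₙ, ε), where ε is the lower bound on the
-- tail of x supplied by 0 < x; so it equals 1 / xₙ for all large n.
1/ : (x : ℝ) → 0ℝ < x → ℝ
1/ x (ε , 0<ε , N , 0+ε≤x) = mkℝ
  (λ n → CauchyLemmas.recip (seq x n ℚ.⊔ ε) (CauchyLemmas.0<p⊔ε (seq x n) 0<ε))
  (CauchyLemmas.cauchy-recip (seq x) 0<ε N
    (λ n N≤n → subst (ℚ._≤ seq x n) (ℚP.+-identityˡ ε) (0+ε≤x n N≤n)) (cauchy x))

sum : ∀ {n} → (Fin n → ℝ) → ℝ
sum = F.foldr _+_ 0ℝ

-- Σₘ cₘ xᵐ / m!, the n-th approximant being the n-th partial sum at xₙ.
expSeries : (c : ℕ → ℚ) → (∀ m → ℚ.∣ c m ∣ ℚ.≤ 1ℚ) → ℝ → ℝ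
expSeries c c≤1 x = mkℝ (λ n → partialSum (λ m → c m ℚ.* expTerm (seq x n) m) n)
  (CauchyLemmas.cauchy-powerSeries c (seq x) c≤1 (cauchy x))

cos sin : ℝ → ℝ
cos = expSeries cosCoeff CauchyLemmas.∣cosCoeff∣≤1
sin = expSeries sinCoeff CauchyLemmas.∣sinCoeff∣≤1

π : ℝ
π = mkℝ (partialSum πTerm) CauchyLemmas.cauchy-π

infix  4 _≈ᶜ_
infixl 6 _+ᶜ_
infixl 7 _*ᶜ_

record ℂ : Set where
  constructor _+i_
  field
    re im : ℝ

open ℂ public

_≈ᶜ_ : ℂ → ℂ → Set
z ≈ᶜ w = re z ≈ re w × im z ≈ im w

0ℂ : ℂ
0ℂ = 0ℝ +i 0ℝ

_+ᶜ_ _*ᶜ_ : ℂ → ℂ → ℂ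
z +ᶜ w = (re z + re w) +i (im z + im w)
z *ᶜ w = (re z * re w - im z * im w) +i (re z * im w + im z * re w)

∣_∣² : ℂ → ℝ
∣ z ∣² = re z * re z + im z * im z

-- cis θ = e^{iθ}
cis : ℝ → ℂ
cis θ = cos θ +i sin θ

sumᶜ : ∀ {n} → (Fin n → ℂ) → ℂ
sumᶜ = F.foldr _+ᶜ_ 0ℂ

⟨_,_⟩ : ∀ {d} → Vec ℝ d → Vec ℝ d → ℝ
⟨ f , t ⟩ = foldr′ _+_ 0ℝ (zipWith _*_ f t)

-- The frequencies need not be distinct and the coefficients may vanish.
FourierSparse : ∀ {d} → ℕ → (Vec ℝ d → ℂ) → Set
FourierSparse {d} k x =
  Σ[ v ∈ (Fin k → ℂ) ] Σ[ f ∈ (Fin k → Vec ℝ d) ]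
    (∀ t → x t ≈ᶜ sumᶜ (λ j → v j *ᶜ cis (fromℕ 2 * π * ⟨ f j , t ⟩)))

InCube : ∀ {d} → ℝ → Vec ℝ d → Set
InCube T = All (λ s → 0ℝ ≤ s × s ≤ T)

multiSum : ∀ d {n} → (Vec (Fin n) d → ℝ) → ℝ
multiSum zero    g = g []
multiSum (suc d) g = sum (λ i → multiSum d (λ is → g (i ∷ is)))

InCell : ℝ → (n : ℕ) → .{{_ : ℕ.NonZero n}} → Fin n → ℝ → Set
InCell T n i s = fromℚ (+ toℕ i ℚ./ n) * T ≤ s
               × s ≤ fromℚ (+ suc (toℕ i) ℚ./ n) * T

riemannSum : ∀ {d} → ℝ → (Vec ℝ d → ℝ) → (n : ℕ) → .{{_ : ℕ.NonZero n}} →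
             (Vec (Fin n) d → Vec ℝ d) → ℝ
riemannSum {d} T g n tag =
  (fromℚ (+ 1 ℚ./ n) * T) ^ d * multiSum d (λ is → g (tag is))

-- I is the integral of g: Riemann sums over the division of the cube into nᵈ
-- equal subcubes, with an arbitrary tag in each, converge to I uniformly in
-- the tags as n → ∞.
IsIntegral : ∀ {d} → ℝ → (Vec ℝ d → ℝ) → ℝ → Set
IsIntegral {d} T g I = ∀ ε → 0ℚ ℚ.< ε →
  ∃[ N ] (∀ n → .{{_ : ℕ.NonZero n}} → N ℕ.≤ n →
    ∀ (tag : Vec (Fin n) d → Vec ℝ d) → (∀ is → Pointwise (InCell T n) is (tag is)) →
      riemannSum T g n tag ≤ I + fromℚ ε × I ≤ riemannSum T g n tag + fromℚ ε)

-- N = ‖x‖²_T = T⁻ᵈ ∫_{[0,T]ᵈ} |x(t)|² dt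
IsNorm² : ∀ {d} (T : ℝ) → 0ℝ < T → (Vec ℝ d → ℂ) → ℝ → Set
IsNorm² {d} T 0<T x N =
  Σ[ I ∈ ℝ ] IsIntegral T (λ t → ∣ x t ∣²) I × N ≈ (1/ T 0<T) ^ d * I

{-# OPTIONS --safe #-}
module Submission where

-- One coordinate at a time, the cube is replaced by a grid of n points per side
-- that passes through t, so that a one-dimensional statement about samples
-- y(j) = Σ vₗ ζₗʲ with |ζₗ| = 1 remains.  For every such ζ there is a polynomial P
-- of degree O(k³) with P(0) = 1, P(ζₗ) = 0 and coefficients of ℓ²-norm O(1):
-- the product over l of (1 - z ζ̄ₗ) Σ_{i < N} (a z ζ̄ₗ)ⁱ with a = 1 - 1/(8k) and
-- N = (8k)².  On |z| = 1 the rational function (1 - z) / (1 - a z) is at most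
-- 2 / (1 + a) in modulus, so each factor enlarges the ℓ²-norm by at most
-- 1 + O(1/k).  Hence y(0) is a combination with bounded coefficients of
-- y(s), y(2s), …, y(ms) for each step s, and summing the resulting inequalities
-- over s bounds n |y(0)|² by k^{O(1)} Σ |y(j)|².  If t lies past the middle of the
-- grid the predictions run backwards.  Since ≤ on ℝ is stable under double
-- negation, the cell that contains t may be chosen classically.

import Defs
import Data.Nat as ℕ
import Data.Nat.Properties as ℕP
import Data.Rational.Properties as ℚP
import Data.Fin.Properties as FinP
import Data.Vec.Functional as F
import Algebra.Solver.Ring
import Data.Nat.Solver
open import Algebra.Bundles using (CommutativeRing)
open import Algebra.Solver.Ring.AlmostCommutativeRing using (fromCommutativeRing; _-Raw-AlmostCommutative⟶_)
open import Algebra.Structures using (IsCommutativeRing)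
open import Data.Fin as Fin using (Fin; zero; suc; toℕ)
open import Data.Integer as ℤ using (+_)
open import Data.Maybe using (Maybe; just; nothing)
open import Data.Nat using (ℕ; zero; suc)
open import Data.Product using (Σ-syntax; ∃-syntax; _×_; _,_; proj₁; proj₂)
open import Data.Rational as ℚ using (ℚ; 0ℚ; 1ℚ; ½)
open import Data.Sum using (inj₁; inj₂)
open import Data.Vec as Vec using (Vec; []; _∷_; zipWith; foldr′; head; tail)
open import Data.Vec.Relation.Binary.Pointwise.Inductive using (Pointwise; []; _∷_)
open import Data.Vec.Relation.Unary.All using (All; []; _∷_)
open import Function using (_∘_)
open import Relation.Binary.PropositionalEquality as ≡ using (_≡_)
open import Relation.Nullary using (¬_; yes; no)
open Defs using (IsCauchy; partialSum; 1/suc; expTerm; cosCoeff; sinCoeff; module CauchyLemmas)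

-- The plain product of the factors 1 - z ζ̄ₗ can have coefficients exponential in k. Dividing each
-- factor by 1 - a z ζ̄ₗ cures this but leaves power series; cutting the geometric series makes them
-- polynomials again, and N of order k² is what brings the remainder aᴺ below 1/(8k). The ℓ²-norm is
-- bounded without Parseval, by a pointwise identity between neighbouring coefficients that
-- telescopes. The total energy is at most 2 and P(0) = 1 takes 1 of it, so a single prediction
-- loses no constant at all. The bound is a pure power of k, so nothing can hide in a multiplicative
-- constant: k = 0 and k = 1 need exact arguments, and for k ≥ 2 numerical constants are absorbed
-- into powers of k. In several dimensions, fixing one coordinate only changes the amplitudes, on
-- which the one-dimensional bound does not depend; hence one factor per coordinate. The shifted
-- grid through t has exactly one point in each cell, so it is an admissible choice of tags for a
-- Riemann sum of the integral. That the integral exists is part of the claim and is proved from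
-- uniform continuity.

module RationalLemmas where
  import Data.Integer.Properties as ℤP
  import Data.Rational.Unnormalised as ℚᵘ
  import Data.Rational.Unnormalised.Properties as ℚᵘP
  open import Data.Rational
  open import Data.Rational.Properties
  open import Data.Rational.Solver using (module +-*-Solver)
  open ≡ using (refl; sym; trans; cong; subst)
  open CauchyLemmas using (0<*; recip; 0<recip; p*recip; 0<1)
  open +-*-Solver

  -- The working method for nonlinear inequalities: exhibit the slack `d` as a visibly nonnegative
  -- expression and leave the remaining identity to the ring solver.
  ≤-by : ∀ {a b} d → 0ℚ ≤ d → a + d ≡ b → a ≤ b
  ≤-by {a} d 0≤d refl = subst (_≤ a + d) (+-identityʳ a) (+-monoʳ-≤ a 0≤d)

  0≤diff : ∀ {a b} → a ≤ b → 0ℚ ≤ b - a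
  0≤diff {a} {b} a≤b = subst (_≤ b - a) (+-inverseʳ a) (+-monoˡ-≤ (- a) a≤b)

  ≤-shift : ∀ {a b c d} → a ≤ b → c + (b - a) ≡ d → c ≤ d
  ≤-shift {a} {b} a≤b = ≤-by (b - a) (0≤diff a≤b)

  p≤∣p∣ : ∀ p → p ≤ ∣ p ∣
  p≤∣p∣ p with ≤-total 0ℚ p
  ... | inj₁ 0≤p = ≤-reflexive (sym (0≤p⇒∣p∣≡p 0≤p))
  ... | inj₂ p≤0 = ≤-trans p≤0 (0≤∣p∣ p)

  -p≤∣p∣ : ∀ p → - p ≤ ∣ p ∣
  -p≤∣p∣ p = subst (- p ≤_) (∣-p∣≡∣p∣ p) (p≤∣p∣ (- p))

  ∣∣≤ : ∀ {p e} → p ≤ e → - p ≤ e → ∣ p ∣ ≤ e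
  ∣∣≤ {p} p≤e -p≤e with ∣p∣≡p∨∣p∣≡-p p
  ... | inj₁ eq = subst (_≤ _) (sym eq) p≤e
  ... | inj₂ eq = subst (_≤ _) (sym eq) -p≤e

  ∣-∣-upper : ∀ {a b e} → ∣ a - b ∣ ≤ e → a ≤ b + e
  ∣-∣-upper {a} {b} {e} h = ≤-shift (≤-trans (p≤∣p∣ (a - b)) h)
    (solve 3 (λ a b e → a :+ (e :- (a :- b)) := b :+ e) refl a b e)

  ∣-∣-lower : ∀ {a b e} → ∣ a - b ∣ ≤ e → b ≤ a + e
  ∣-∣-lower {a} {b} {e} h = ≤-shift (≤-trans (-p≤∣p∣ (a - b)) h)
    (solve 3 (λ a b e → b :+ (e :- (:- (a :- b))) := a :+ e) refl a b e)

  ∣-∣-intro : ∀ {a b e} → a ≤ b + e → b ≤ a + e → ∣ a - b ∣ ≤ e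
  ∣-∣-intro {a} {b} {e} p q = ∣∣≤
    (≤-shift p (solve 3 (λ a b e → a :- b :+ (b :+ e :- a) := e) refl a b e))
    (≤-shift q (solve 3 (λ a b e → (:- (a :- b)) :+ (a :+ e :- b) := e) refl a b e))

  -- The choice is δ = min (1, ε / K); the cap at 1 allows δ² to be absorbed into δ.
  scale-down : ∀ K ε → 0ℚ < K → 0ℚ < ε → Σ[ δ ∈ ℚ ] 0ℚ < δ × δ ≤ 1ℚ × K * δ ≤ ε
  scale-down K ε 0<K 0<ε = 1ℚ ⊓ η , 0<δ , p⊓q≤p 1ℚ η , ≤-trans
      (*-monoˡ-≤-nonNeg K {{nonNegative (<⇒≤ 0<K)}} (p⊓q≤q 1ℚ η))
      (≤-reflexive (trans (solve 3 (λ K e r → K :* (e :* r) := (K :* r) :* e) refl K ε (recip K 0<K))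
        (trans (cong (_* ε) (p*recip K 0<K)) (*-identityˡ ε))))
    where
    η = ε * recip K 0<K
    0<η : 0ℚ < η
    0<η = 0<* 0<ε (0<recip K 0<K)
    0<δ : 0ℚ < 1ℚ ⊓ η
    0<δ with ⊓-sel 1ℚ η
    ... | inj₁ eq = subst (0ℚ <_) (sym eq) 0<1
    ... | inj₂ eq = subst (0ℚ <_) (sym eq) 0<η

  fromℕ-suc : ∀ n → + suc n / 1 ≡ 1ℚ + + n / 1
  fromℕ-suc n = toℚᵘ-injective
    (ℚᵘP.≃-trans (toℚᵘ-fromℚᵘ (ℚᵘ.mkℚᵘ (+ suc n) 0))
    (ℚᵘP.≃-trans (ℚᵘ.*≡* (cong (ℤ._* + 1) (cong (λ z → + 1 ℤ.+ z) (sym (ℤP.*-identityʳ (+ n))))))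
    (ℚᵘP.≃-sym (ℚᵘP.≃-trans (toℚᵘ-homo-+ 1ℚ (+ n / 1))
      (ℚᵘP.+-congʳ (ℚᵘ.mkℚᵘ (+ 1) 0) (toℚᵘ-fromℚᵘ (ℚᵘ.mkℚᵘ (+ n) 0)))))))

  fromℕ-+ : ∀ m n → + (m ℕ.+ n) / 1 ≡ + m / 1 + + n / 1
  fromℕ-+ zero    n = sym (+-identityˡ (+ n / 1))
  fromℕ-+ (suc m) n = trans (fromℕ-suc (m ℕ.+ n)) (trans (cong (λ z → 1ℚ + z) (fromℕ-+ m n))
    (trans (sym (+-assoc 1ℚ (+ m / 1) (+ n / 1))) (cong (λ z → z + + n / 1) (sym (fromℕ-suc m)))))

  fromℕ-* : ∀ m n → + (m ℕ.* n) / 1 ≡ + m / 1 * (+ n / 1)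
  fromℕ-* m n = sym (CauchyLemmas.frac-* {m} {0} {n} {0})

  suc*1/suc : ∀ n → + suc n / 1 * 1/suc n ≡ 1ℚ
  suc*1/suc n = trans (CauchyLemmas.frac-* {suc n} {0} {1} {n})
    (≤-antisym (CauchyLemmas.frac-≤ {suc n ℕ.* 1} {1 ℕ.* suc n} {1} {1} (ℕP.≤-reflexive eq))
               (CauchyLemmas.frac-≤ {1} {1} {suc n ℕ.* 1} {1 ℕ.* suc n} (ℕP.≤-reflexive (sym eq))))
    where
    eq : suc n ℕ.* 1 ℕ.* 1 ≡ 1 ℕ.* (1 ℕ.* suc n)
    eq = trans (ℕP.*-identityʳ (suc n ℕ.* 1)) (trans (ℕP.*-comm (suc n) 1) (sym (ℕP.*-identityˡ (1 ℕ.* suc n))))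

-- Cauchy products of series and the addition law of the exponential series

module Convolution where
  open import Data.Rational
  open import Data.Rational.Properties
  open import Data.Rational.Solver using (module +-*-Solver)
  open ≡ using (refl; sym; trans; cong; cong₂; subst)
  open CauchyLemmas using (0≤*; 0≤+; partialSum-shift; *-mono-≤)
  open RationalLemmas
  open +-*-Solver
  open ≤-Reasoning

  conv : (ℕ → ℚ) → (ℕ → ℚ) → ℕ → ℚ
  conv a b zero    = a 0 * b 0
  conv a b (suc m) = a 0 * b (suc m) + conv (a ∘ suc) b m

  conv-cong : ∀ {a a′ b b′} → (∀ i → a i ≡ a′ i) → (∀ j → b j ≡ b′ j) →
    ∀ m → conv a b m ≡ conv a′ b′ m
  conv-cong p q zero    = cong₂ _*_ (p 0) (q 0)
  conv-cong p q (suc m) = cong₂ _+_ (cong₂ _*_ (p 0) (q (suc m))) (conv-cong (p ∘ suc) q m)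

  conv-scaleˡ : ∀ c a b m → conv (λ i → c * a i) b m ≡ c * conv a b m
  conv-scaleˡ c a b zero    = *-assoc c (a 0) (b 0)
  conv-scaleˡ c a b (suc m) = trans
    (cong (λ z → c * a 0 * b (suc m) + z) (conv-scaleˡ c (a ∘ suc) b m))
    (solve 4 (λ c a b v → c :* a :* b :+ c :* v := c :* (a :* b :+ v)) refl
      c (a 0) (b (suc m)) (conv (a ∘ suc) b m))

  conv-scaleʳ : ∀ c a b m → conv a (λ j → c * b j) m ≡ c * conv a b m
  conv-scaleʳ c a b zero    = solve 3 (λ c a b → a :* (c :* b) := c :* (a :* b)) refl c (a 0) (b 0)
  conv-scaleʳ c a b (suc m) = trans
    (cong (λ z → a 0 * (c * b (suc m)) + z) (conv-scaleʳ c (a ∘ suc) b m))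
    (solve 4 (λ c a b v → a :* (c :* b) :+ c :* v := c :* (a :* b :+ v)) refl
      c (a 0) (b (suc m)) (conv (a ∘ suc) b m))

  conv-sucˡ : ∀ a b m → a 0 ≡ 0ℚ → conv a b (suc m) ≡ conv (a ∘ suc) b m
  conv-sucˡ a b m a0 = trans (cong (λ z → z * b (suc m) + conv (a ∘ suc) b m) a0)
    (trans (cong (λ z → z + conv (a ∘ suc) b m) (*-zeroˡ (b (suc m)))) (+-identityˡ (conv (a ∘ suc) b m)))

  conv-sucʳ : ∀ a b m → b 0 ≡ 0ℚ → conv a b (suc m) ≡ conv a (b ∘ suc) m
  conv-sucʳ a b zero b0 = trans (cong (λ z → a 0 * b 1 + a 1 * z) b0)
    (trans (cong (λ z → a 0 * b 1 + z) (*-zeroʳ (a 1))) (+-identityʳ (a 0 * b 1)))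
  conv-sucʳ a b (suc m) b0 = cong (λ z → a 0 * b (suc (suc m)) + z) (conv-sucʳ (a ∘ suc) b m b0)

  -- One statement serves two purposes: the weights i + j = i · 1 + 1 · j give the Leibniz rule
  -- behind `conv-exp`, and the real and imaginary parts of powers of the imaginary unit give the
  -- addition formulas of cos and sin.
  conv-weighted : ∀ σ (C c c′ s s′ : ℕ → ℚ) →
    (∀ i j → C (i ℕ.+ j) ≡ c i * c′ j + σ * (s i * s′ j)) → ∀ a b m →
    conv (λ i → c i * a i) (λ j → c′ j * b j) m
      + σ * conv (λ i → s i * a i) (λ j → s′ j * b j) m ≡ C m * conv a b m
  conv-weighted σ C c c′ s s′ h a b zero = trans
    (solve 7 (λ g c c′ s s′ a b → (c :* a) :* (c′ :* b) :+ g :* ((s :* a) :* (s′ :* b))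
        := (c :* c′ :+ g :* (s :* s′)) :* (a :* b)) refl σ (c 0) (c′ 0) (s 0) (s′ 0) (a 0) (b 0))
    (cong (_* (a 0 * b 0)) (sym (h 0 0)))
  conv-weighted σ C c c′ s s′ h a b (suc m) = trans
    (solve 9 (λ g c c′ s s′ a b u v →
         (c :* a) :* (c′ :* b) :+ u :+ g :* ((s :* a) :* (s′ :* b) :+ v)
      := (c :* c′ :+ g :* (s :* s′)) :* (a :* b) :+ (u :+ g :* v)) refl
        σ (c 0) (c′ (suc m)) (s 0) (s′ (suc m)) (a 0) (b (suc m)) u v)
    (trans (cong₂ (λ y z → y * (a 0 * b (suc m)) + z) (sym (h 0 (suc m)))
        (conv-weighted σ (C ∘ suc) (c ∘ suc) c′ (s ∘ suc) s′ (λ i j → h (suc i) j) (a ∘ suc) b m))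
      (sym (*-distribˡ-+ (C (suc m)) (a 0 * b (suc m)) (conv (a ∘ suc) b m))))
    where
    u = conv (λ i → c (suc i) * a (suc i)) (λ j → c′ j * b j) m
    v = conv (λ i → s (suc i) * a (suc i)) (λ j → s′ j * b j) m

  conv-nonneg : ∀ {a b} → (∀ i → 0ℚ ≤ a i) → (∀ j → 0ℚ ≤ b j) → ∀ m → 0ℚ ≤ conv a b m
  conv-nonneg {a} {b} p q zero    = 0≤* {a 0} {b 0} (p 0) (q 0)
  conv-nonneg {a} {b} p q (suc m) = 0≤+ {a 0 * b (suc m)} {conv (a ∘ suc) b m}
    (0≤* {a 0} {b (suc m)} (p 0) (q (suc m))) (conv-nonneg (p ∘ suc) q m)

  partialSum-cong : ∀ {a b} → (∀ i → a i ≡ b i) → ∀ n → partialSum a n ≡ partialSum b n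
  partialSum-cong h zero    = refl
  partialSum-cong h (suc n) = cong₂ _+_ (partialSum-cong h n) (h n)

  partialSum-linear : ∀ σ a b n →
    partialSum (λ m → a m + σ * b m) n ≡ partialSum a n + σ * partialSum b n
  partialSum-linear σ a b zero    = solve 1 (λ g → con 0ℚ := con 0ℚ :+ g :* con 0ℚ) refl σ
  partialSum-linear σ a b (suc n) = trans
    (cong (_+ (a n + σ * b n)) (partialSum-linear σ a b n))
    (solve 5 (λ g a b x y → (x :+ g :* y) :+ (a :+ g :* b) := (x :+ a) :+ g :* (y :+ b)) refl
      σ (a n) (b n) (partialSum a n) (partialSum b n))

  partialSum-nonneg : ∀ {a} → (∀ i → 0ℚ ≤ a i) → ∀ n → 0ℚ ≤ partialSum a n
  partialSum-nonneg p zero = ≤-refl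
  partialSum-nonneg {a} p (suc n) = 0≤+ {partialSum a n} {a n} (partialSum-nonneg p n) (p n)

  partialSum-mono : ∀ {a} → (∀ i → 0ℚ ≤ a i) → ∀ j n → partialSum a n ≤ partialSum a (j ℕ.+ n)
  partialSum-mono p zero n = ≤-refl
  partialSum-mono {a} p (suc j) n = ≤-trans (partialSum-mono p j n)
    (≤-by (a (j ℕ.+ n)) (p (j ℕ.+ n)) refl)

  partialSum-head : ∀ a n → partialSum a (suc n) ≡ a 0 + partialSum (a ∘ suc) n
  partialSum-head a zero    = trans (+-identityˡ (a 0)) (sym (+-identityʳ (a 0)))
  partialSum-head a (suc n) = trans (cong (_+ a (suc n)) (partialSum-head a n))
    (+-assoc (a 0) (partialSum (a ∘ suc) n) (a (suc n)))

  partialSum-conv-head : ∀ a b n → partialSum (conv a b) (suc n)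
    ≡ a 0 * partialSum b (suc n) + partialSum (conv (a ∘ suc) b) n
  partialSum-conv-head a b zero =
    solve 2 (λ a b → con 0ℚ :+ a :* b := a :* (con 0ℚ :+ b) :+ con 0ℚ) refl (a 0) (b 0)
  partialSum-conv-head a b (suc n) = trans
    (cong (_+ conv a b (suc n)) (partialSum-conv-head a b n))
    (solve 5 (λ a p q b v → (a :* p :+ q) :+ (a :* b :+ v) := a :* (p :+ b) :+ (q :+ v)) refl
      (a 0) (partialSum b (suc n)) (partialSum (conv (a ∘ suc) b) n) (b (suc n)) (conv (a ∘ suc) b n))

  -- For n ≤ N this is the sum of aᵢ bⱼ over i < n, j < N, n ≤ i + j: the part of the rectangle
  -- outside the triangle.
  excess : (ℕ → ℚ) → (ℕ → ℚ) → ℕ → ℕ → ℚ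
  excess a b n N = partialSum a n * partialSum b N - partialSum (conv a b) n

  excess-suc : ∀ a b n N → excess a b (suc n) N
    ≡ a 0 * (partialSum b N - partialSum b (suc n)) + excess (a ∘ suc) b n N
  excess-suc a b n N = trans
    (cong₂ (λ x y → x * partialSum b N - y) (partialSum-head a n) (partialSum-conv-head a b n))
    (solve 5 (λ a p B b q → (a :+ p) :* B :- (a :* b :+ q) := a :* (B :- b) :+ (p :* B :- q)) refl
      (a 0) (partialSum (a ∘ suc) n) (partialSum b N) (partialSum b (suc n))
      (partialSum (conv (a ∘ suc) b) n))

  -- The index set of the excess is the same for all sequences, so bounds on the terms carry over.
  -- The second length is written j + n because peeling off a term of `a` lowers n and raises j.
  excess-bound : ∀ a b A B → (∀ i → ∣ a i ∣ ≤ A i) → (∀ j → ∣ b j ∣ ≤ B j) → ∀ n j →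
    ∣ excess a b n (j ℕ.+ n) ∣ ≤ excess A B n (j ℕ.+ n)
  excess-bound a b A B p q zero j = ≤-reflexive (trans
    (cong ∣_∣ (solve 1 (λ x → con 0ℚ :* x :- con 0ℚ := con 0ℚ) refl (partialSum b (j ℕ.+ 0))))
    (solve 1 (λ x → con 0ℚ := con 0ℚ :* x :- con 0ℚ) refl (partialSum B (j ℕ.+ 0))))
  excess-bound a b A B p q (suc n) j = begin
    ∣ excess a b (suc n) N ∣
      ≡⟨ cong ∣_∣ (excess-suc a b n N) ⟩
    ∣ a 0 * t + excess (a ∘ suc) b n N ∣
      ≤⟨ ∣p+q∣≤∣p∣+∣q∣ (a 0 * t) (excess (a ∘ suc) b n N) ⟩
    ∣ a 0 * t ∣ + ∣ excess (a ∘ suc) b n N ∣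
      ≡⟨ cong (_+ ∣ excess (a ∘ suc) b n N ∣) (∣p*q∣≡∣p∣*∣q∣ (a 0) t) ⟩
    ∣ a 0 ∣ * ∣ t ∣ + ∣ excess (a ∘ suc) b n N ∣
      ≤⟨ +-mono-≤ (*-mono-≤ {∣ a 0 ∣} {A 0} {∣ t ∣} {T} (≤-trans (0≤∣p∣ (a 0)) (p 0)) (0≤∣p∣ t) (p 0)
            (partialSum-shift b B q j (suc n)))
           (subst (λ k → ∣ excess (a ∘ suc) b n k ∣ ≤ excess (A ∘ suc) B n k) (sym (ℕP.+-suc j n))
             (excess-bound (a ∘ suc) b (A ∘ suc) B (p ∘ suc) q n (suc j))) ⟩
    A 0 * T + excess (A ∘ suc) B n N
      ≡⟨ excess-suc A B n N ⟨
    excess A B (suc n) N ∎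
    where
    N = j ℕ.+ suc n
    t = partialSum b N - partialSum b (suc n)
    T = partialSum B N - partialSum B (suc n)

  -- The rectangle i < n, j < N lies inside the triangle i + j < n + N, and all terms are
  -- nonnegative.
  product≤partialSum-conv : ∀ A B → (∀ i → 0ℚ ≤ A i) → (∀ j → 0ℚ ≤ B j) → ∀ n N →
    partialSum A n * partialSum B N ≤ partialSum (conv A B) (n ℕ.+ N)
  product≤partialSum-conv A B p q zero N = ≤-trans (≤-reflexive (*-zeroˡ (partialSum B N)))
    (partialSum-nonneg (conv-nonneg p q) N)
  product≤partialSum-conv A B p q (suc n) N = begin
    partialSum A (suc n) * partialSum B N
      ≡⟨ cong (_* partialSum B N) (partialSum-head A n) ⟩
    (A 0 + partialSum (A ∘ suc) n) * partialSum B N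
      ≡⟨ *-distribʳ-+ (partialSum B N) (A 0) (partialSum (A ∘ suc) n) ⟩
    A 0 * partialSum B N + partialSum (A ∘ suc) n * partialSum B N
      ≤⟨ +-mono-≤ (*-monoˡ-≤-nonNeg (A 0) {{nonNegative (p 0)}} (partialSum-mono q (suc n) N))
                  (product≤partialSum-conv (A ∘ suc) B (p ∘ suc) q n N) ⟩
    A 0 * partialSum B (suc n ℕ.+ N) + partialSum (conv (A ∘ suc) B) (n ℕ.+ N)
      ≡⟨ partialSum-conv-head A B (n ℕ.+ N) ⟨
    partialSum (conv A B) (suc n ℕ.+ N) ∎

  product-partialSum : ∀ a b A B → (∀ i → ∣ a i ∣ ≤ A i) → (∀ j → ∣ b j ∣ ≤ B j) → ∀ n →
    ∣ partialSum a n * partialSum b n - partialSum (conv a b) n ∣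
      ≤ partialSum (conv A B) (n ℕ.+ n) - partialSum (conv A B) n
  product-partialSum a b A B p q n = ≤-trans (excess-bound a b A B p q n 0)
    (+-monoˡ-≤ (- partialSum (conv A B) n) (product≤partialSum-conv A B
      (λ i → ≤-trans (0≤∣p∣ (a i)) (p i)) (λ j → ≤-trans (0≤∣p∣ (b j)) (q j)) n n))

  -- Instead of binomial coefficients, the differential equation of the exponential is used
  -- coefficientwise: (i + 1) eᵢ₊₁ = q eᵢ. The Leibniz rule shows that the Cauchy product satisfies
  -- the same recursion with x + y.
  conv-exp : ∀ x y m → conv (expTerm x) (expTerm y) m ≡ expTerm (x + y) m
  conv-exp x y zero    = refl
  conv-exp x y (suc m) = begin-equality
    conv ex ey (suc m)
      ≡⟨ *-identityˡ (conv ex ey (suc m)) ⟨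
    1ℚ * conv ex ey (suc m)
      ≡⟨ cong (_* conv ex ey (suc m)) (trans (*-comm (1/suc m) (w (suc m))) (suc*1/suc m)) ⟨
    (1/suc m * w (suc m)) * conv ex ey (suc m)
      ≡⟨ *-assoc (1/suc m) (w (suc m)) (conv ex ey (suc m)) ⟩
    1/suc m * (w (suc m) * conv ex ey (suc m))
      ≡⟨ cong (1/suc m *_) leibniz ⟩
    1/suc m * ((x + y) * conv ex ey m)
      ≡⟨ cong (λ z → 1/suc m * ((x + y) * z)) (conv-exp x y m) ⟩
    1/suc m * ((x + y) * expTerm (x + y) m)
      ≡⟨ solve 3 (λ r s e → r :* (s :* e) := e :* (s :* r)) refl (1/suc m) (x + y) (expTerm (x + y) m) ⟩
    expTerm (x + y) (suc m) ∎
    where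
    ex = expTerm x
    ey = expTerm y
    w : ℕ → ℚ
    w n = + n / 1
    derive : ∀ q i → w (suc i) * expTerm q (suc i) ≡ q * expTerm q i
    derive q i = trans
      (solve 4 (λ w e q r → w :* (e :* (q :* r)) := (w :* r) :* (q :* e)) refl
        (w (suc i)) (expTerm q i) q (1/suc i))
      (trans (cong (_* (q * expTerm q i)) (suc*1/suc i)) (*-identityˡ (q * expTerm q i)))
    leibniz : w (suc m) * conv ex ey (suc m) ≡ (x + y) * conv ex ey m
    leibniz = begin-equality
      w (suc m) * conv ex ey (suc m)
        ≡⟨ conv-weighted 1ℚ w w (λ _ → 1ℚ) (λ _ → 1ℚ) w
             (λ i j → trans (fromℕ-+ i j) (solve 2 (λ a b → a :+ b
               := a :* con 1ℚ :+ con 1ℚ :* (con 1ℚ :* b)) refl (w i) (w j))) ex ey (suc m) ⟨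
      conv (λ i → w i * ex i) (λ j → 1ℚ * ey j) (suc m)
        + 1ℚ * conv (λ i → 1ℚ * ex i) (λ j → w j * ey j) (suc m)
        ≡⟨ cong₂ (λ u v → u + 1ℚ * v)
             (conv-sucˡ (λ i → w i * ex i) (λ j → 1ℚ * ey j) m (*-zeroˡ (ex 0)))
             (conv-sucʳ (λ i → 1ℚ * ex i) (λ j → w j * ey j) m (*-zeroˡ (ey 0))) ⟩
      conv (λ i → w (suc i) * ex (suc i)) (λ j → 1ℚ * ey j) m
        + 1ℚ * conv (λ i → 1ℚ * ex i) (λ j → w (suc j) * ey (suc j)) m
        ≡⟨ cong₂ (λ u v → u + 1ℚ * v)
             (trans (conv-cong (derive x) (λ j → *-identityˡ (ey j)) m) (conv-scaleˡ x ex ey m))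
             (trans (conv-cong (λ i → *-identityˡ (ex i)) (derive y) m) (conv-scaleʳ y ex ey m)) ⟩
      x * conv ex ey m + 1ℚ * (y * conv ex ey m)
        ≡⟨ solve 3 (λ x y v → x :* v :+ con 1ℚ :* (y :* v) := (x :+ y) :* v) refl x y (conv ex ey m) ⟩
      (x + y) * conv ex ey m ∎

-- Addition, parity and Lipschitz estimates for the partial sums of cos and sin

module Trigonometry where
  open import Data.Rational
  open import Data.Rational.Properties
  open import Data.Rational.Solver using (module +-*-Solver)
  open ≡ using (refl; sym; trans; cong; cong₂)
  open RationalLemmas
  open Convolution
  open CauchyLemmas using (expTerm-bound; *-mono-≤; 0<1)
  open +-*-Solver
  open ≤-Reasoning

  cosCoeff-suc : ∀ m → cosCoeff (suc m) ≡ - sinCoeff m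
  cosCoeff-suc 0 = refl
  cosCoeff-suc 1 = refl
  cosCoeff-suc 2 = refl
  cosCoeff-suc 3 = refl
  cosCoeff-suc (suc (suc (suc (suc m)))) = cosCoeff-suc m

  sinCoeff-suc : ∀ m → sinCoeff (suc m) ≡ cosCoeff m
  sinCoeff-suc 0 = refl
  sinCoeff-suc 1 = refl
  sinCoeff-suc 2 = refl
  sinCoeff-suc 3 = refl
  sinCoeff-suc (suc (suc (suc (suc m)))) = sinCoeff-suc m

  -- Real and imaginary part of the exponent law for the imaginary unit, with the signs -1 and 1
  -- kept as explicit factors to match σ in `conv-weighted`.
  coeff-+ : ∀ i j →
    cosCoeff (i ℕ.+ j) ≡ cosCoeff i * cosCoeff j + (- 1ℚ) * (sinCoeff i * sinCoeff j)
    × sinCoeff (i ℕ.+ j) ≡ cosCoeff i * sinCoeff j + 1ℚ * (sinCoeff i * cosCoeff j)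
  coeff-+ zero j =
      solve 2 (λ c s → c := con 1ℚ :* c :+ (:- con 1ℚ) :* (con 0ℚ :* s)) refl (cosCoeff j) (sinCoeff j)
    , solve 2 (λ c s → s := con 1ℚ :* s :+ con 1ℚ :* (con 0ℚ :* c)) refl (cosCoeff j) (sinCoeff j)
  coeff-+ (suc i) j with coeff-+ i j
  ... | pc , ps = (begin-equality
      cosCoeff (suc (i ℕ.+ j))
        ≡⟨ trans (cosCoeff-suc (i ℕ.+ j)) (cong -_ ps) ⟩
      - (c * s′ + 1ℚ * (s * c′))
        ≡⟨ solve 4 (λ c s c′ s′ → :- (c :* s′ :+ con 1ℚ :* (s :* c′))
             := (:- s) :* c′ :+ (:- con 1ℚ) :* (c :* s′)) refl c s c′ s′ ⟩
      (- s) * c′ + (- 1ℚ) * (c * s′)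
        ≡⟨ cong₂ (λ u v → u * c′ + (- 1ℚ) * (v * s′)) (cosCoeff-suc i) (sinCoeff-suc i) ⟨
      cosCoeff (suc i) * c′ + (- 1ℚ) * (sinCoeff (suc i) * s′) ∎)
    , (begin-equality
      sinCoeff (suc (i ℕ.+ j))
        ≡⟨ trans (sinCoeff-suc (i ℕ.+ j)) pc ⟩
      c * c′ + (- 1ℚ) * (s * s′)
        ≡⟨ solve 4 (λ c s c′ s′ → c :* c′ :+ (:- con 1ℚ) :* (s :* s′)
             := (:- s) :* s′ :+ con 1ℚ :* (c :* c′)) refl c s c′ s′ ⟩
      (- s) * s′ + 1ℚ * (c * c′)
        ≡⟨ cong₂ (λ u v → u * s′ + 1ℚ * (v * c′)) (cosCoeff-suc i) (sinCoeff-suc i) ⟨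
      cosCoeff (suc i) * s′ + 1ℚ * (sinCoeff (suc i) * c′) ∎)
    where
    c = cosCoeff i
    s = sinCoeff i
    c′ = cosCoeff j
    s′ = sinCoeff j

  series : (ℕ → ℚ) → ℚ → ℕ → ℚ
  series c q = partialSum (λ m → c m * expTerm q m)

  term-bound : ∀ (c : ℕ → ℚ) q M → (∀ m → ∣ c m ∣ ≤ 1ℚ) → ∣ q ∣ ≤ M → ∀ m → ∣ c m * expTerm q m ∣ ≤ expTerm M m
  term-bound c q M c≤1 q≤M m = begin
    ∣ c m * expTerm q m ∣     ≡⟨ ∣p*q∣≡∣p∣*∣q∣ (c m) (expTerm q m) ⟩
    ∣ c m ∣ * ∣ expTerm q m ∣ ≤⟨ *-mono-≤ {∣ c m ∣} {1ℚ} {∣ expTerm q m ∣} {expTerm M m}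
                                   (<⇒≤ 0<1) (0≤∣p∣ (expTerm q m)) (c≤1 m) (expTerm-bound q M q≤M m) ⟩
    1ℚ * expTerm M m          ≡⟨ *-identityˡ (expTerm M m) ⟩
    expTerm M m               ∎

  series-+ : ∀ σ (C c c′ s s′ : ℕ → ℚ) →
    (∀ i j → C (i ℕ.+ j) ≡ c i * c′ j + σ * (s i * s′ j)) →
    ∀ x y n → series C (x + y) n ≡
      partialSum (conv (λ i → c i * expTerm x i) (λ j → c′ j * expTerm y j)) n
      + σ * partialSum (conv (λ i → s i * expTerm x i) (λ j → s′ j * expTerm y j)) n
  series-+ σ C c c′ s s′ h x y n = trans
    (partialSum-cong (λ m → trans (cong (C m *_) (sym (conv-exp x y m)))
      (sym (conv-weighted σ C c c′ s s′ h (expTerm x) (expTerm y) m))) n)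
    (partialSum-linear σ (conv (λ i → c i * expTerm x i) (λ j → c′ j * expTerm y j))
      (conv (λ i → s i * expTerm x i) (λ j → s′ j * expTerm y j)) n)

  -- The error is a tail of the exponential series at 2M, uniform in |x|, |y| ≤ M. Uniformity is
  -- essential because the approximants of cos x are partial sums evaluated at the moving points xₙ.
  series-+-bound : ∀ σ (C c c′ s s′ : ℕ → ℚ) → ∣ σ ∣ ≡ 1ℚ →
    (∀ i j → C (i ℕ.+ j) ≡ c i * c′ j + σ * (s i * s′ j)) →
    (∀ m → ∣ c m ∣ ≤ 1ℚ) → (∀ m → ∣ c′ m ∣ ≤ 1ℚ) → (∀ m → ∣ s m ∣ ≤ 1ℚ) → (∀ m → ∣ s′ m ∣ ≤ 1ℚ) →
    ∀ x y M n → ∣ x ∣ ≤ M → ∣ y ∣ ≤ M →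
    ∣ (series c x n * series c′ y n + σ * (series s x n * series s′ y n)) - series C (x + y) n ∣
      ≤ (partialSum (expTerm (M + M)) (n ℕ.+ n) - partialSum (expTerm (M + M)) n)
      + (partialSum (expTerm (M + M)) (n ℕ.+ n) - partialSum (expTerm (M + M)) n)
  series-+-bound σ C c c′ s s′ ∣σ∣ h c≤ c′≤ s≤ s′≤ x y M n x≤M y≤M = begin
    ∣ (P + σ * Q) - series C (x + y) n ∣
      ≡⟨ cong (λ z → ∣ (P + σ * Q) - z ∣) (series-+ σ C c c′ s s′ h x y n) ⟩
    ∣ (P + σ * Q) - (P′ + σ * Q′) ∣
      ≡⟨ cong ∣_∣ (solve 5 (λ g p q p′ q′ → (p :+ g :* q) :- (p′ :+ g :* q′)
           := (p :- p′) :+ g :* (q :- q′)) refl σ P Q P′ Q′) ⟩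
    ∣ (P - P′) + σ * (Q - Q′) ∣
      ≤⟨ ∣p+q∣≤∣p∣+∣q∣ (P - P′) (σ * (Q - Q′)) ⟩
    ∣ P - P′ ∣ + ∣ σ * (Q - Q′) ∣
      ≡⟨ cong (λ z → ∣ P - P′ ∣ + z) (trans (∣p*q∣≡∣p∣*∣q∣ σ (Q - Q′))
           (trans (cong (_* ∣ Q - Q′ ∣) ∣σ∣) (*-identityˡ ∣ Q - Q′ ∣))) ⟩
    ∣ P - P′ ∣ + ∣ Q - Q′ ∣
      ≤⟨ +-mono-≤ (bound c c′ c≤ c′≤) (bound s s′ s≤ s′≤) ⟩
    D + D ∎
    where
    P = series c x n * series c′ y n
    Q = series s x n * series s′ y n
    P′ = partialSum (conv (λ i → c i * expTerm x i) (λ j → c′ j * expTerm y j)) n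
    Q′ = partialSum (conv (λ i → s i * expTerm x i) (λ j → s′ j * expTerm y j)) n
    D = partialSum (expTerm (M + M)) (n ℕ.+ n) - partialSum (expTerm (M + M)) n
    bound : ∀ a b → (∀ m → ∣ a m ∣ ≤ 1ℚ) → (∀ m → ∣ b m ∣ ≤ 1ℚ) →
      ∣ series a x n * series b y n
        - partialSum (conv (λ i → a i * expTerm x i) (λ j → b j * expTerm y j)) n ∣ ≤ D
    bound a b a≤ b≤ = ≤-trans
      (product-partialSum (λ i → a i * expTerm x i) (λ j → b j * expTerm y j) (expTerm M) (expTerm M)
        (term-bound a x M a≤ x≤M) (term-bound b y M b≤ y≤M) n)
      (≤-reflexive (cong₂ _-_ (partialSum-cong (conv-exp M M) (n ℕ.+ n)) (partialSum-cong (conv-exp M M) n)))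

  -- Both parities share one induction because passing from m to m + 1 exchanges the two coefficient
  -- sequences up to sign.
  term-neg : ∀ q m → cosCoeff m * expTerm (- q) m ≡ cosCoeff m * expTerm q m
                   × sinCoeff m * expTerm (- q) m ≡ - (sinCoeff m * expTerm q m)
  term-neg q zero    = refl , refl
  term-neg q (suc m) with term-neg q m
  ... | pc , ps = (begin-equality
      cosCoeff (suc m) * (e′ * (- q * r))
        ≡⟨ cong (_* (e′ * (- q * r))) (cosCoeff-suc m) ⟩
      (- s) * (e′ * (- q * r))
        ≡⟨ solve 4 (λ s e q r → (:- s) :* (e :* ((:- q) :* r)) := (s :* e) :* (q :* r)) refl s e′ q r ⟩
      (s * e′) * (q * r)
        ≡⟨ cong (_* (q * r)) ps ⟩
      (- (s * e)) * (q * r)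
        ≡⟨ solve 4 (λ s e q r → (:- (s :* e)) :* (q :* r) := (:- s) :* (e :* (q :* r))) refl s e q r ⟩
      (- s) * (e * (q * r))
        ≡⟨ cong (_* (e * (q * r))) (cosCoeff-suc m) ⟨
      cosCoeff (suc m) * (e * (q * r)) ∎)
    , (begin-equality
      sinCoeff (suc m) * (e′ * (- q * r))
        ≡⟨ cong (_* (e′ * (- q * r))) (sinCoeff-suc m) ⟩
      c * (e′ * (- q * r))
        ≡⟨ solve 4 (λ c e q r → c :* (e :* ((:- q) :* r)) := :- ((c :* e) :* (q :* r))) refl c e′ q r ⟩
      - ((c * e′) * (q * r))
        ≡⟨ cong (λ z → - (z * (q * r))) pc ⟩
      - ((c * e) * (q * r))
        ≡⟨ cong -_ (*-assoc c e (q * r)) ⟩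
      - (c * (e * (q * r)))
        ≡⟨ cong (λ z → - (z * (e * (q * r)))) (sinCoeff-suc m) ⟨
      - (sinCoeff (suc m) * (e * (q * r))) ∎)
    where
    c = cosCoeff m
    s = sinCoeff m
    e = expTerm q m
    e′ = expTerm (- q) m
    r = 1/suc m

  cos-series-neg : ∀ q n → series cosCoeff (- q) n ≡ series cosCoeff q n
  cos-series-neg q = partialSum-cong (λ m → proj₁ (term-neg q m))

  sin-series-neg : ∀ q n → series sinCoeff (- q) n ≡ - series sinCoeff q n
  sin-series-neg q zero    = refl
  sin-series-neg q (suc n) = trans
    (cong₂ _+_ (sin-series-neg q n) (proj₂ (term-neg q n)))
    (sym (neg-distrib-+ (series sinCoeff q n) (sinCoeff n * expTerm q n)))

  cos-series-0 : ∀ n → series cosCoeff 0ℚ (suc n) ≡ 1ℚ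
  cos-series-0 zero    = refl
  cos-series-0 (suc n) = trans (cong₂ _+_ (cos-series-0 n)
    (trans (cong (λ z → cosCoeff (suc n) * (expTerm 0ℚ n * z)) (*-zeroˡ (1/suc n)))
      (trans (cong (cosCoeff (suc n) *_) (*-zeroʳ (expTerm 0ℚ n))) (*-zeroʳ (cosCoeff (suc n))))))
    (+-identityʳ 1ℚ)

  series-lipschitz : ∀ c → (∀ m → ∣ c m ∣ ≤ 1ℚ) → ∀ p q M → ∣ p ∣ + 1ℚ ≤ M → ∣ q ∣ ≤ M → ∀ n →
    ∣ series c p n - series c q n ∣ ≤ ∣ p - q ∣ * partialSum (expTerm M) n
  series-lipschitz c c≤1 p q M p≤M q≤M zero    = ≤-reflexive (sym (*-zeroʳ ∣ p - q ∣))
  series-lipschitz c c≤1 p q M p≤M q≤M (suc n) = begin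
    ∣ (series c p n + c n * x) - (series c q n + c n * y) ∣
      ≡⟨ cong ∣_∣ (solve 5 (λ A B c x y → (A :+ c :* x) :- (B :+ c :* y)
           := (A :- B) :+ c :* (x :- y)) refl (series c p n) (series c q n) (c n) x y) ⟩
    ∣ (series c p n - series c q n) + c n * (x - y) ∣
      ≤⟨ ∣p+q∣≤∣p∣+∣q∣ (series c p n - series c q n) (c n * (x - y)) ⟩
    ∣ series c p n - series c q n ∣ + ∣ c n * (x - y) ∣
      ≤⟨ +-mono-≤ (series-lipschitz c c≤1 p q M p≤M q≤M n) step ⟩
    ∣ p - q ∣ * S + ∣ p - q ∣ * E
      ≡⟨ *-distribˡ-+ ∣ p - q ∣ S E ⟨
    ∣ p - q ∣ * (S + E) ∎
    where
    x = expTerm p n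
    y = expTerm q n
    S = partialSum (expTerm M) n
    E = expTerm M n
    step : ∣ c n * (x - y) ∣ ≤ ∣ p - q ∣ * E
    step = begin
      ∣ c n * (x - y) ∣      ≡⟨ ∣p*q∣≡∣p∣*∣q∣ (c n) (x - y) ⟩
      ∣ c n ∣ * ∣ x - y ∣    ≤⟨ *-mono-≤ {∣ c n ∣} {1ℚ} {∣ x - y ∣} {∣ p - q ∣ * E} (<⇒≤ 0<1)
                                  (0≤∣p∣ (x - y)) (c≤1 n) (CauchyLemmas.expTerm-lipschitz p q M p≤M q≤M n) ⟩
      1ℚ * (∣ p - q ∣ * E)   ≡⟨ *-identityˡ (∣ p - q ∣ * E) ⟩
      ∣ p - q ∣ * E          ∎

-- The properties of the real numbers on which the argument rests

record RealStructure : Set₁ where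
  infix  4 _≤_ _≈_
  infixl 6 _+_ _-_
  infixl 7 _*_
  infix  8 -_
  field
    R     : Set
    _≤_   : R → R → Set
    _+_   : R → R → R
    _*_   : R → R → R
    -_    : R → R
    fromℚ : ℚ → R
    cos   : R → R
    sin   : R → R

  _≈_ : R → R → Set
  _≈_ = λ x y → x ≤ y × y ≤ x

  0# : R
  0# = fromℚ 0ℚ

  1# : R
  1# = fromℚ 1ℚ

  _-_ : R → R → R
  _-_ = λ x y → x + (- y)

  fromℕ : ℕ → R
  fromℕ n = fromℚ (+ n ℚ./ 1)

  Near : R → R → R → Set
  Near e x y = x ≤ y + e × y ≤ x + e

  field
    isCommutativeRing : IsCommutativeRing _≈_ _+_ _*_ -_ 0# 1#
    ≤-refl     : ∀ {x} → x ≤ x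
    ≤-trans    : ∀ {x y z} → x ≤ y → y ≤ z → x ≤ z
    +-mono-≤   : ∀ {x y u v} → x ≤ y → u ≤ v → x + u ≤ y + v
    0≤*        : ∀ {x y} → 0# ≤ x → 0# ≤ y → 0# ≤ x * y
    fromℚ-+    : ∀ p q → fromℚ (p ℚ.+ q) ≈ fromℚ p + fromℚ q
    fromℚ-*    : ∀ p q → fromℚ (p ℚ.* q) ≈ fromℚ p * fromℚ q
    fromℚ-neg  : ∀ p → fromℚ (ℚ.- p) ≈ - fromℚ p
    fromℚ-mono : ∀ {p q} → p ℚ.≤ q → fromℚ p ≤ fromℚ q
    -- Order on constructive reals is undecidable. This field and the next allow case distinctions
    -- as long as the goal is itself an inequality ≤.
    ≰⇒≥        : ∀ {x y} → ¬ (x ≤ y) → y ≤ x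
    ≤-stable   : ∀ {x y} → ¬ ¬ (x ≤ y) → x ≤ y
    ≤-limit    : ∀ {x y} → (∀ ε → 0ℚ ℚ.< ε → x ≤ y + fromℚ ε) → x ≤ y
    bounded    : ∀ x → Σ[ q ∈ ℚ ] 0ℚ ℚ.< q × x ≤ fromℚ q × - x ≤ fromℚ q
    complete   : ∀ (s : ℕ → R) →
      (∀ ε → 0ℚ ℚ.< ε → ∃[ N ] (∀ m n → N ℕ.≤ m → N ℕ.≤ n → s m ≤ s n + fromℚ ε)) →
      Σ[ L ∈ R ] (∀ ε → 0ℚ ℚ.< ε → ∃[ N ] (∀ n → N ℕ.≤ n → Near (fromℚ ε) (s n) L))
    cos-+      : ∀ x y → cos (x + y) ≈ cos x * cos y - sin x * sin y
    sin-+      : ∀ x y → sin (x + y) ≈ cos x * sin y + sin x * cos y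
    cos²+sin²  : ∀ x → cos x * cos x + sin x * sin x ≈ 1#
    cos-sin-lipschitz : ∀ K → 0ℚ ℚ.< K → Σ[ B ∈ ℚ ] 0ℚ ℚ.< B ×
      (∀ {x y} → x ≤ fromℚ K → - x ≤ fromℚ K → y ≤ fromℚ K → - y ≤ fromℚ K →
       ∀ δ → 0ℚ ℚ.< δ → Near (fromℚ δ) x y →
       Near (fromℚ (B ℚ.* δ)) (cos x) (cos y) × Near (fromℚ (B ℚ.* δ)) (sin x) (sin y))

-- Ordered-ring consequences, finite sums and powers

module RealAlgebra (𝓡 : RealStructure) where
  open RealStructure 𝓡 public

  ≈-refl : ∀ {x} → x ≈ x
  ≈-refl = ≤-refl , ≤-refl

  ≈-sym : ∀ {x y} → x ≈ y → y ≈ x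
  ≈-sym (p , q) = q , p

  ≈-trans : ∀ {x y z} → x ≈ y → y ≈ z → x ≈ z
  ≈-trans (p , p′) (q , q′) = ≤-trans p q , ≤-trans q′ p′

  ≡⇒≈ : ∀ {x y} → x ≡ y → x ≈ y
  ≡⇒≈ ≡.refl = ≈-refl

  commutativeRing : CommutativeRing _ _
  commutativeRing = record { isCommutativeRing = isCommutativeRing }

  open IsCommutativeRing isCommutativeRing public
    using (+-cong; *-cong; -‿cong; +-comm; +-assoc; *-comm; *-assoc; +-identityˡ; +-identityʳ;
           *-identityˡ; *-identityʳ; zeroˡ; zeroʳ; distribˡ; distribʳ; -‿inverseʳ)

  private
    ℚ-rawRing = CommutativeRing.rawRing ℚP.+-*-commutativeRing
    almostCommutativeRing = fromCommutativeRing commutativeRing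

    morphism : ℚ-rawRing -Raw-AlmostCommutative⟶ almostCommutativeRing
    morphism = record
      { ⟦_⟧ = fromℚ ; +-homo = fromℚ-+ ; *-homo = fromℚ-* ; -‿homo = fromℚ-neg
      ; 0-homo = ≈-refl ; 1-homo = ≈-refl }

    coefficient? : ∀ p q → Maybe (fromℚ p ≈ fromℚ q)
    coefficient? p q with p ℚP.≟ q
    ... | yes eq = just (≡⇒≈ (≡.cong fromℚ eq))
    ... | no _   = nothing

  module Solver = Algebra.Solver.Ring ℚ-rawRing almostCommutativeRing morphism coefficient?
  open Solver using (solve; _:=_; _:+_; _:*_; _:-_; :-_; con)

  infix  1 begin_
  infixr 2 _≤⟨_⟩_ _≈⟨_⟩_ _≈˘⟨_⟩_
  infix  3 _∎

  begin_ : ∀ {x y} → x ≤ y → x ≤ y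
  begin p = p

  _≤⟨_⟩_ : ∀ x {y z} → x ≤ y → y ≤ z → x ≤ z
  x ≤⟨ p ⟩ q = ≤-trans p q

  _≈⟨_⟩_ : ∀ x {y z} → x ≈ y → y ≤ z → x ≤ z
  x ≈⟨ p ⟩ q = ≤-trans (proj₁ p) q

  _≈˘⟨_⟩_ : ∀ x {y z} → y ≈ x → y ≤ z → x ≤ z
  x ≈˘⟨ p ⟩ q = ≤-trans (proj₂ p) q

  _∎ : ∀ x → x ≤ x
  x ∎ = ≤-refl

  ≤-by : ∀ {a b} d → 0# ≤ d → a + d ≈ b → a ≤ b
  ≤-by {a} d 0≤d eq = ≤-trans (proj₁ (≈-sym (+-identityʳ a))) (≤-trans (+-mono-≤ ≤-refl 0≤d) (proj₁ eq))

  0≤diff : ∀ {a b} → a ≤ b → 0# ≤ b - a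
  0≤diff {a} {b} a≤b = ≤-trans (proj₂ (-‿inverseʳ a)) (+-mono-≤ a≤b ≤-refl)

  ≤-shift : ∀ {a b c d} → a ≤ b → c + (b - a) ≈ d → c ≤ d
  ≤-shift {a} {b} a≤b = ≤-by (b - a) (0≤diff a≤b)

  0≤+ : ∀ {a b} → 0# ≤ a → 0# ≤ b → 0# ≤ a + b
  0≤+ p q = ≤-trans (proj₂ (+-identityˡ 0#)) (+-mono-≤ p q)

  neg-mono : ∀ {a b} → a ≤ b → - b ≤ - a
  neg-mono {a} {b} p = ≤-shift p (solve 2 (λ a b → :- b :+ (b :- a) := :- a) ≈-refl a b)

  *-monoˡ : ∀ {c a b} → 0# ≤ c → a ≤ b → c * a ≤ c * b
  *-monoˡ {c} {a} {b} 0≤c p = ≤-by (c * (b - a)) (0≤* 0≤c (0≤diff p))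
    (solve 3 (λ c a b → c :* a :+ c :* (b :- a) := c :* b) ≈-refl c a b)

  *-monoʳ : ∀ {c a b} → 0# ≤ c → a ≤ b → a * c ≤ b * c
  *-monoʳ {c} {a} {b} 0≤c p = ≤-trans (proj₁ (*-comm a c)) (≤-trans (*-monoˡ 0≤c p) (proj₁ (*-comm c b)))

  0≤fromℚ : ∀ {q} → 0ℚ ℚ.≤ q → 0# ≤ fromℚ q
  0≤fromℚ = fromℚ-mono

  0≤1 : 0# ≤ 1#
  0≤1 = fromℚ-mono (ℚP.nonNegative⁻¹ 1ℚ)

  0≤fromℕ : ∀ n → 0# ≤ fromℕ n
  0≤fromℕ n = fromℚ-mono (ℚP.nonNegative⁻¹ (+ n ℚ./ 1) {{ℚP.normalize-nonNeg n 1}})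

  fromℕ-suc : ∀ n → fromℕ (suc n) ≈ 1# + fromℕ n
  fromℕ-suc n = ≈-trans (≡⇒≈ (≡.cong fromℚ (RationalLemmas.fromℕ-suc n))) (fromℚ-+ 1ℚ (+ n ℚ./ 1))

  fromℕ-+ : ∀ m n → fromℕ (m ℕ.+ n) ≈ fromℕ m + fromℕ n
  fromℕ-+ m n = ≈-trans (≡⇒≈ (≡.cong fromℚ (RationalLemmas.fromℕ-+ m n))) (fromℚ-+ (+ m ℚ./ 1) (+ n ℚ./ 1))

  fromℕ-* : ∀ m n → fromℕ (m ℕ.* n) ≈ fromℕ m * fromℕ n
  fromℕ-* m n = ≈-trans (≡⇒≈ (≡.cong fromℚ (RationalLemmas.fromℕ-* m n))) (fromℚ-* (+ m ℚ./ 1) (+ n ℚ./ 1))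

  fromℕ-mono : ∀ {m n} → m ℕ.≤ n → fromℕ m ≤ fromℕ n
  fromℕ-mono {m} {n} m≤n = ≤-by (fromℕ (n ℕ.∸ m)) (0≤fromℕ (n ℕ.∸ m))
    (≈-trans (≈-sym (fromℕ-+ m (n ℕ.∸ m))) (≡⇒≈ (≡.cong fromℕ (ℕP.m+[n∸m]≡n m≤n))))

  -- There is no sign distinction on x, but the goal is stable: if it failed, x could not be
  -- nonnegative, so x ≤ 0, and then the square of - x is nonnegative.
  0≤sq : ∀ x → 0# ≤ x * x
  0≤sq x = ≤-stable λ ¬p → ¬p (≤-trans
    (let 0≤-x = ≤-trans (0≤diff (≰⇒≥ (λ 0≤x → ¬p (0≤* 0≤x 0≤x)))) (proj₁ (+-identityˡ (- x))) in 0≤* 0≤-x 0≤-x)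
    (proj₁ (solve 1 (λ x → (:- x) :* (:- x) := x :* x) ≈-refl x)))

  -- Cancellation without division: if y ≤ x, then (c - 1) (x - y) ≥ 0 together with c x ≤ c y
  -- returns x ≤ y.
  *-cancelˡ-1≤ : ∀ {c x y} → 1# ≤ c → c * x ≤ c * y → x ≤ y
  *-cancelˡ-1≤ {c} {x} {y} 1≤c p = ≤-stable λ x≰y → x≰y
    (≤-by ((c * y - c * x) + (c - 1#) * (x - y))
      (0≤+ (0≤diff p) (0≤* (0≤diff 1≤c) (0≤diff (≰⇒≥ x≰y))))
      (solve 3 (λ c x y → x :+ ((c :* y :- c :* x) :+ (c :- con 1ℚ) :* (x :- y)) := y) ≈-refl c x y))

  sum : ℕ → (ℕ → R) → R
  sum zero    g = 0#
  sum (suc n) g = g 0 + sum n (g ∘ suc)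

  sum-cong : ∀ n {f g} → (∀ i → f i ≈ g i) → sum n f ≈ sum n g
  sum-cong zero    h = ≈-refl
  sum-cong (suc n) h = +-cong (h 0) (sum-cong n (h ∘ suc))

  sum-mono : ∀ n {f g} → (∀ i → f i ≤ g i) → sum n f ≤ sum n g
  sum-mono zero    h = ≤-refl
  sum-mono (suc n) h = +-mono-≤ (h 0) (sum-mono n (h ∘ suc))

  sum-nonneg : ∀ n {f} → (∀ i → 0# ≤ f i) → 0# ≤ sum n f
  sum-nonneg zero    h = ≤-refl
  sum-nonneg (suc n) h = 0≤+ (h 0) (sum-nonneg n (h ∘ suc))

  sum-linear : ∀ n c f d g → sum n (λ i → c * f i + d * g i) ≈ c * sum n f + d * sum n g
  sum-linear zero    c f d g = solve 2 (λ c d → con 0ℚ := c :* con 0ℚ :+ d :* con 0ℚ) ≈-refl c d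
  sum-linear (suc n) c f d g = ≈-trans (+-cong ≈-refl (sum-linear n c (f ∘ suc) d (g ∘ suc)))
    (solve 6 (λ c d f g F G → (c :* f :+ d :* g) :+ (c :* F :+ d :* G) := c :* (f :+ F) :+ d :* (g :+ G))
      ≈-refl c d (f 0) (g 0) (sum n (f ∘ suc)) (sum n (g ∘ suc)))

  sum-+ : ∀ n f g → sum n (λ i → f i + g i) ≈ sum n f + sum n g
  sum-+ zero    f g = ≈-sym (+-identityˡ 0#)
  sum-+ (suc n) f g = ≈-trans (+-cong ≈-refl (sum-+ n (f ∘ suc) (g ∘ suc)))
    (solve 4 (λ f g F G → (f :+ g) :+ (F :+ G) := (f :+ F) :+ (g :+ G))
      ≈-refl (f 0) (g 0) (sum n (f ∘ suc)) (sum n (g ∘ suc)))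

  sum-const : ∀ n c → sum n (λ _ → c) ≈ fromℕ n * c
  sum-const zero    c = ≈-sym (zeroˡ c)
  sum-const (suc n) c = ≈-trans (+-cong ≈-refl (sum-const n c))
    (≈-trans (solve 2 (λ n c → c :+ n :* c := (con 1ℚ :+ n) :* c) ≈-refl (fromℕ n) c)
      (*-cong (≈-sym (fromℕ-suc n)) ≈-refl))

  sum-split : ∀ m n g → sum (m ℕ.+ n) g ≈ sum m g + sum n (λ i → g (m ℕ.+ i))
  sum-split zero    n g = ≈-sym (+-identityˡ (sum n g))
  sum-split (suc m) n g = ≈-trans (+-cong ≈-refl (sum-split m n (g ∘ suc)))
    (≈-sym (+-assoc (g 0) (sum m (g ∘ suc)) (sum n (λ i → g (suc m ℕ.+ i)))))

  sum-extend : ∀ {m n g} → (∀ i → 0# ≤ g i) → m ℕ.≤ n → sum m g ≤ sum n g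
  sum-extend {n = n} h ℕ.z≤n = sum-nonneg n h
  sum-extend h (ℕ.s≤s m≤n) = +-mono-≤ ≤-refl (sum-extend (h ∘ suc) m≤n)

  sum-swap : ∀ m n (g : ℕ → ℕ → R) → sum m (λ i → sum n (g i)) ≈ sum n (λ j → sum m (λ i → g i j))
  sum-swap zero    n g = ≈-sym (≈-trans (sum-const n 0#) (zeroʳ (fromℕ n)))
  sum-swap (suc m) n g = ≈-trans (+-cong ≈-refl (sum-swap m n (g ∘ suc)))
    (≈-sym (sum-+ n (g 0) (λ j → sum m (λ i → g (suc i) j))))

  sum-last : ∀ n g → sum (suc n) g ≈ sum n g + g n
  sum-last zero    g = +-comm (g 0) 0#
  sum-last (suc n) g = ≈-trans (+-cong ≈-refl (sum-last n (g ∘ suc)))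
    (≈-sym (+-assoc (g 0) (sum n (g ∘ suc)) (g (suc n))))

  term≤sum : ∀ n {g} → (∀ i → 0# ≤ g i) → ∀ {i} → i ℕ.< n → g i ≤ sum n g
  term≤sum (suc n) {g} h {zero}  _           = ≤-by (sum n (g ∘ suc)) (sum-nonneg n (h ∘ suc)) ≈-refl
  term≤sum (suc n) {g} h {suc i} (ℕ.s≤s i<n) = ≤-trans (term≤sum n (h ∘ suc) i<n)
    (≤-by (g 0) (h 0) (+-comm (sum n (g ∘ suc)) (g 0)))

  -- The sampled index is the last one in each of A consecutive blocks of length j + 1, so no term
  -- is taken twice.
  sum-stride : ∀ {g} → (∀ i → 0# ≤ g i) → ∀ j A →
    sum A (λ a → g (j ℕ.+ a ℕ.* suc j)) ≤ sum (A ℕ.* suc j) g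
  sum-stride {g} h j zero    = ≤-refl
  sum-stride {g} h j (suc A) = ≤-trans
    (+-mono-≤ (≤-trans (proj₁ (≡⇒≈ (≡.cong g (ℕP.+-identityʳ j)))) (term≤sum (suc j) h (ℕP.n<1+n j)))
      (≤-trans (proj₁ (sum-cong A (λ a → ≡⇒≈ (≡.cong g (reindex a)))))
        (sum-stride (λ i → h (suc j ℕ.+ i)) j A)))
    (proj₂ (sum-split (suc j) (A ℕ.* suc j) g))
    where
    reindex : ∀ a → j ℕ.+ suc a ℕ.* suc j ≡ suc j ℕ.+ (j ℕ.+ a ℕ.* suc j)
    reindex a = ℕP.+-suc j (j ℕ.+ a ℕ.* suc j)

  power : R → ℕ → R
  power x zero    = 1#
  power x (suc n) = x * power x n

  0≤power : ∀ {x} → 0# ≤ x → ∀ n → 0# ≤ power x n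
  0≤power p zero    = 0≤1
  0≤power p (suc n) = 0≤* p (0≤power p n)

  bernoulli : ∀ {x} → 0# ≤ x → x ≤ 1# → ∀ n → 1# - fromℕ n * x ≤ power (1# - x) n
  bernoulli {x} 0≤x x≤1 zero    = proj₁ (solve 1 (λ x → con 1ℚ :- con 0ℚ :* x := con 1ℚ) ≈-refl x)
  bernoulli {x} 0≤x x≤1 (suc n) = ≤-trans
    (≤-by (fromℕ n * (x * x)) (0≤* (0≤fromℕ n) (0≤sq x))
      (≈-trans (+-cong (+-cong ≈-refl (-‿cong (*-cong (fromℕ-suc n) ≈-refl))) ≈-refl)
        (solve 2 (λ n x → (con 1ℚ :- (con 1ℚ :+ n) :* x) :+ n :* (x :* x) := (con 1ℚ :- x) :* (con 1ℚ :- n :* x))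
          ≈-refl (fromℕ n) x)))
    (*-monoˡ (0≤diff x≤1) (bernoulli 0≤x x≤1 n))

  -- A division-free form of (1 - x)ⁿ ≤ 1 / (1 + n x). The induction step is (1 - x) (1 + (n + 1) x)
  -- = 1 + n x - (n + 1) x².
  power-decay : ∀ {x} → 0# ≤ x → x ≤ 1# → ∀ n → power (1# - x) n * (1# + fromℕ n * x) ≤ 1#
  power-decay {x} 0≤x x≤1 zero    = proj₁ (solve 1 (λ x → con 1ℚ :* (con 1ℚ :+ con 0ℚ :* x) := con 1ℚ) ≈-refl x)
  power-decay {x} 0≤x x≤1 (suc n) = ≤-trans
    (≤-by (power (1# - x) n * ((1# + fromℕ n) * (x * x)))
      (0≤* (0≤power (0≤diff x≤1) n) (0≤* (0≤+ 0≤1 (0≤fromℕ n)) (0≤sq x)))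
      (≈-trans (+-cong (*-cong ≈-refl (+-cong ≈-refl (*-cong (fromℕ-suc n) ≈-refl))) ≈-refl)
        (solve 3 (λ p n x → ((con 1ℚ :- x) :* p) :* (con 1ℚ :+ (con 1ℚ :+ n) :* x) :+ p :* ((con 1ℚ :+ n) :* (x :* x))
            := p :* (con 1ℚ :+ n :* x)) ≈-refl (power (1# - x) n) (fromℕ n) x)))
    (power-decay 0≤x x≤1 n)

-- Complex numbers over the abstract reals and the Cauchy-Schwarz inequality

module ComplexAlgebra (𝓡 : RealStructure) where
  open RealAlgebra 𝓡
  open Solver using (solve; _:=_; _:+_; _:*_; _:-_; :-_; con)

  infix  4 _≈ᶜ_
  infixl 6 _+ᶜ_ _-ᶜ_
  infixl 7 _*ᶜ_

  record C : Set where
    constructor _+i_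
    field
      re im : R
  open C public

  _≈ᶜ_ : C → C → Set
  z ≈ᶜ w = re z ≈ re w × im z ≈ im w

  _+ᶜ_ _*ᶜ_ : C → C → C
  z +ᶜ w = (re z + re w) +i (im z + im w)
  z *ᶜ w = (re z * re w - im z * im w) +i (re z * im w + im z * re w)

  -ᶜ_ conj : C → C
  -ᶜ z = (- re z) +i (- im z)
  conj z = re z +i (- im z)

  _-ᶜ_ : C → C → C
  z -ᶜ w = z +ᶜ (-ᶜ w)

  fromR : R → C
  fromR x = x +i 0#

  0ᶜ 1ᶜ : C
  0ᶜ = fromR 0#
  1ᶜ = fromR 1#

  norm² : C → R
  norm² z = re z * re z + im z * im z

  ≈ᶜ-refl : ∀ {z} → z ≈ᶜ z
  ≈ᶜ-refl = ≈-refl , ≈-refl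

  ≈ᶜ-sym : ∀ {z w} → z ≈ᶜ w → w ≈ᶜ z
  ≈ᶜ-sym (p , q) = ≈-sym p , ≈-sym q

  ≈ᶜ-trans : ∀ {z w u} → z ≈ᶜ w → w ≈ᶜ u → z ≈ᶜ u
  ≈ᶜ-trans (p , q) (p′ , q′) = ≈-trans p p′ , ≈-trans q q′

  ≡⇒≈ᶜ : ∀ {z w} → z ≡ w → z ≈ᶜ w
  ≡⇒≈ᶜ ≡.refl = ≈ᶜ-refl

  +ᶜ-cong : ∀ {z z′ w w′} → z ≈ᶜ z′ → w ≈ᶜ w′ → z +ᶜ w ≈ᶜ z′ +ᶜ w′
  +ᶜ-cong (p , q) (p′ , q′) = +-cong p p′ , +-cong q q′

  -ᶜ-cong : ∀ {z w} → z ≈ᶜ w → -ᶜ z ≈ᶜ -ᶜ w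
  -ᶜ-cong (p , q) = -‿cong p , -‿cong q

  *ᶜ-cong : ∀ {z z′ w w′} → z ≈ᶜ z′ → w ≈ᶜ w′ → z *ᶜ w ≈ᶜ z′ *ᶜ w′
  *ᶜ-cong (p , q) (p′ , q′) =
      +-cong (*-cong p p′) (-‿cong (*-cong q q′))
    , +-cong (*-cong p q′) (*-cong q p′)

  norm²-cong : ∀ {z w} → z ≈ᶜ w → norm² z ≈ norm² w
  norm²-cong (p , q) = +-cong (*-cong p p) (*-cong q q)

  commutativeRingᶜ : CommutativeRing _ _
  commutativeRingᶜ = record
    { Carrier = C ; _≈_ = _≈ᶜ_ ; _+_ = _+ᶜ_ ; _*_ = _*ᶜ_ ; -_ = -ᶜ_ ; 0# = 0ᶜ ; 1# = 1ᶜ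
    ; isCommutativeRing = record
      { isRing = record
        { +-isAbelianGroup = record
          { isGroup = record
            { isMonoid = record
              { isSemigroup = record
                { isMagma = record
                  { isEquivalence = record { refl = ≈ᶜ-refl ; sym = ≈ᶜ-sym ; trans = ≈ᶜ-trans }
                  ; ∙-cong = +ᶜ-cong }
                ; assoc = λ x y z → +-assoc (re x) (re y) (re z) , +-assoc (im x) (im y) (im z) }
              ; identity = (λ x → +-identityˡ (re x) , +-identityˡ (im x))
                         , (λ x → +-identityʳ (re x) , +-identityʳ (im x)) }
            ; inverse = (λ x → ≈-trans (+-comm (- re x) (re x)) (-‿inverseʳ (re x))
                             , ≈-trans (+-comm (- im x) (im x)) (-‿inverseʳ (im x)))
                      , (λ x → -‿inverseʳ (re x) , -‿inverseʳ (im x))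
            ; ⁻¹-cong = -ᶜ-cong }
          ; comm = λ x y → +-comm (re x) (re y) , +-comm (im x) (im y) }
        ; *-cong = *ᶜ-cong
        ; *-assoc = λ x y z →
              solve 6 (λ a b c d e f → (a :* c :- b :* d) :* e :- (a :* d :+ b :* c) :* f
                := a :* (c :* e :- d :* f) :- b :* (c :* f :+ d :* e)) ≈-refl (re x) (im x) (re y) (im y) (re z) (im z)
            , solve 6 (λ a b c d e f → (a :* c :- b :* d) :* f :+ (a :* d :+ b :* c) :* e
                := a :* (c :* f :+ d :* e) :+ b :* (c :* e :- d :* f)) ≈-refl (re x) (im x) (re y) (im y) (re z) (im z)
        ; *-identity = (λ x → solve 2 (λ a b → con 1ℚ :* a :- con 0ℚ :* b := a) ≈-refl (re x) (im x)
                            , solve 2 (λ a b → con 1ℚ :* b :+ con 0ℚ :* a := b) ≈-refl (re x) (im x))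
                     , (λ x → solve 2 (λ a b → a :* con 1ℚ :- b :* con 0ℚ := a) ≈-refl (re x) (im x)
                            , solve 2 (λ a b → a :* con 0ℚ :+ b :* con 1ℚ := b) ≈-refl (re x) (im x))
        ; distrib = (λ x y z →
              solve 6 (λ a b c d e f → a :* (c :+ e) :- b :* (d :+ f) := (a :* c :- b :* d) :+ (a :* e :- b :* f))
                ≈-refl (re x) (im x) (re y) (im y) (re z) (im z)
            , solve 6 (λ a b c d e f → a :* (d :+ f) :+ b :* (c :+ e) := (a :* d :+ b :* c) :+ (a :* f :+ b :* e))
                ≈-refl (re x) (im x) (re y) (im y) (re z) (im z))
                  , (λ x y z →
              solve 6 (λ a b c d e f → (c :+ e) :* a :- (d :+ f) :* b := (c :* a :- d :* b) :+ (e :* a :- f :* b))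
                ≈-refl (re x) (im x) (re y) (im y) (re z) (im z)
            , solve 6 (λ a b c d e f → (c :+ e) :* b :+ (d :+ f) :* a := (c :* b :+ d :* a) :+ (e :* b :+ f :* a))
                ≈-refl (re x) (im x) (re y) (im y) (re z) (im z)) }
      ; *-comm = λ x y →
            solve 4 (λ a b c d → a :* c :- b :* d := c :* a :- d :* b) ≈-refl (re x) (im x) (re y) (im y)
          , solve 4 (λ a b c d → a :* d :+ b :* c := c :* b :+ d :* a) ≈-refl (re x) (im x) (re y) (im y) } }

  private
    ℚ-rawRing = CommutativeRing.rawRing ℚP.+-*-commutativeRing
    almostCommutativeRing = fromCommutativeRing commutativeRingᶜ

    0≈-0 : 0# ≈ - 0#
    0≈-0 = solve 0 (con 0ℚ := :- con 0ℚ) ≈-refl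

    morphism : ℚ-rawRing -Raw-AlmostCommutative⟶ almostCommutativeRing
    morphism = record
      { ⟦_⟧ = λ q → fromR (fromℚ q)
      ; +-homo = λ p q → fromℚ-+ p q , ≈-sym (+-identityˡ 0#)
      ; *-homo = λ p q → ≈-trans (fromℚ-* p q) (solve 2 (λ p q → p :* q := p :* q :- con 0ℚ :* con 0ℚ) ≈-refl (fromℚ p) (fromℚ q))
                       , solve 2 (λ p q → con 0ℚ := p :* con 0ℚ :+ con 0ℚ :* q) ≈-refl (fromℚ p) (fromℚ q)
      ; -‿homo = λ p → fromℚ-neg p , 0≈-0
      ; 0-homo = ≈ᶜ-refl ; 1-homo = ≈ᶜ-refl }

    coefficient? : ∀ p q → Maybe (fromR (fromℚ p) ≈ᶜ fromR (fromℚ q))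
    coefficient? p q with p ℚP.≟ q
    ... | yes eq = just (≡⇒≈ᶜ (≡.cong (λ t → fromR (fromℚ t)) eq))
    ... | no _   = nothing

  module Solverᶜ = Algebra.Solver.Ring ℚ-rawRing almostCommutativeRing morphism coefficient?

  0≤norm² : ∀ z → 0# ≤ norm² z
  0≤norm² z = 0≤+ (0≤sq (re z)) (0≤sq (im z))

  norm²-0 : norm² 0ᶜ ≈ 0#
  norm²-0 = solve 0 (con 0ℚ :* con 0ℚ :+ con 0ℚ :* con 0ℚ := con 0ℚ) ≈-refl

  norm²-* : ∀ z w → norm² (z *ᶜ w) ≈ norm² z * norm² w
  norm²-* z w = solve 4 (λ a b c d →
      (a :* c :- b :* d) :* (a :* c :- b :* d) :+ (a :* d :+ b :* c) :* (a :* d :+ b :* c)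
      := (a :* a :+ b :* b) :* (c :* c :+ d :* d)) ≈-refl (re z) (im z) (re w) (im w)

  norm²-unit* : ∀ {b} → norm² b ≈ 1# → ∀ z → norm² (b *ᶜ z) ≈ norm² z
  norm²-unit* {b} h z = ≈-trans (norm²-* b z) (≈-trans (*-cong h ≈-refl) (*-identityˡ (norm² z)))

  norm²-neg : ∀ z → norm² (-ᶜ z) ≈ norm² z
  norm²-neg z = solve 2 (λ a b → (:- a) :* (:- a) :+ (:- b) :* (:- b) := a :* a :+ b :* b) ≈-refl (re z) (im z)

  norm²-conj : ∀ z → norm² (conj z) ≈ norm² z
  norm²-conj z = solve 2 (λ a b → a :* a :+ (:- b) :* (:- b) := a :* a :+ b :* b) ≈-refl (re z) (im z)

  conj-inverse : ∀ z → norm² z ≈ 1# → conj z *ᶜ z ≈ᶜ 1ᶜ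
  conj-inverse z h =
      ≈-trans (solve 2 (λ a b → a :* a :- (:- b) :* b := a :* a :+ b :* b) ≈-refl (re z) (im z)) h
    , solve 2 (λ a b → a :* b :+ (:- b) :* a := con 0ℚ) ≈-refl (re z) (im z)

  sumᶜ : ℕ → (ℕ → C) → C
  sumᶜ zero    g = 0ᶜ
  sumᶜ (suc n) g = g 0 +ᶜ sumᶜ n (g ∘ suc)

  inner : C → C → R
  inner z w = re z * re w + im z * im w

  -- The right-hand side is Σⱼ |pⱼ w̄ - p w̄ⱼ|².
  cauchy-schwarz-step : ∀ n (p w : ℕ → C) (p₀ w₀ : C) → 0# ≤
    sum n (λ j → norm² (p j)) * norm² w₀ + norm² p₀ * sum n (λ j → norm² (w j))
      - fromℕ 2 * inner (sumᶜ n (λ j → p j *ᶜ w j)) (p₀ *ᶜ w₀)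
  cauchy-schwarz-step zero p w p₀ w₀ = proj₁ (solve 4
    (λ a b x y → con 0ℚ := con 0ℚ :* a :+ b :* con 0ℚ :- con (+ 2 ℚ./ 1) :* (con 0ℚ :* x :+ con 0ℚ :* y))
    ≈-refl (norm² w₀) (norm² p₀) (re (p₀ *ᶜ w₀)) (im (p₀ *ᶜ w₀)))
  cauchy-schwarz-step (suc n) p w p₀ w₀ = ≤-trans
    (0≤+ (0≤norm² z) (cauchy-schwarz-step n (p ∘ suc) (w ∘ suc) p₀ w₀))
    (proj₁ (≈-trans (+-cong identity ≈-refl) regroup))
    where
    z = (p 0 *ᶜ conj w₀) -ᶜ (p₀ *ᶜ conj (w 0))
    P = sum n (λ j → norm² (p (suc j)))
    W = sum n (λ j → norm² (w (suc j)))
    S = sumᶜ n (λ j → p (suc j) *ᶜ w (suc j))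
    identity : norm² z ≈ norm² (p 0) * norm² w₀ + norm² p₀ * norm² (w 0)
                         - fromℕ 2 * inner (p 0 *ᶜ w 0) (p₀ *ᶜ w₀)
    identity = solve 8 (λ a b c d e f g h →
      let u = (a :* g :- b :* (:- h)) :+ :- (e :* c :- f :* (:- d))
          v = (a :* (:- h) :+ b :* g) :+ :- (e :* (:- d) :+ f :* c)
      in u :* u :+ v :* v
        := (a :* a :+ b :* b) :* (g :* g :+ h :* h) :+ (e :* e :+ f :* f) :* (c :* c :+ d :* d)
           :- con (+ 2 ℚ./ 1) :* ((a :* c :- b :* d) :* (e :* g :- f :* h) :+ (a :* d :+ b :* c) :* (e :* h :+ f :* g)))
      ≈-refl (re (p 0)) (im (p 0)) (re (w 0)) (im (w 0)) (re p₀) (im p₀) (re w₀) (im w₀)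
    regroup : (norm² (p 0) * norm² w₀ + norm² p₀ * norm² (w 0) - fromℕ 2 * inner (p 0 *ᶜ w 0) (p₀ *ᶜ w₀))
      + (P * norm² w₀ + norm² p₀ * W - fromℕ 2 * inner S (p₀ *ᶜ w₀))
      ≈ (norm² (p 0) + P) * norm² w₀ + norm² p₀ * (norm² (w 0) + W)
         - fromℕ 2 * inner (p 0 *ᶜ w 0 +ᶜ S) (p₀ *ᶜ w₀)
    regroup = solve 12 (λ a b c d P W x y s t u v →
      (a :* b :+ c :* d :- con (+ 2 ℚ./ 1) :* (x :* u :+ y :* v)) :+ (P :* b :+ c :* W :- con (+ 2 ℚ./ 1) :* (s :* u :+ t :* v))
      := (a :+ P) :* b :+ c :* (d :+ W) :- con (+ 2 ℚ./ 1) :* ((x :+ s) :* u :+ (y :+ t) :* v)) ≈-refl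
      (norm² (p 0)) (norm² w₀) (norm² p₀) (norm² (w 0)) P W (re (p 0 *ᶜ w 0)) (im (p 0 *ᶜ w 0)) (re S) (im S)
      (re (p₀ *ᶜ w₀)) (im (p₀ *ᶜ w₀))

  -- Expanding |p₀ w₀ + S|² leaves the cross term 2 ⟨S, p₀ w₀⟩, which is exactly what
  -- `cauchy-schwarz-step` bounds. No conjugate appears because linear prediction uses the bilinear
  -- pairing.
  cauchy-schwarz : ∀ n (p w : ℕ → C) →
    norm² (sumᶜ n (λ j → p j *ᶜ w j)) ≤ sum n (λ j → norm² (p j)) * sum n (λ j → norm² (w j))
  cauchy-schwarz zero p w = proj₁ (solve 0 (con 0ℚ :* con 0ℚ :+ con 0ℚ :* con 0ℚ := con 0ℚ :* con 0ℚ) ≈-refl)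
  cauchy-schwarz (suc n) p w = ≤-by
    ((P * W - norm² S) + (P * norm² (w 0) + norm² (p 0) * W - fromℕ 2 * inner S (p 0 *ᶜ w 0)))
    (0≤+ (0≤diff (cauchy-schwarz n (p ∘ suc) (w ∘ suc))) (cauchy-schwarz-step n (p ∘ suc) (w ∘ suc) (p 0) (w 0)))
    (≈-trans (+-cong (solve 4 (λ a b s t → (a :+ s) :* (a :+ s) :+ (b :+ t) :* (b :+ t)
        := (a :* a :+ b :* b) :+ (s :* s :+ t :* t) :+ con (+ 2 ℚ./ 1) :* (s :* a :+ t :* b)) ≈-refl
        (re (p 0 *ᶜ w 0)) (im (p 0 *ᶜ w 0)) (re S) (im S)) ≈-refl)
      (≈-trans (+-cong (+-cong (+-cong (norm²-* (p 0) (w 0)) ≈-refl) ≈-refl) ≈-refl)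
        (solve 6 (λ a b P W s i →
            (a :* b :+ s :+ con (+ 2 ℚ./ 1) :* i) :+ ((P :* W :- s) :+ (P :* b :+ a :* W :- con (+ 2 ℚ./ 1) :* i))
            := (a :+ P) :* (b :+ W)) ≈-refl
          (norm² (p 0)) (norm² (w 0)) P W (norm² S) (inner S (p 0 *ᶜ w 0)))))
    where
    P = sum n (λ j → norm² (p (suc j)))
    W = sum n (λ j → norm² (w (suc j)))
    S = sumᶜ n (λ j → p (suc j) *ᶜ w (suc j))

-- The damped annihilating polynomial and its energy

module Annihilator (𝓡 : RealStructure) where
  open RealAlgebra 𝓡
  open ComplexAlgebra 𝓡
  private
    module S = Solver
    module Sᶜ = Solverᶜ

  ev : ℕ → (ℕ → C) → C → C
  ev zero    u ζ = 0ᶜ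
  ev (suc M) u ζ = u 0 +ᶜ ζ *ᶜ ev M (u ∘ suc) ζ

  ev-linear : ∀ M u c v ζ → ev M (λ j → u j +ᶜ c *ᶜ v j) ζ ≈ᶜ ev M u ζ +ᶜ c *ᶜ ev M v ζ
  ev-linear zero    u c v ζ = Sᶜ.solve 1 (λ c → con 0ℚ := con 0ℚ :+ c :* con 0ℚ) ≈ᶜ-refl c
    where open Sᶜ
  ev-linear (suc M) u c v ζ = ≈ᶜ-trans
    (+ᶜ-cong ≈ᶜ-refl (*ᶜ-cong ≈ᶜ-refl (ev-linear M (u ∘ suc) c (v ∘ suc) ζ)))
    (Sᶜ.solve 6 (λ a c b z U V → (a :+ c :* b) :+ z :* (U :+ c :* V) := (a :+ z :* U) :+ c :* (b :+ z :* V))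
      ≈ᶜ-refl (u 0) c (v 0) ζ (ev M (u ∘ suc) ζ) (ev M (v ∘ suc) ζ))
    where open Sᶜ

  ev-extend : ∀ N u ζ → u N ≈ᶜ 0ᶜ → ev (suc N) u ζ ≈ᶜ ev N u ζ
  ev-extend zero    u ζ h = ≈ᶜ-trans (+ᶜ-cong h ≈ᶜ-refl)
    (Sᶜ.solve 1 (λ z → con 0ℚ :+ z :* con 0ℚ := con 0ℚ) ≈ᶜ-refl ζ)
    where open Sᶜ
  ev-extend (suc N) u ζ h = +ᶜ-cong ≈ᶜ-refl (*ᶜ-cong ≈ᶜ-refl (ev-extend N (u ∘ suc) ζ h))

  shift : (ℕ → C) → ℕ → C
  shift u zero    = 0ᶜ
  shift u (suc j) = u j

  -- A polynomial is its coefficient sequence, and this is multiplication by b z. Likewise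
  -- `iterate b n` multiplies by (b z)ⁿ, `geometric a b n` by Σ_{i < n} (a b z)ⁱ, and
  -- `difference c b` by 1 + c b z.
  twist : C → (ℕ → C) → ℕ → C
  twist b u j = b *ᶜ shift u j

  iterate : C → ℕ → (ℕ → C) → ℕ → C
  iterate b zero    u = u
  iterate b (suc n) u = twist b (iterate b n u)

  geometric : R → C → ℕ → (ℕ → C) → ℕ → C
  geometric a b zero    u j = 0ᶜ
  geometric a b (suc n) u j = geometric a b n u j +ᶜ fromR (power a n) *ᶜ iterate b n u j

  difference : C → C → (ℕ → C) → ℕ → C
  difference c b u j = u j +ᶜ c *ᶜ twist b u j

  -1ᶜ : C
  -1ᶜ = -ᶜ 1ᶜ

  -- multiplication by (1 - b z) Σ_{i < n} (a b z)ⁱ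
  factor : R → C → ℕ → (ℕ → C) → ℕ → C
  factor a b n u = difference -1ᶜ b (geometric a b n u)

  shift-linear : ∀ u c v j → shift (λ i → u i +ᶜ c *ᶜ v i) j ≈ᶜ shift u j +ᶜ c *ᶜ shift v j
  shift-linear u c v zero    = Sᶜ.solve 1 (λ c → con 0ℚ := con 0ℚ :+ c :* con 0ℚ) ≈ᶜ-refl c
    where open Sᶜ
  shift-linear u c v (suc j) = ≈ᶜ-refl

  shift-0 : ∀ j → shift (λ _ → 0ᶜ) j ≈ᶜ 0ᶜ
  shift-0 zero    = ≈ᶜ-refl
  shift-0 (suc j) = ≈ᶜ-refl

  fromR-* : ∀ x y → fromR (x * y) ≈ᶜ fromR x *ᶜ fromR y
  fromR-* x y = S.solve 2 (λ x y → x :* y := x :* y :- con 0ℚ :* con 0ℚ) ≈-refl x y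
              , S.solve 2 (λ x y → con 0ℚ := x :* con 0ℚ :+ con 0ℚ :* y) ≈-refl x y
    where open S

  -- The finite geometric series: (1 - a b z) Σ_{i < n} (a b z)ⁱ = 1 - (a b z)ⁿ. It turns the energy
  -- of the damped difference into that of `u` up to a remainder of size aⁿ.
  telescope : ∀ a b n u j →
    difference (-ᶜ fromR a) b (geometric a b n u) j ≈ᶜ u j -ᶜ fromR (power a n) *ᶜ iterate b n u j
  telescope a b zero u j = ≈ᶜ-trans
    (+ᶜ-cong ≈ᶜ-refl (*ᶜ-cong ≈ᶜ-refl (*ᶜ-cong ≈ᶜ-refl (shift-0 j))))
    (Sᶜ.solve 3 (λ a b u → con 0ℚ :+ (:- a) :* (b :* con 0ℚ) := u :- con 1ℚ :* u) ≈ᶜ-refl (fromR a) b (u j))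
    where open Sᶜ
  telescope a b (suc n) u j = ≈ᶜ-trans
    (+ᶜ-cong ≈ᶜ-refl (*ᶜ-cong ≈ᶜ-refl (*ᶜ-cong ≈ᶜ-refl
      (shift-linear (geometric a b n u) (fromR (power a n)) (iterate b n u) j))))
    (≈ᶜ-trans (Sᶜ.solve 7 (λ a b G p e S T → (G :+ p :* e) :+ (:- a) :* (b :* (S :+ p :* T))
        := (G :+ (:- a) :* (b :* S)) :+ p :* e :- (a :* p) :* (b :* T)) ≈ᶜ-refl
        (fromR a) b (geometric a b n u j) (fromR (power a n)) (iterate b n u j)
        (shift (geometric a b n u) j) (shift (iterate b n u) j))
      (≈ᶜ-trans (+ᶜ-cong (+ᶜ-cong (telescope a b n u j) ≈ᶜ-refl)
          (-ᶜ-cong (*ᶜ-cong (≈ᶜ-sym (fromR-* a (power a n))) ≈ᶜ-refl)))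
        (Sᶜ.solve 4 (λ u p e f → (u :- p :* e) :+ p :* e :- f := u :- f) ≈ᶜ-refl
          (u j) (fromR (power a n)) (iterate b n u j) (fromR (power a (suc n)) *ᶜ iterate b (suc n) u j))))
    where open Sᶜ

  Support : ℕ → (ℕ → C) → Set
  Support M u = ∀ j → M ℕ.≤ j → u j ≈ᶜ 0ᶜ

  -- Requiring this for every sufficiently long truncation makes it stable under multiplication by
  -- further factors, which shift the truncation length.
  Vanishes : ℕ → (ℕ → C) → C → Set
  Vanishes M u ζ = ∀ N → M ℕ.≤ N → ev N u ζ ≈ᶜ 0ᶜ

  private
    0+c*0 : ∀ {z w} c → z ≈ᶜ 0ᶜ → w ≈ᶜ 0ᶜ → z +ᶜ c *ᶜ w ≈ᶜ 0ᶜ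
    0+c*0 c p q = ≈ᶜ-trans (+ᶜ-cong p (*ᶜ-cong ≈ᶜ-refl q))
      (Sᶜ.solve 1 (λ c → con 0ℚ :+ c :* con 0ℚ := con 0ℚ) ≈ᶜ-refl c)
      where open Sᶜ

    c*0 : ∀ {z} c → z ≈ᶜ 0ᶜ → c *ᶜ z ≈ᶜ 0ᶜ
    c*0 c p = ≈ᶜ-trans (*ᶜ-cong ≈ᶜ-refl p) (Sᶜ.solve 1 (λ c → c :* con 0ℚ := con 0ℚ) ≈ᶜ-refl c)
      where open Sᶜ

  support-twist : ∀ {M u} b → Support M u → Support (suc M) (twist b u)
  support-twist b h (suc j) (ℕ.s≤s M≤j) = c*0 b (h j M≤j)

  support-iterate : ∀ {M u} b n → Support M u → Support (n ℕ.+ M) (iterate b n u)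
  support-iterate b zero    h = h
  support-iterate b (suc n) h = support-twist b (support-iterate b n h)

  support-geometric : ∀ {M u} a b n → Support M u → Support (n ℕ.+ M) (geometric a b n u)
  support-geometric a b zero    h j M≤j = ≈ᶜ-refl
  support-geometric a b (suc n) h j M≤j = 0+c*0 (fromR (power a n))
    (support-geometric a b n h j (ℕP.<⇒≤ M≤j)) (support-iterate b n h j (ℕP.<⇒≤ M≤j))

  support-difference : ∀ {M u} c b → Support M u → Support (suc M) (difference c b u)
  support-difference c b h j M≤j = 0+c*0 c (h j (ℕP.<⇒≤ M≤j)) (support-twist b h j M≤j)

  ev-twist : ∀ N b u ζ → ev (suc N) (twist b u) ζ ≈ᶜ b *ᶜ (ζ *ᶜ ev N u ζ)
  ev-twist N b u ζ = ≈ᶜ-trans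
    (+ᶜ-cong ≈ᶜ-refl (*ᶜ-cong ≈ᶜ-refl (ev-scale N b u)))
    (Sᶜ.solve 3 (λ b z e → b :* con 0ℚ :+ z :* (b :* e) := b :* (z :* e)) ≈ᶜ-refl b ζ (ev N u ζ))
    where
    open Sᶜ
    ev-scale : ∀ N b u → ev N (λ j → b *ᶜ u j) ζ ≈ᶜ b *ᶜ ev N u ζ
    ev-scale zero    b u = ≈ᶜ-sym (c*0 b ≈ᶜ-refl)
    ev-scale (suc N) b u = ≈ᶜ-trans (+ᶜ-cong ≈ᶜ-refl (*ᶜ-cong ≈ᶜ-refl (ev-scale N b (u ∘ suc))))
      (Sᶜ.solve 4 (λ b u z e → b :* u :+ z :* (b :* e) := b :* (u :+ z :* e)) ≈ᶜ-refl b (u 0) ζ (ev N (u ∘ suc) ζ))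

  vanishes-twist : ∀ {M u ζ} b → Vanishes M u ζ → Vanishes (suc M) (twist b u) ζ
  vanishes-twist {u = u} {ζ} b h (suc N) (ℕ.s≤s M≤N) =
    ≈ᶜ-trans (ev-twist N b u ζ) (c*0 b (c*0 ζ (h N M≤N)))

  vanishes-iterate : ∀ {M u ζ} b n → Vanishes M u ζ → Vanishes (n ℕ.+ M) (iterate b n u) ζ
  vanishes-iterate b zero    h = h
  vanishes-iterate b (suc n) h = vanishes-twist b (vanishes-iterate b n h)

  vanishes-0 : ∀ N ζ → ev N (λ _ → 0ᶜ) ζ ≈ᶜ 0ᶜ
  vanishes-0 zero    ζ = ≈ᶜ-refl
  vanishes-0 (suc N) ζ = 0+c*0 ζ ≈ᶜ-refl (vanishes-0 N ζ)

  vanishes-geometric : ∀ {M u ζ} a b n → Vanishes M u ζ → Vanishes (n ℕ.+ M) (geometric a b n u) ζ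
  vanishes-geometric {ζ = ζ} a b zero    h N M≤N = vanishes-0 N ζ
  vanishes-geometric {u = u} {ζ} a b (suc n) h N M≤N = ≈ᶜ-trans
    (ev-linear N (geometric a b n u) (fromR (power a n)) (iterate b n u) ζ)
    (0+c*0 (fromR (power a n)) (vanishes-geometric a b n h N (ℕP.<⇒≤ M≤N)) (vanishes-iterate b n h N (ℕP.<⇒≤ M≤N)))

  vanishes-difference : ∀ {M u ζ} c b → Vanishes M u ζ → Vanishes (suc M) (difference c b u) ζ
  vanishes-difference {u = u} {ζ} c b h N M≤N = ≈ᶜ-trans (ev-linear N u c (twist b u) ζ)
    (0+c*0 c (h N (ℕP.<⇒≤ M≤N)) (vanishes-twist b h N M≤N))

  -- The factor 1 - b z has its root at ζ. The two halves of the difference are truncated at lengths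
  -- N + 1 and N; the support bound makes the top coefficient zero, so they still cancel.
  difference-kills : ∀ {M u ζ} b → b *ᶜ ζ ≈ᶜ 1ᶜ → Support M u → Vanishes (suc M) (difference -1ᶜ b u) ζ
  difference-kills {u = u} {ζ} b bζ h (suc N) (ℕ.s≤s M≤N) = ≈ᶜ-trans
    (ev-linear (suc N) u -1ᶜ (twist b u) ζ)
    (≈ᶜ-trans (+ᶜ-cong (ev-extend N u ζ (h N M≤N)) (*ᶜ-cong ≈ᶜ-refl (ev-twist N b u ζ)))
    (≈ᶜ-trans (Sᶜ.solve 3 (λ b z e → e :+ (:- con 1ℚ) :* (b :* (z :* e)) := (con 1ℚ :- b :* z) :* e) ≈ᶜ-refl b ζ (ev N u ζ))
    (≈ᶜ-trans (*ᶜ-cong (+ᶜ-cong ≈ᶜ-refl (-ᶜ-cong bζ)) ≈ᶜ-refl)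
      (Sᶜ.solve 1 (λ e → (con 1ℚ :- con 1ℚ) :* e := con 0ℚ) ≈ᶜ-refl (ev N u ζ)))))
    where open Sᶜ

  energy : ℕ → (ℕ → C) → R
  energy M u = sum M (norm² ∘ u)

  0≤energy : ∀ M u → 0# ≤ energy M u
  0≤energy M u = sum-nonneg M (λ j → 0≤norm² (u j))

  -- Only an inequality: the shift may push the last coefficient out of the window of length M.
  energy-twist : ∀ M b u → norm² b ≈ 1# → energy M (twist b u) ≤ energy M u
  energy-twist zero    b u h = ≤-refl
  energy-twist (suc M) b u h =
    begin
      norm² (b *ᶜ 0ᶜ) + sum M (λ j → norm² (b *ᶜ u j))
        ≈⟨ +-cong (≈-trans (norm²-unit* h 0ᶜ) norm²-0) (sum-cong M (λ j → norm²-unit* h (u j))) ⟩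
      0# + energy M u
        ≈⟨ +-identityˡ (energy M u) ⟩
      energy M u
        ≤⟨ sum-extend (λ j → 0≤norm² (u j)) (ℕP.n≤1+n M) ⟩
      energy (suc M) u
    ∎

  energy-iterate : ∀ M b n u → norm² b ≈ 1# → energy M (iterate b n u) ≤ energy M u
  energy-iterate M b zero    u h = ≤-refl
  energy-iterate M b (suc n) u h = ≤-trans (energy-twist M b (iterate b n u) h) (energy-iterate M b n u h)

  -- 4 |x - a y|² = |A (x - y) + B (x + y)|² with A = 1 + a and B = 1 - a; after
  -- dropping B² |x + y|², the mixed term 2 A B (|x|² - |y|²) telescopes when summed.
  energy-difference : ∀ M a b s → 0# ≤ a → a ≤ 1# → norm² b ≈ 1# →
    (1# + a) * (1# + a) * energy M (difference -1ᶜ b s) ≤ fromℕ 4 * energy M (difference (-ᶜ fromR a) b s)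
  energy-difference M a b s 0≤a a≤1 ∣b∣ = ≤-by
    ((fromℕ 4 * X + c * E′ - (A * A * Y + c * E)) + c * (E - E′))
    (0≤+ (0≤diff summed) (0≤* 0≤c (0≤diff (energy-twist M b s ∣b∣))))
    (S.solve 6 (λ K x c e e′ y → K :* y :+ ((con (+ 4 ℚ./ 1) :* x :+ c :* e′ :- (K :* y :+ c :* e)) :+ c :* (e :- e′))
      := con (+ 4 ℚ./ 1) :* x) ≈-refl (A * A) X c E E′ Y)
    where
    open S
    A = 1# + a
    B = 1# - a
    c = fromℕ 2 * (A * B)
    X = energy M (difference (-ᶜ fromR a) b s)
    Y = energy M (difference -1ᶜ b s)
    E = energy M s
    E′ = energy M (twist b s)
    0≤c : 0# ≤ c
    0≤c = 0≤* (0≤fromℕ 2) (0≤* (0≤+ 0≤1 0≤a) (0≤diff a≤1))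
    pointwise : ∀ j → A * A * norm² (difference -1ᶜ b s j) + c * norm² (s j)
                    ≤ fromℕ 4 * norm² (difference (-ᶜ fromR a) b s j) + c * norm² (twist b s j)
    pointwise j = ≤-by (B * B * norm² (s j +ᶜ twist b s j)) (0≤* (0≤sq B) (0≤norm² (s j +ᶜ twist b s j)))
      (S.solve 5 (λ x y z w a → let A = con 1ℚ :+ a ; B = con 1ℚ :- a ; c = con (+ 2 ℚ./ 1) :* (A :* B)
                                    ur = x :+ (:- con 1ℚ :* z :- :- con 0ℚ :* w)
                                    ui = y :+ (:- con 1ℚ :* w :+ :- con 0ℚ :* z)
                                    vr = x :+ (:- a :* z :- :- con 0ℚ :* w)
                                    vi = y :+ (:- a :* w :+ :- con 0ℚ :* z) in
         (A :* A :* (ur :* ur :+ ui :* ui) :+ c :* (x :* x :+ y :* y))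
           :+ B :* B :* ((x :+ z) :* (x :+ z) :+ (y :+ w) :* (y :+ w))
         := con (+ 4 ℚ./ 1) :* (vr :* vr :+ vi :* vi) :+ c :* (z :* z :+ w :* w)) ≈-refl
        (re (s j)) (im (s j)) (re (twist b s j)) (im (twist b s j)) a)
    summed : A * A * Y + c * E ≤ fromℕ 4 * X + c * E′
    summed = ≤-trans (proj₂ (sum-linear M (A * A) (norm² ∘ difference -1ᶜ b s) c (norm² ∘ s)))
      (≤-trans (sum-mono M pointwise)
        (proj₁ (sum-linear M (fromℕ 4) (norm² ∘ difference (-ᶜ fromR a) b s) c (norm² ∘ twist b s))))

  -- A triangle inequality without square roots: adding δ |u + e|² to |u - δ e|² removes the mixed
  -- term and leaves (1 + δ) |u|² + (δ + δ²) |e|².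
  energy-remainder : ∀ M δ u e → 0# ≤ δ → energy M e ≤ energy M u →
    energy M (λ j → u j -ᶜ fromR δ *ᶜ e j) ≤ (1# + δ) * (1# + δ) * energy M u
  energy-remainder M δ u e 0≤δ e≤u = begin
    energy M (λ j → u j -ᶜ fromR δ *ᶜ e j)
      ≤⟨ sum-mono M pointwise ⟩
    sum M (λ j → (1# + δ) * norm² (u j) + (δ + δ * δ) * norm² (e j))
      ≈⟨ sum-linear M (1# + δ) (norm² ∘ u) (δ + δ * δ) (norm² ∘ e) ⟩
    (1# + δ) * energy M u + (δ + δ * δ) * energy M e
      ≤⟨ +-mono-≤ ≤-refl (*-monoˡ (0≤+ 0≤δ (0≤sq δ)) e≤u) ⟩
    (1# + δ) * energy M u + (δ + δ * δ) * energy M u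
      ≈⟨ S.solve 2 (λ d u → (con 1ℚ :+ d) :* u :+ (d :+ d :* d) :* u := (con 1ℚ :+ d) :* (con 1ℚ :+ d) :* u) ≈-refl δ (energy M u) ⟩
    (1# + δ) * (1# + δ) * energy M u
    ∎
    where
    open S using (con; _:+_; _:*_; _:-_; :-_; _:=_)
    pointwise : ∀ j → norm² (u j -ᶜ fromR δ *ᶜ e j) ≤ (1# + δ) * norm² (u j) + (δ + δ * δ) * norm² (e j)
    pointwise j = ≤-by (δ * norm² (u j +ᶜ e j)) (0≤* 0≤δ (0≤norm² (u j +ᶜ e j)))
      (S.solve 5 (λ x y z w d → let r = x :+ :- (d :* z :- con 0ℚ :* w) ; i = y :+ :- (d :* w :+ con 0ℚ :* z) in
          (r :* r :+ i :* i) :+ d :* ((x :+ z) :* (x :+ z) :+ (y :+ w) :* (y :+ w))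
          := (con 1ℚ :+ d) :* (x :* x :+ y :* y) :+ (d :+ d :* d) :* (z :* z :+ w :* w)) ≈-refl
        (re (u j)) (im (u j)) (re (e j)) (im (e j)) δ)

  module _ (q : ℕ) (η : R) (qη≈1 : fromℕ q * η ≈ 1#) (0≤η : 0# ≤ η) (8η≤1 : fromℕ 8 * η ≤ 1#) where
    private
      open S using (con; _:+_; _:*_; _:-_; :-_; _:=_)

      n : ℕ
      n = q ℕ.* q

      a : R
      a = 1# - η

      η≤1 : η ≤ 1#
      η≤1 = ≤-by ((1# - fromℕ 8 * η) + fromℕ 7 * η) (0≤+ (0≤diff 8η≤1) (0≤* (0≤fromℕ 7) 0≤η))
        (S.solve 1 (λ h → h :+ ((con 1ℚ :- con (+ 8 ℚ./ 1) :* h) :+ con (+ 7 ℚ./ 1) :* h) := con 1ℚ) ≈-refl η)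

      0≤a : 0# ≤ a
      0≤a = 0≤diff η≤1

      a≤1 : a ≤ 1#
      a≤1 = ≤-by η 0≤η (S.solve 1 (λ h → (con 1ℚ :- h) :+ h := con 1ℚ) ≈-refl η)

      δ : R
      δ = power a n

      0≤δ : 0# ≤ δ
      0≤δ = 0≤power 0≤a n

      -- This is the purpose of n = q²: then n η = q, so `power-decay` gives δ (1 + q) ≤ 1, and q η
      -- = 1 turns this into δ ≤ η.
      δ≤η : δ ≤ η
      δ≤η = begin
        δ                              ≈⟨ S.solve 1 (λ d → d := d :* con 1ℚ) ≈-refl δ ⟩
        δ * 1#                         ≤⟨ *-monoˡ 0≤δ (proj₂ qη≈1) ⟩
        δ * (fromℕ q * η)              ≤⟨ ≤-by (δ * η) (0≤* 0≤δ 0≤η) ≈-refl ⟩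
        δ * (fromℕ q * η) + δ * η      ≈⟨ S.solve 3 (λ d q h → d :* (q :* h) :+ d :* h := h :* (d :* (con 1ℚ :+ q :* con 1ℚ))) ≈-refl δ (fromℕ q) η ⟩
        η * (δ * (1# + fromℕ q * 1#))
          ≈⟨ *-cong ≈-refl (*-cong ≈-refl (+-cong ≈-refl (≈-trans (*-cong ≈-refl (≈-sym qη≈1))
               (≈-trans (≈-sym (*-assoc (fromℕ q) (fromℕ q) η)) (*-cong (≈-sym (fromℕ-* q q)) ≈-refl))))) ⟩
        η * (δ * (1# + fromℕ n * η))   ≤⟨ *-monoˡ 0≤η (power-decay 0≤η η≤1 n) ⟩
        η * 1#                         ≈⟨ *-identityʳ η ⟩
        η                              ∎

      t : R
      t = 1# - fromℕ 4 * η

      0≤t : 0# ≤ t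
      0≤t = ≤-by ((1# - fromℕ 8 * η) + fromℕ 4 * η) (0≤+ (0≤diff 8η≤1) (0≤* (0≤fromℕ 4) 0≤η))
        (S.solve 1 (λ h → con 0ℚ :+ ((con 1ℚ :- con (+ 8 ℚ./ 1) :* h) :+ con (+ 4 ℚ./ 1) :* h) := con 1ℚ :- con (+ 4 ℚ./ 1) :* h) ≈-refl η)

      -- One factor enlarges the energy at most by 1 / (1 - 4 η). The estimates give (1 + a)² X ≤ 4
      -- (1 + η)² Y, and (1 + a)² = (2 - η)² dominates 4 (1 + η)² (1 - 4 η), so the common factor
      -- cancels.
      energy-factor : ∀ M b u → norm² b ≈ 1# → t * energy M (factor a b n u) ≤ energy M u
      energy-factor M b u ∣b∣ = *-cancelˡ-1≤ {c} 1≤c (begin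
        c * (t * X)
          ≤⟨ ≤-by (rest * X) (0≤* 0≤rest (0≤energy M (factor a b n u)))
               (S.solve 2 (λ h x → let A = con 1ℚ :+ h in con (+ 4 ℚ./ 1) :* (A :* A) :* ((con 1ℚ :- con (+ 4 ℚ./ 1) :* h) :* x)
                   :+ (con (+ 4 ℚ./ 1) :* h :+ con (+ 29 ℚ./ 1) :* (h :* h) :+ con (+ 16 ℚ./ 1) :* (h :* (h :* h))) :* x
                 := (con 1ℚ :+ (con 1ℚ :- h)) :* (con 1ℚ :+ (con 1ℚ :- h)) :* x) ≈-refl η X) ⟩
        (1# + a) * (1# + a) * X
          ≤⟨ energy-difference M a b (geometric a b n u) 0≤a a≤1 ∣b∣ ⟩
        fromℕ 4 * energy M (difference (-ᶜ fromR a) b (geometric a b n u))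
          ≈⟨ *-cong ≈-refl (sum-cong M (λ j → norm²-cong (telescope a b n u j))) ⟩
        fromℕ 4 * energy M (λ j → u j -ᶜ fromR δ *ᶜ iterate b n u j)
          ≤⟨ *-monoˡ (0≤fromℕ 4) (energy-remainder M δ u (iterate b n u) 0≤δ (energy-iterate M b n u ∣b∣)) ⟩
        fromℕ 4 * ((1# + δ) * (1# + δ) * Y)
          ≤⟨ *-monoˡ (0≤fromℕ 4) (*-monoʳ (0≤energy M u)
               (≤-trans (*-monoʳ (0≤+ 0≤1 0≤δ) 1+δ≤1+η) (*-monoˡ (0≤+ 0≤1 0≤η) 1+δ≤1+η))) ⟩
        fromℕ 4 * ((1# + η) * (1# + η) * Y)
          ≈⟨ ≈-sym (*-assoc (fromℕ 4) ((1# + η) * (1# + η)) Y) ⟩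
        c * Y
        ∎)
        where
        X = energy M (factor a b n u)
        Y = energy M u
        c = fromℕ 4 * ((1# + η) * (1# + η))
        -- The exact difference (2 - η)² - 4 (1 + η)² (1 - 4 η).
        rest = fromℕ 4 * η + fromℕ 29 * (η * η) + fromℕ 16 * (η * (η * η))
        0≤rest : 0# ≤ rest
        0≤rest = 0≤+ (0≤+ (0≤* (0≤fromℕ 4) 0≤η) (0≤* (0≤fromℕ 29) (0≤sq η))) (0≤* (0≤fromℕ 16) (0≤* 0≤η (0≤sq η)))
        1+δ≤1+η : 1# + δ ≤ 1# + η
        1+δ≤1+η = +-mono-≤ ≤-refl δ≤η
        1≤c : 1# ≤ c
        1≤c = ≤-by (fromℕ 3 + fromℕ 8 * η + fromℕ 4 * (η * η))
          (0≤+ (0≤+ (0≤fromℕ 3) (0≤* (0≤fromℕ 8) 0≤η)) (0≤* (0≤fromℕ 4) (0≤sq η)))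
          (S.solve 1 (λ h → con 1ℚ :+ (con (+ 3 ℚ./ 1) :+ con (+ 8 ℚ./ 1) :* h :+ con (+ 4 ℚ./ 1) :* (h :* h))
            := con (+ 4 ℚ./ 1) :* ((con 1ℚ :+ h) :* (con 1ℚ :+ h))) ≈-refl η)

      n≡suc : 0 ℕ.< q → Σ[ n′ ∈ ℕ ] n ≡ suc n′
      n≡suc (ℕ.s≤s {n = q′} _) = q′ ℕ.+ q′ ℕ.* q , ≡.refl

    -- A factor has degree n. The count n + 1 follows the support lemmas, which charge n for
    -- `geometric` and 1 for `difference`.
    degree : ℕ → ℕ
    degree zero    = 0
    degree (suc r) = suc (n ℕ.+ degree r)

    record Annihilating {r} (ζ : Fin r → C) : Set where
      field
        poly      : ℕ → C
        poly-0    : poly 0 ≈ᶜ 1ᶜ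
        support   : Support (suc (degree r)) poly
        vanishes  : ∀ l → Vanishes (suc (degree r)) poly (ζ l)
        energy-≤1 : ∀ M → power t r * energy M poly ≤ 1#

    factor-head : ∀ b u m → factor a b (suc m) u 0 ≈ᶜ u 0
    factor-head b u m = ≈ᶜ-trans (+ᶜ-cong (geometric-head m) ≈ᶜ-refl)
      (Sᶜ.solve 2 (λ u b → u Sᶜ.:+ (Sᶜ.:- Sᶜ.con 1ℚ) Sᶜ.:* (b Sᶜ.:* Sᶜ.con 0ℚ) Sᶜ.:= u) ≈ᶜ-refl (u 0) b)
      where
      geometric-head : ∀ m → geometric a b (suc m) u 0 ≈ᶜ u 0
      geometric-head zero    = Sᶜ.solve 1 (λ u → Sᶜ.con 0ℚ Sᶜ.:+ Sᶜ.con 1ℚ Sᶜ.:* u Sᶜ.:= u) ≈ᶜ-refl (u 0)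
      geometric-head (suc m) = ≈ᶜ-trans (+ᶜ-cong (geometric-head m) ≈ᶜ-refl)
        (Sᶜ.solve 3 (λ u p b → u Sᶜ.:+ p Sᶜ.:* (b Sᶜ.:* Sᶜ.con 0ℚ) Sᶜ.:= u) ≈ᶜ-refl (u 0) (fromR (power a (suc m))) b)

    -- One factor is multiplied on per frequency, with b = ζ̄ = ζ⁻¹ on the unit circle; later
    -- factors keep earlier roots. The condition 0 < q ensures n ≥ 1, so the geometric sum is
    -- nonempty and the constant coefficient stays 1.
    annihilating : 0 ℕ.< q → ∀ {r} (ζ : Fin r → C) → (∀ l → norm² (ζ l) ≈ 1#) → Annihilating ζ
    annihilating 0<q {zero} ζ ∣ζ∣ = record
      { poly = one ; poly-0 = ≈ᶜ-refl ; support = λ { (suc j) _ → ≈ᶜ-refl } ; vanishes = λ ()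
      ; energy-≤1 = λ M → ≤-trans (proj₁ (*-identityˡ (energy M one))) (energy-one M) }
      where
      one : ℕ → C
      one zero    = 1ᶜ
      one (suc j) = 0ᶜ
      energy-one : ∀ M → energy M one ≤ 1#
      energy-one zero    = 0≤1
      energy-one (suc M) = ≤-trans (+-mono-≤ ≤-refl (proj₁ (sum-const M (norm² 0ᶜ))))
        (proj₁ (S.solve 1 (λ m → (con 1ℚ :* con 1ℚ :+ con 0ℚ :* con 0ℚ) :+ m :* (con 0ℚ :* con 0ℚ :+ con 0ℚ :* con 0ℚ) := con 1ℚ) ≈-refl (fromℕ M)))
    annihilating 0<q {suc r} ζ ∣ζ∣ = record
      { poly = factor a b n u
      ; poly-0 = ≈ᶜ-trans poly-0′ A.poly-0
      ; support = support-difference -1ᶜ b G-support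
      ; vanishes = λ
          { zero    → difference-kills b (conj-inverse (ζ zero) (∣ζ∣ zero)) G-support
          ; (suc l) → vanishes-difference -1ᶜ b
              (λ N le → vanishes-geometric a b n (A.vanishes l) N (ℕP.≤-trans (ℕP.≤-reflexive (ℕP.+-suc n (degree r))) le)) }
      ; energy-≤1 = λ M → ≤-trans
          (proj₁ (S.solve 3 (λ t p e → (t :* p) :* e := p :* (t :* e)) ≈-refl t (power t r) (energy M (factor a b n u))))
          (≤-trans (*-monoˡ (0≤power 0≤t r) (energy-factor M b u (≈-trans (norm²-conj (ζ zero)) (∣ζ∣ zero)))) (A.energy-≤1 M))
      }
      where
      module A = Annihilating (annihilating 0<q (ζ ∘ suc) (∣ζ∣ ∘ suc))
      u = A.poly
      b = conj (ζ zero)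
      G-support : Support (suc (n ℕ.+ degree r)) (geometric a b n u)
      G-support j le = support-geometric a b n A.support j (ℕP.≤-trans (ℕP.≤-reflexive (ℕP.+-suc n (degree r))) le)
      poly-0′ : factor a b n u 0 ≈ᶜ u 0
      poly-0′ with n≡suc 0<q
      ... | n′ , eq = ≡.subst (λ m → factor a b m u 0 ≈ᶜ u 0) (≡.sym eq) (factor-head b u n′)

    -- Bernoulli gives tʳ ≥ 1 - 4 r η ≥ 1/2, and tʳ times the energy is at most 1.
    energy-≤2 : ∀ {r} (ζ : Fin r → C) (p : Annihilating ζ) → fromℕ 8 * (fromℕ r * η) ≤ 1# →
      ∀ M → energy M (Annihilating.poly p) ≤ fromℕ 2
    energy-≤2 {r} ζ p 8rη≤1 M = ≤-by
      (fromℕ 2 * (1# - power t r * E) + fromℕ 2 * ((power t r - (1# - fromℕ r * (fromℕ 4 * η))) * E)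
        + (1# - fromℕ 8 * (fromℕ r * η)) * E)
      (0≤+ (0≤+ (0≤* (0≤fromℕ 2) (0≤diff (Annihilating.energy-≤1 p M)))
                (0≤* (0≤fromℕ 2) (0≤* (0≤diff (bernoulli 0≤4η 4η≤1 r)) 0≤E)))
           (0≤* (0≤diff 8rη≤1) 0≤E))
      (S.solve 4 (λ e p r h → e :+ (con (+ 2 ℚ./ 1) :* (con 1ℚ :- p :* e)
          :+ con (+ 2 ℚ./ 1) :* ((p :- (con 1ℚ :- r :* (con (+ 4 ℚ./ 1) :* h))) :* e)
          :+ (con 1ℚ :- con (+ 8 ℚ./ 1) :* (r :* h)) :* e) := con (+ 2 ℚ./ 1)) ≈-refl E (power t r) (fromℕ r) η)
      where
      E = energy M (Annihilating.poly p)
      0≤E = 0≤energy M (Annihilating.poly p)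
      0≤4η : 0# ≤ fromℕ 4 * η
      0≤4η = 0≤* (0≤fromℕ 4) 0≤η
      4η≤1 : fromℕ 4 * η ≤ 1#
      4η≤1 = ≤-by t 0≤t (S.solve 1 (λ h → con (+ 4 ℚ./ 1) :* h :+ (con 1ℚ :- con (+ 4 ℚ./ 1) :* h) := con 1ℚ) ≈-refl η)

-- Linear prediction and averaging for samples of an exponential sum

module ExponentialSums (𝓡 : RealStructure) where
  open import Data.Nat.DivMod using (_/_; m≡m%n+[m/n]*n; m%n<n; m/n*n≤m)
  open RealAlgebra 𝓡
  open ComplexAlgebra 𝓡
  open Annihilator 𝓡
  private
    module S = Solver
    module Sᶜ = Solverᶜ

  finSum : ∀ {k} → (Fin k → C) → C
  finSum {zero}  f = 0ᶜ
  finSum {suc k} f = f zero +ᶜ finSum (f ∘ suc)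

  finSum-cong : ∀ {k} {f g : Fin k → C} → (∀ l → f l ≈ᶜ g l) → finSum f ≈ᶜ finSum g
  finSum-cong {zero}  h = ≈ᶜ-refl
  finSum-cong {suc k} h = +ᶜ-cong (h zero) (finSum-cong (h ∘ suc))

  pair : ℕ → (ℕ → C) → (ℕ → C) → C
  pair M p w = sumᶜ M (λ j → p j *ᶜ w j)

  pair-cong : ∀ M p {w w′} → (∀ j → w j ≈ᶜ w′ j) → pair M p w ≈ᶜ pair M p w′
  pair-cong zero    p h = ≈ᶜ-refl
  pair-cong (suc M) p h = +ᶜ-cong (*ᶜ-cong ≈ᶜ-refl (h 0)) (pair-cong M (p ∘ suc) (h ∘ suc))

  pair-+ : ∀ M p w w′ → pair M p (λ j → w j +ᶜ w′ j) ≈ᶜ pair M p w +ᶜ pair M p w′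
  pair-+ zero    p w w′ = Sᶜ.solve 0 (con 0ℚ := con 0ℚ :+ con 0ℚ) ≈ᶜ-refl
    where open Sᶜ
  pair-+ (suc M) p w w′ = ≈ᶜ-trans (+ᶜ-cong ≈ᶜ-refl (pair-+ M (p ∘ suc) (w ∘ suc) (w′ ∘ suc)))
    (Sᶜ.solve 5 (λ p w v W V → p :* (w :+ v) :+ (W :+ V) := (p :* w :+ W) :+ (p :* v :+ V)) ≈ᶜ-refl
      (p 0) (w 0) (w′ 0) (pair M (p ∘ suc) (w ∘ suc)) (pair M (p ∘ suc) (w′ ∘ suc)))
    where open Sᶜ

  pair-0 : ∀ M p → pair M p (λ _ → 0ᶜ) ≈ᶜ 0ᶜ
  pair-0 zero    p = ≈ᶜ-refl
  pair-0 (suc M) p = ≈ᶜ-trans (+ᶜ-cong ≈ᶜ-refl (pair-0 M (p ∘ suc)))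
    (Sᶜ.solve 1 (λ p → p :* con 0ℚ :+ con 0ℚ := con 0ℚ) ≈ᶜ-refl (p 0))
    where open Sᶜ

  GeometricSequence : C → (ℕ → C) → Set
  GeometricSequence ζ w = ∀ j → w (suc j) ≈ᶜ ζ *ᶜ w j

  pair-geometric : ∀ M p {ζ w} → GeometricSequence ζ w → pair M p w ≈ᶜ ev M p ζ *ᶜ w 0
  pair-geometric zero    p {ζ} {w} h = Sᶜ.solve 1 (λ w → con 0ℚ := con 0ℚ :* w) ≈ᶜ-refl (w 0)
    where open Sᶜ
  pair-geometric (suc M) p {ζ} {w} h = ≈ᶜ-trans
    (+ᶜ-cong ≈ᶜ-refl (≈ᶜ-trans (pair-geometric M (p ∘ suc) (h ∘ suc)) (*ᶜ-cong ≈ᶜ-refl (h 0))))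
    (Sᶜ.solve 4 (λ p w e z → p :* w :+ e :* (z :* w) := (p :+ z :* e) :* w) ≈ᶜ-refl
      (p 0) (w 0) (ev M (p ∘ suc) ζ) ζ)
    where open Sᶜ

  -- The components are described by their recursion instead of as vₗ ζₗʲ: this is the form in which
  -- the addition law of `cis` delivers them.
  record ExponentialSum (k : ℕ) (y : ℕ → C) : Set where
    field
      ratio     : Fin k → C
      unit      : ∀ l → norm² (ratio l) ≈ 1#
      component : Fin k → ℕ → C
      geom      : ∀ l → GeometricSequence (ratio l) (component l)
      total     : ∀ j → y j ≈ᶜ finSum (λ l → component l j)

  pair-vanishes : ∀ M p {k} (ζ : Fin k → C) (w : Fin k → ℕ → C) → (∀ l → GeometricSequence (ζ l) (w l)) →
    (∀ l → ev M p (ζ l) ≈ᶜ 0ᶜ) → pair M p (λ j → finSum (λ l → w l j)) ≈ᶜ 0ᶜ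
  pair-vanishes M p {zero}  ζ w g h = pair-0 M p
  pair-vanishes M p {suc k} ζ w g h = ≈ᶜ-trans
    (pair-+ M p (w zero) (λ j → finSum (λ l → w (suc l) j)))
    (≈ᶜ-trans (+ᶜ-cong (≈ᶜ-trans (pair-geometric M p (g zero)) (*ᶜ-cong (h zero) ≈ᶜ-refl))
                       (pair-vanishes M p (ζ ∘ suc) (w ∘ suc) (g ∘ suc) (h ∘ suc)))
      (Sᶜ.solve 1 (λ w → con 0ℚ :* w :+ con 0ℚ := con 0ℚ) ≈ᶜ-refl (w zero 0)))
    where open Sᶜ

  -- The annihilation solves for y(0) = - Σ_{j ≥ 1} pⱼ y(j). Of the energy 2 the coefficient p₀ = 1
  -- uses up 1, so Cauchy-Schwarz applies with a factor at most 1.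
  predict : ∀ m p y → p 0 ≈ᶜ 1ᶜ → pair (suc m) p y ≈ᶜ 0ᶜ → energy (suc m) p ≤ fromℕ 2 →
    norm² (y 0) ≤ energy m (y ∘ suc)
  predict m p y p0 vanish p≤2 = begin
    norm² (y 0)
      ≈⟨ norm²-cong y0 ⟩
    norm² (-ᶜ pair m (p ∘ suc) (y ∘ suc))
      ≈⟨ norm²-neg (pair m (p ∘ suc) (y ∘ suc)) ⟩
    norm² (pair m (p ∘ suc) (y ∘ suc))
      ≤⟨ cauchy-schwarz m (p ∘ suc) (y ∘ suc) ⟩
    energy m (p ∘ suc) * energy m (y ∘ suc)
      ≤⟨ *-monoʳ (0≤energy m (y ∘ suc)) tail≤1 ⟩
    1# * energy m (y ∘ suc)
      ≈⟨ *-identityˡ (energy m (y ∘ suc)) ⟩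
    energy m (y ∘ suc)
    ∎
    where
    open Sᶜ using (con; _:+_; _:*_; _:-_; :-_; _:=_)
    y0 : y 0 ≈ᶜ -ᶜ pair m (p ∘ suc) (y ∘ suc)
    y0 = ≈ᶜ-trans (Sᶜ.solve 2 (λ y r → y := (con 1ℚ :* y :+ r) :- r) ≈ᶜ-refl (y 0) (pair m (p ∘ suc) (y ∘ suc)))
      (≈ᶜ-trans (+ᶜ-cong (≈ᶜ-trans (+ᶜ-cong (*ᶜ-cong (≈ᶜ-sym p0) ≈ᶜ-refl) ≈ᶜ-refl) vanish) ≈ᶜ-refl)
        (Sᶜ.solve 1 (λ r → con 0ℚ :+ r := r) ≈ᶜ-refl (-ᶜ pair m (p ∘ suc) (y ∘ suc))))
    tail≤1 : energy m (p ∘ suc) ≤ 1#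
    tail≤1 = ≤-shift p≤2 (≈-trans
      (+-cong ≈-refl (+-cong ≈-refl (-‿cong (+-cong (norm²-cong p0) ≈-refl))))
      (S.solve 1 (λ e → e S.:+ (S.con (+ 2 ℚ./ 1) S.:- ((S.con 1ℚ S.:* S.con 1ℚ S.:+ S.con 0ℚ S.:* S.con 0ℚ) S.:+ e)) S.:= S.con 1ℚ)
        ≈-refl (energy m (p ∘ suc))))

  degree-bound : ℕ → ℕ
  degree-bound k = k ℕ.* suc (8 ℕ.* k ℕ.* (8 ℕ.* k))

  predict-exponentialSum : ∀ {k y} → 1 ℕ.≤ k → ExponentialSum k y →
    norm² (y 0) ≤ energy (degree-bound k) (y ∘ suc)
  predict-exponentialSum {suc k} {y} _ Y = ≡.subst (λ m → norm² (y 0) ≤ energy m (y ∘ suc)) degree≡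
    (predict m poly y poly-0
      (≈ᶜ-trans (pair-cong (suc m) poly total)
        (pair-vanishes (suc m) poly ratio component geom (λ l → vanishes l (suc m) ℕP.≤-refl)))
      (energy-≤2 q η qη≈1 0≤η 8η≤1 ratio P (proj₁ 8kη≈1) (suc m)))
    where
    open ExponentialSum Y
    -- Eight times the number of frequencies (here `suc k`), so that the hypothesis 8 r η ≤ 1 of
    -- `energy-≤2` holds with equality.
    q : ℕ
    q = 8 ℕ.* suc k
    q′ : ℕ
    q′ = k ℕ.+ 7 ℕ.* suc k
    η : R
    η = fromℚ (1/suc q′)
    qη≈1 : fromℕ q * η ≈ 1#
    qη≈1 = ≈-trans (≈-sym (fromℚ-* (+ q ℚ./ 1) (1/suc q′)))
      (≡⇒≈ (≡.cong fromℚ (RationalLemmas.suc*1/suc q′)))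
    0≤η : 0# ≤ η
    0≤η = 0≤fromℚ (ℚP.nonNegative⁻¹ (1/suc q′) {{ℚP.normalize-nonNeg 1 (suc q′)}})
    8kη≈1 : fromℕ 8 * (fromℕ (suc k) * η) ≈ 1#
    8kη≈1 = ≈-trans (≈-trans (≈-sym (*-assoc (fromℕ 8) (fromℕ (suc k)) η)) (*-cong (≈-sym (fromℕ-* 8 (suc k))) ≈-refl)) qη≈1
    8η≤1 : fromℕ 8 * η ≤ 1#
    8η≤1 = ≤-trans (*-monoʳ 0≤η (fromℕ-mono (ℕP.m≤m*n 8 (suc k)))) (proj₁ qη≈1)
    P : Annihilating q η qη≈1 0≤η 8η≤1 ratio
    P = annihilating q η qη≈1 0≤η 8η≤1 (ℕ.s≤s ℕ.z≤n) ratio unit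
    open Annihilating P
    m = degree q η qη≈1 0≤η 8η≤1 (suc k)
    degree≡ : m ≡ degree-bound (suc k)
    degree≡ = go (suc k)
      where
      go : ∀ r → degree q η qη≈1 0≤η 8η≤1 r ≡ r ℕ.* suc (q ℕ.* q)
      go zero    = ≡.refl
      go (suc r) = ≡.cong (λ d → suc (q ℕ.* q ℕ.+ d)) (go r)

  private
    complexPower : C → ℕ → C
    complexPower ζ zero    = 1ᶜ
    complexPower ζ (suc a) = ζ *ᶜ complexPower ζ a

    geometric-jump : ∀ {ζ w} → GeometricSequence ζ w → ∀ a j → w (a ℕ.+ j) ≈ᶜ complexPower ζ a *ᶜ w j
    geometric-jump {w = w} h zero    j = Sᶜ.solve 1 (λ w → w Sᶜ.:= Sᶜ.con 1ℚ Sᶜ.:* w) ≈ᶜ-refl (w j)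
    geometric-jump {ζ} {w} h (suc a) j = ≈ᶜ-trans (h (a ℕ.+ j)) (≈ᶜ-trans (*ᶜ-cong ≈ᶜ-refl (geometric-jump h a j))
      (Sᶜ.solve 3 (λ z p w → z Sᶜ.:* (p Sᶜ.:* w) Sᶜ.:= (z Sᶜ.:* p) Sᶜ.:* w) ≈ᶜ-refl ζ (complexPower ζ a) (w j)))

    complexPower-unit : ∀ {ζ} → norm² ζ ≈ 1# → ∀ a → norm² (complexPower ζ a) ≈ 1#
    complexPower-unit h zero    = S.solve 0 (S.con 1ℚ S.:* S.con 1ℚ S.:+ S.con 0ℚ S.:* S.con 0ℚ S.:= S.con 1ℚ) ≈-refl
    complexPower-unit {ζ} h (suc a) = ≈-trans (norm²-unit* h (complexPower ζ a)) (complexPower-unit h a)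

  -- Subsampling replaces ζ by ζᵃ, still on the unit circle and still k terms, so the prediction
  -- applies with the same constants.
  stride : ∀ {k y} a → ExponentialSum k y → ExponentialSum k (λ j → y (j ℕ.* a))
  stride a Y = record
    { ratio     = λ l → complexPower (ratio l) a
    ; unit      = λ l → complexPower-unit (unit l) a
    ; component = λ l j → component l (j ℕ.* a)
    ; geom      = λ l j → geometric-jump (geom l) a (j ℕ.* a)
    ; total     = λ j → total (j ℕ.* a) }
    where open ExponentialSum Y

  sum-mono-< : ∀ n {f g} → (∀ i → i ℕ.< n → f i ≤ g i) → sum n f ≤ sum n g
  sum-mono-< zero    h = ≤-refl
  sum-mono-< (suc n) h = +-mono-≤ (h 0 (ℕ.s≤s ℕ.z≤n)) (sum-mono-< n (λ i i<n → h (suc i) (ℕ.s≤s i<n)))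

  -- The predictions with step sizes a = 1, …, A are added up.
  stride-average : ∀ {k y} → 1 ℕ.≤ k → ExponentialSum k y → ∀ A →
    fromℕ A * norm² (y 0) ≤ fromℕ (degree-bound k) * energy (A ℕ.* degree-bound k) (y ∘ suc)
  stride-average {k} {y} 1≤k Y A = begin
    fromℕ A * norm² (y 0)
      ≈˘⟨ sum-const A (norm² (y 0)) ⟩
    sum A (λ _ → norm² (y 0))
      ≤⟨ sum-mono A (λ a → predict-exponentialSum 1≤k (stride (suc a) Y)) ⟩
    sum A (λ a → sum m (λ j → norm² (y (suc j ℕ.* suc a))))
      ≈⟨ sum-swap A m (λ a j → norm² (y (suc j ℕ.* suc a))) ⟩
    sum m (λ j → sum A (λ a → norm² (y (suc j ℕ.* suc a))))
      ≤⟨ sum-mono-< m each ⟩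
    sum m (λ _ → energy (A ℕ.* m) (y ∘ suc))
      ≈⟨ sum-const m (energy (A ℕ.* m) (y ∘ suc)) ⟩
    fromℕ m * energy (A ℕ.* m) (y ∘ suc)
    ∎
    where
    m = degree-bound k
    -- For fixed j the indices (j + 1) (a + 1) are distinct and at most A m, so no sample repeats.
    -- Repetitions between different j cost the factor m.
    each : ∀ j → j ℕ.< m → sum A (λ a → norm² (y (suc j ℕ.* suc a))) ≤ energy (A ℕ.* m) (y ∘ suc)
    each j j<m = begin
      sum A (λ a → norm² (y (suc j ℕ.* suc a)))
        ≈⟨ sum-cong A (λ a → ≡⇒≈ (≡.cong (λ i → norm² (y i)) (ℕP.*-comm (suc j) (suc a)))) ⟩
      sum A (λ a → norm² (y (suc (j ℕ.+ a ℕ.* suc j))))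
        ≤⟨ sum-stride (λ i → 0≤norm² (y (suc i))) j A ⟩
      energy (A ℕ.* suc j) (y ∘ suc)
        ≤⟨ sum-extend (λ i → 0≤norm² (y (suc i))) (ℕP.*-monoʳ-≤ A j<m) ⟩
      energy (A ℕ.* m) (y ∘ suc)
      ∎

  -- The ℓ samples after y(0) leave room for strides up to A = ℓ / m. Since ℓ < m + A m, one has n ≤
  -- 2m + 2mA: the averaged predictions pay for 2mA, and the sample y(0) inside the window pays for
  -- 2m. Windows shorter than m thus need no separate case.
  endpoint-bound : ∀ {k y} → 1 ℕ.≤ k → ExponentialSum k y → ∀ ℓ n → n ℕ.≤ suc (ℓ ℕ.+ ℓ) →
    let m = degree-bound k in
    fromℕ n * norm² (y 0) ≤ fromℕ (2 ℕ.* (m ℕ.* m)) * energy (suc ℓ) y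
  endpoint-bound {k} {y} 1≤k Y ℓ n n≤ = begin
    fromℕ n * N₀
      ≤⟨ *-monoʳ (0≤norm² (y 0)) (fromℕ-mono n≤2m+2mA) ⟩
    fromℕ (2 ℕ.* m ℕ.+ 2 ℕ.* m ℕ.* A) * N₀
      ≈⟨ *-cong (≈-trans (fromℕ-+ (2 ℕ.* m) (2 ℕ.* m ℕ.* A)) (+-cong ≈-refl (fromℕ-* (2 ℕ.* m) A))) ≈-refl ⟩
    (fromℕ (2 ℕ.* m) + fromℕ (2 ℕ.* m) * fromℕ A) * N₀
      ≈⟨ S.solve 3 (λ a b x → (a S.:+ a S.:* b) S.:* x S.:= a S.:* x S.:+ a S.:* (b S.:* x)) ≈-refl (fromℕ (2 ℕ.* m)) (fromℕ A) N₀ ⟩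
    fromℕ (2 ℕ.* m) * N₀ + fromℕ (2 ℕ.* m) * (fromℕ A * N₀)
      ≤⟨ +-mono-≤ (*-monoʳ (0≤norm² (y 0)) (fromℕ-mono 2m≤2mm))
           (*-monoˡ (0≤fromℕ (2 ℕ.* m)) (≤-trans (stride-average 1≤k Y A)
             (*-monoˡ (0≤fromℕ m) (sum-extend (λ i → 0≤norm² (y (suc i))) (m/n*n≤m ℓ m))))) ⟩
    fromℕ (2 ℕ.* (m ℕ.* m)) * N₀ + fromℕ (2 ℕ.* m) * (fromℕ m * E)
      ≈⟨ +-cong ≈-refl (≈-trans (≈-sym (*-assoc (fromℕ (2 ℕ.* m)) (fromℕ m) E))
           (*-cong (≈-trans (≈-sym (fromℕ-* (2 ℕ.* m) m)) (≡⇒≈ (≡.cong fromℕ (ℕP.*-assoc 2 m m)))) ≈-refl)) ⟩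
    fromℕ (2 ℕ.* (m ℕ.* m)) * N₀ + fromℕ (2 ℕ.* (m ℕ.* m)) * E
      ≈˘⟨ distribˡ (fromℕ (2 ℕ.* (m ℕ.* m))) N₀ E ⟩
    fromℕ (2 ℕ.* (m ℕ.* m)) * (N₀ + E)
    ∎
    where
    m = degree-bound k
    N₀ = norm² (y 0)
    E = energy ℓ (y ∘ suc)
    instance
      m≢0 : ℕ.NonZero m
      m≢0 = ℕ.>-nonZero (ℕP.≤-trans 1≤k (ℕP.m≤m*n k (suc (8 ℕ.* k ℕ.* (8 ℕ.* k)))))
    A = ℓ / m
    2m≤2mm : 2 ℕ.* m ℕ.≤ 2 ℕ.* (m ℕ.* m)
    2m≤2mm = ℕP.*-monoʳ-≤ 2 (ℕP.m≤m*n m m)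
    ℓ<m+Am : suc ℓ ℕ.≤ m ℕ.+ A ℕ.* m
    ℓ<m+Am = ≡.subst (ℕ._< m ℕ.+ A ℕ.* m) (≡.sym (m≡m%n+[m/n]*n ℓ m)) (ℕP.+-monoˡ-< (A ℕ.* m) (m%n<n ℓ m))
    n≤2m+2mA : n ℕ.≤ 2 ℕ.* m ℕ.+ 2 ℕ.* m ℕ.* A
    n≤2m+2mA = ℕP.≤-trans n≤ (ℕP.≤-trans (ℕP.+-mono-≤ ℓ<m+Am (ℕP.<⇒≤ ℓ<m+Am)) (ℕP.≤-reflexive
      (solve 2 (λ m a → (m :+ a :* m) :+ (m :+ a :* m) := con 2 :* m :+ con 2 :* m :* a) ≡.refl m A)))
      where open Data.Nat.Solver.+-*-Solver

  sum-reverse : ∀ m f g → (∀ i j → i ℕ.+ j ≡ m → f j ≈ g i) → sum (suc m) f ≈ sum (suc m) g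
  sum-reverse zero    f g h = +-cong (h 0 0 ≡.refl) ≈-refl
  sum-reverse (suc m) f g h = ≈-trans
    (+-cong (h (suc m) 0 (ℕP.+-identityʳ (suc m)))
      (sum-reverse m (f ∘ suc) g (λ i j eq → h i (suc j) (≡.trans (ℕP.+-suc i j) (≡.cong suc eq)))))
    (≈-trans (+-comm (g (suc m)) (sum (suc m) g)) (≈-sym (sum-last (suc m) g)))

  -- The origin of the exponent 21: m = k (1 + 64 k²) ≤ 128 k³ ≤ k¹⁰ because 128 = 2⁷ ≤ k⁷, and the
  -- remaining factor 2 is at most k.
  degree-bound-power : ∀ k → 2 ℕ.≤ k → 2 ℕ.* (degree-bound k ℕ.* degree-bound k) ℕ.≤ k ℕ.^ 21
  degree-bound-power k 2≤k = ℕP.≤-trans (ℕP.*-mono-≤ 2≤k (ℕP.*-mono-≤ m≤ m≤))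
    (ℕP.≤-reflexive (≡.cong (k ℕ.*_) (≡.sym (ℕP.^-distribˡ-+-* k 10 10))))
    where
    k² = k ℕ.* k
    1≤k : 1 ℕ.≤ k
    1≤k = ℕP.<⇒≤ 2≤k
    1≤64k² : 1 ℕ.≤ 64 ℕ.* k²
    1≤64k² = ℕP.*-mono-≤ {1} {64} (ℕ.s≤s ℕ.z≤n) (ℕP.*-mono-≤ 1≤k 1≤k)
    7-powers : 128 ℕ.≤ k ℕ.^ 7
    7-powers = ℕP.^-monoˡ-≤ 7 2≤k
    m≤ : degree-bound k ℕ.≤ k ℕ.^ 10
    m≤ = ℕP.*-monoʳ-≤ k (ℕP.≤-trans (ℕP.≤-trans
      (ℕP.+-mono-≤ {1} {64 ℕ.* k²} {8 ℕ.* k ℕ.* (8 ℕ.* k)} 1≤64k²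
        (ℕP.≤-reflexive (solve 1 (λ k → con 8 :* k :* (con 8 :* k) := con 64 :* (k :* k)) ≡.refl k)))
      (ℕP.≤-reflexive (solve 1 (λ x → con 64 :* x :+ con 64 :* x := con 128 :* x) ≡.refl k²)))
      (ℕP.≤-trans (ℕP.*-monoˡ-≤ k² 7-powers)
        (ℕP.≤-reflexive (≡.trans (≡.cong (λ x → k ℕ.^ 7 ℕ.* (k ℕ.* x)) (≡.sym (ℕP.*-identityʳ k)))
          (≡.sym (ℕP.^-distribˡ-+-* k 7 2))))))
      where open Data.Nat.Solver.+-*-Solver

  constant-norm : ∀ {y} → ExponentialSum 1 y → ∀ j → norm² (y j) ≈ norm² (y 0)
  constant-norm {y} Y zero    = ≈-refl
  constant-norm {y} Y (suc j) = ≈-trans (≈-trans (norm²-cong (single (suc j))) (≈-trans (norm²-cong (geom zero j))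
      (norm²-unit* (unit zero) (component zero j))))
    (≈-trans (norm²-cong (≈ᶜ-sym (single j))) (constant-norm Y j))
    where
    open ExponentialSum Y
    single : ∀ j → y j ≈ᶜ component zero j
    single j = ≈ᶜ-trans (total j) (Sᶜ.solve 1 (λ z → z Sᶜ.:+ Sᶜ.con 0ℚ Sᶜ.:= z) ≈ᶜ-refl (component zero j))

  -- The grid has i₀ points before the distinguished one and ℓ after it. The longer side, with the
  -- point itself, contains at least half of the grid, which is what `endpoint-bound` requires.
  grid-bound-≥2 : ∀ k → 2 ℕ.≤ k → (g : ℕ → R) → (∀ i → 0# ≤ g i) → ∀ i₀ ℓ {forward backward} →
    ExponentialSum k forward → (∀ j → norm² (forward j) ≈ g (i₀ ℕ.+ j)) →
    ExponentialSum k backward → (∀ i j → i ℕ.+ j ≡ i₀ → norm² (backward j) ≈ g i) →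
    fromℕ (i₀ ℕ.+ suc ℓ) * g i₀ ≤ fromℕ (k ℕ.^ 21) * sum (i₀ ℕ.+ suc ℓ) g
  grid-bound-≥2 k 2≤k g 0≤g i₀ ℓ {forward} {backward} F F≈ B B≈ with ℕP.≤-total i₀ ℓ
  ... | inj₁ i₀≤ℓ = begin
    fromℕ n * g i₀
      ≈⟨ *-cong ≈-refl (≈-trans (≡⇒≈ (≡.cong g (≡.sym (ℕP.+-identityʳ i₀)))) (≈-sym (F≈ 0))) ⟩
    fromℕ n * norm² (forward 0)
      ≤⟨ endpoint-bound (ℕP.<⇒≤ 2≤k) F ℓ n (ℕP.≤-trans (ℕP.≤-reflexive (ℕP.+-suc i₀ ℓ)) (ℕ.s≤s (ℕP.+-monoˡ-≤ ℓ i₀≤ℓ))) ⟩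
    fromℕ (2 ℕ.* (m ℕ.* m)) * energy (suc ℓ) forward
      ≤⟨ *-monoʳ (0≤energy (suc ℓ) forward) (fromℕ-mono (degree-bound-power k 2≤k)) ⟩
    fromℕ (k ℕ.^ 21) * energy (suc ℓ) forward
      ≤⟨ *-monoˡ (0≤fromℕ (k ℕ.^ 21)) (≤-trans (proj₁ (sum-cong (suc ℓ) F≈))
           (≤-trans (≤-by (sum i₀ g) (sum-nonneg i₀ 0≤g) (+-comm (sum (suc ℓ) (λ j → g (i₀ ℕ.+ j))) (sum i₀ g)))
             (proj₂ (sum-split i₀ (suc ℓ) g)))) ⟩
    fromℕ (k ℕ.^ 21) * sum n g
    ∎
    where
    m = degree-bound k
    n = i₀ ℕ.+ suc ℓ
  ... | inj₂ ℓ≤i₀ = begin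
    fromℕ n * g i₀
      ≈⟨ *-cong ≈-refl (≈-sym (B≈ i₀ 0 (ℕP.+-identityʳ i₀))) ⟩
    fromℕ n * norm² (backward 0)
      ≤⟨ endpoint-bound (ℕP.<⇒≤ 2≤k) B i₀ n (ℕP.≤-trans (ℕP.≤-reflexive (ℕP.+-suc i₀ ℓ)) (ℕ.s≤s (ℕP.+-monoʳ-≤ i₀ ℓ≤i₀))) ⟩
    fromℕ (2 ℕ.* (m ℕ.* m)) * energy (suc i₀) backward
      ≤⟨ *-monoʳ (0≤energy (suc i₀) backward) (fromℕ-mono (degree-bound-power k 2≤k)) ⟩
    fromℕ (k ℕ.^ 21) * energy (suc i₀) backward
      ≤⟨ *-monoˡ (0≤fromℕ (k ℕ.^ 21)) (≤-trans (proj₁ (sum-reverse i₀ (norm² ∘ backward) g B≈))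
           (sum-extend 0≤g (ℕP.≤-trans (ℕP.≤-reflexive (ℕP.+-comm 1 i₀)) (ℕP.+-monoʳ-≤ i₀ (ℕ.s≤s ℕ.z≤n))))) ⟩
    fromℕ (k ℕ.^ 21) * sum n g
    ∎
    where
    m = degree-bound k
    n = i₀ ℕ.+ suc ℓ

  -- The constant k²¹ is 0 for k = 0 and 1 for k = 1, so these cases must hold exactly: the empty
  -- sum vanishes, and a single exponential has constant modulus.
  grid-bound : ∀ k (g : ℕ → R) → (∀ i → 0# ≤ g i) → ∀ i₀ ℓ {forward backward} →
    ExponentialSum k forward → (∀ j → norm² (forward j) ≈ g (i₀ ℕ.+ j)) →
    ExponentialSum k backward → (∀ i j → i ℕ.+ j ≡ i₀ → norm² (backward j) ≈ g i) →
    fromℕ (i₀ ℕ.+ suc ℓ) * g i₀ ≤ fromℕ (k ℕ.^ 21) * sum (i₀ ℕ.+ suc ℓ) g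
  grid-bound zero g 0≤g i₀ ℓ {forward} F F≈ _ _ = begin
    fromℕ n * g i₀  ≈⟨ *-cong ≈-refl g≈0 ⟩
    fromℕ n * 0#    ≈⟨ S.solve 2 (λ n s → n S.:* S.con 0ℚ S.:= S.con 0ℚ S.:* s) ≈-refl (fromℕ n) (sum n g) ⟩
    0# * sum n g    ∎
    where
    n = i₀ ℕ.+ suc ℓ
    g≈0 : g i₀ ≈ 0#
    g≈0 = ≈-trans (≡⇒≈ (≡.cong g (≡.sym (ℕP.+-identityʳ i₀)))) (≈-trans (≈-sym (F≈ 0))
      (≈-trans (norm²-cong (ExponentialSum.total F 0)) norm²-0))
  grid-bound (suc zero) g 0≤g i₀ ℓ {forward} {backward} F F≈ B B≈ = begin
    fromℕ n * g i₀  ≈˘⟨ sum-const n (g i₀) ⟩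
    sum n (λ _ → g i₀) ≤⟨ sum-mono n (λ i → proj₂ (const i)) ⟩
    sum n g         ≈˘⟨ *-identityˡ (sum n g) ⟩
    1# * sum n g    ∎
    where
    n = i₀ ℕ.+ suc ℓ
    g₀ : norm² (forward 0) ≈ g i₀
    g₀ = ≈-trans (F≈ 0) (≡⇒≈ (≡.cong g (ℕP.+-identityʳ i₀)))
    const : ∀ i → g i ≈ g i₀
    const i with ℕP.≤-total i₀ i
    ... | inj₁ i₀≤i = ≈-trans (≡⇒≈ (≡.cong g (≡.sym (ℕP.m+[n∸m]≡n i₀≤i))))
      (≈-trans (≈-sym (F≈ (i ℕ.∸ i₀))) (≈-trans (constant-norm F (i ℕ.∸ i₀)) g₀))
    ... | inj₂ i≤i₀ = ≈-trans (≈-sym (B≈ i (i₀ ℕ.∸ i) (ℕP.m+[n∸m]≡n i≤i₀)))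
      (≈-trans (constant-norm B (i₀ ℕ.∸ i)) (B≈ i₀ 0 (ℕP.+-identityʳ i₀)))
  grid-bound k@(suc (suc _)) g 0≤g i₀ ℓ F F≈ B B≈ = grid-bound-≥2 k (ℕ.s≤s (ℕ.s≤s ℕ.z≤n)) g 0≤g i₀ ℓ F F≈ B B≈

-- Riemann sums and integrability of uniformly continuous functions

module Integration (𝓡 : RealStructure) where
  open import Data.Fin using (quotient; remainder; _↑ˡ_; _↑ʳ_)
  open RealAlgebra 𝓡
  open Solver using (solve; _:=_; _:+_; _:*_; con)
  open CauchyLemmas using (0<*; 0<½; frac-≤; half+half)
  open RationalLemmas using (scale-down)

  sumFin : ∀ {n} → (Fin n → R) → R
  sumFin = F.foldr _+_ 0#

  sumFin-cong : ∀ {n} {f g : Fin n → R} → (∀ i → f i ≈ g i) → sumFin f ≈ sumFin g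
  sumFin-cong {zero}  h = ≈-refl
  sumFin-cong {suc n} h = +-cong (h zero) (sumFin-cong (h ∘ suc))

  sumFin-mono : ∀ {n} {f g : Fin n → R} → (∀ i → f i ≤ g i) → sumFin f ≤ sumFin g
  sumFin-mono {zero}  h = ≤-refl
  sumFin-mono {suc n} h = +-mono-≤ (h zero) (sumFin-mono (h ∘ suc))

  sumFin-toℕ : ∀ n (g : ℕ → R) → sumFin {n} (g ∘ toℕ) ≈ sum n g
  sumFin-toℕ zero    g = ≈-refl
  sumFin-toℕ (suc n) g = +-cong ≈-refl (sumFin-toℕ n (g ∘ suc))

  sumFin-+ : ∀ {n} (f g : Fin n → R) → sumFin (λ i → f i + g i) ≈ sumFin f + sumFin g
  sumFin-+ {zero}  f g = ≈-sym (+-identityˡ 0#)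
  sumFin-+ {suc n} f g = ≈-trans (+-cong ≈-refl (sumFin-+ (f ∘ suc) (g ∘ suc)))
    (solve 4 (λ f g F G → (f :+ g) :+ (F :+ G) := (f :+ F) :+ (g :+ G)) ≈-refl
      (f zero) (g zero) (sumFin (f ∘ suc)) (sumFin (g ∘ suc)))

  sumFin-scale : ∀ {n} c (f : Fin n → R) → sumFin (λ i → c * f i) ≈ c * sumFin f
  sumFin-scale {zero}  c f = ≈-sym (zeroʳ c)
  sumFin-scale {suc n} c f = ≈-trans (+-cong ≈-refl (sumFin-scale c (f ∘ suc)))
    (≈-sym (distribˡ c (f zero) (sumFin (f ∘ suc))))

  sumFin-const : ∀ n c → sumFin {n} (λ _ → c) ≈ fromℕ n * c
  sumFin-const n c = ≈-trans (sumFin-toℕ n (λ _ → c)) (sum-const n c)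

  sumFin-split : ∀ m n (f : Fin (m ℕ.+ n) → R) →
    sumFin f ≈ sumFin (λ i → f (i ↑ˡ n)) + sumFin (λ j → f (m ↑ʳ j))
  sumFin-split zero    n f = ≈-sym (+-identityˡ (sumFin f))
  sumFin-split (suc m) n f = ≈-trans (+-cong ≈-refl (sumFin-split m n (f ∘ suc)))
    (≈-sym (+-assoc (f zero) (sumFin (λ i → f (suc (i ↑ˡ n)))) (sumFin (λ j → f (suc (m ↑ʳ j))))))

  quotient-↑ˡ : ∀ n m (j : Fin m) → quotient {suc n} m (j ↑ˡ (n ℕ.* m)) ≡ zero
  quotient-↑ˡ n m j = ≡.cong proj₁ (FinP.remQuot-combine {suc n} {m} zero j)

  quotient-↑ʳ : ∀ n m (i : Fin (n ℕ.* m)) → quotient {suc n} m (m ↑ʳ i) ≡ suc (quotient {n} m i)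
  quotient-↑ʳ n m i = ≡.trans
    (≡.cong (λ i → quotient {suc n} m (m ↑ʳ i)) (≡.sym (FinP.combine-remQuot {n} m i)))
    (≡.cong proj₁ (FinP.remQuot-combine {suc n} {m} (suc (quotient {n} m i)) (remainder {n} m i)))

  sumFin-quotient : ∀ n m (f : Fin n → R) → sumFin {n ℕ.* m} (f ∘ quotient {n} m) ≈ fromℕ m * sumFin f
  sumFin-quotient zero    m f = ≈-sym (zeroʳ (fromℕ m))
  sumFin-quotient (suc n) m f = ≈-trans (sumFin-split m (n ℕ.* m) (f ∘ quotient {suc n} m))
    (≈-trans (+-cong
        (≈-trans (sumFin-cong {m} (λ j → ≡⇒≈ (≡.cong f (quotient-↑ˡ n m j)))) (sumFin-const m (f zero)))
        (≈-trans (sumFin-cong {n ℕ.* m} (λ i → ≡⇒≈ (≡.cong f (quotient-↑ʳ n m i)))) (sumFin-quotient n m (f ∘ suc))))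
      (≈-sym (distribˡ (fromℕ m) (f zero) (sumFin (f ∘ suc)))))

  multiSum : ∀ d {n} → (Vec (Fin n) d → R) → R
  multiSum zero    g = g []
  multiSum (suc d) g = sumFin (λ i → multiSum d (λ is → g (i ∷ is)))

  multiSum-cong : ∀ d {n} {f g : Vec (Fin n) d → R} → (∀ is → f is ≈ g is) → multiSum d f ≈ multiSum d g
  multiSum-cong zero    h = h []
  multiSum-cong (suc d) h = sumFin-cong (λ i → multiSum-cong d (λ is → h (i ∷ is)))

  multiSum-mono : ∀ d {n} {f g : Vec (Fin n) d → R} → (∀ is → f is ≤ g is) → multiSum d f ≤ multiSum d g
  multiSum-mono zero    h = h []
  multiSum-mono (suc d) h = sumFin-mono (λ i → multiSum-mono d (λ is → h (i ∷ is)))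

  multiSum-+const : ∀ d {n} (f : Vec (Fin n) d → R) e →
    multiSum d (λ is → f is + e) ≈ multiSum d f + power (fromℕ n) d * e
  multiSum-+const zero    f e = +-cong ≈-refl (≈-sym (*-identityˡ e))
  multiSum-+const (suc d) {n} f e = ≈-trans
    (sumFin-cong (λ i → multiSum-+const d (λ is → f (i ∷ is)) e))
    (≈-trans (sumFin-+ (λ i → multiSum d (λ is → f (i ∷ is))) (λ _ → power (fromℕ n) d * e))
      (+-cong ≈-refl (≈-trans (sumFin-const n (power (fromℕ n) d * e)) (≈-sym (*-assoc (fromℕ n) (power (fromℕ n) d) e)))))

  multiSum-quotient : ∀ d n m (f : Vec (Fin n) d → R) →
    multiSum d {n ℕ.* m} (λ is → f (Vec.map (quotient {n} m) is)) ≈ power (fromℕ m) d * multiSum d f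
  multiSum-quotient zero    n m f = ≈-sym (*-identityˡ (f []))
  multiSum-quotient (suc d) n m f = ≈-trans
    (sumFin-cong (λ i → multiSum-quotient d n m (λ is → f (quotient {n} m i ∷ is))))
    (≈-trans (sumFin-quotient n m (λ i → power (fromℕ m) d * multiSum d (λ is → f (i ∷ is))))
    (≈-trans (*-cong ≈-refl (sumFin-scale (power (fromℕ m) d) (λ i → multiSum d (λ is → f (i ∷ is)))))
      (≈-sym (*-assoc (fromℕ m) (power (fromℕ m) d) (multiSum (suc d) f)))))

  power-* : ∀ x y n → power (x * y) n ≈ power x n * power y n
  power-* x y zero    = ≈-sym (*-identityˡ 1#)
  power-* x y (suc n) = ≈-trans (*-cong ≈-refl (power-* x y n))
    (solve 4 (λ x y p q → (x :* y) :* (p :* q) := (x :* p) :* (y :* q)) ≈-refl x y (power x n) (power y n))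

  power-cong : ∀ {x y} n → x ≈ y → power x n ≈ power y n
  power-cong zero    h = ≈-refl
  power-cong (suc n) h = *-cong h (power-cong n h)

  power-1 : ∀ n → power 1# n ≈ 1#
  power-1 zero    = ≈-refl
  power-1 (suc n) = ≈-trans (*-identityˡ (power 1# n)) (power-1 n)

  power-inverse : ∀ {x y} n → x * y ≈ 1# → power x n * power y n ≈ 1#
  power-inverse {x} {y} n h = ≈-trans (≈-sym (power-* x y n)) (≈-trans (power-cong n h) (power-1 n))

  unitFraction : (n : ℕ) → .{{_ : ℕ.NonZero n}} → R
  unitFraction n = fromℚ (+ 1 ℚ./ n)

  fraction : ∀ i n .{{_ : ℕ.NonZero n}} → fromℚ (+ i ℚ./ n) ≈ fromℕ i * unitFraction n
  fraction i (suc n) = ≈-trans (≡⇒≈ (≡.cong fromℚ (≡.sym (≡.trans (CauchyLemmas.frac-* {i} {0} {1} {n})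
    (ℚP./-cong (≡.cong +_ (ℕP.*-identityʳ i)) (ℕP.*-identityˡ (suc n)))))))
    (fromℚ-* (+ i ℚ./ 1) (+ 1 ℚ./ suc n))

  n*1/n : ∀ n .{{_ : ℕ.NonZero n}} → fromℕ n * unitFraction n ≈ 1#
  n*1/n (suc n) = ≈-trans (≈-sym (fromℚ-* (+ suc n ℚ./ 1) (+ 1 ℚ./ suc n))) (≡⇒≈ (≡.cong fromℚ (RationalLemmas.suc*1/suc n)))

  0≤unitFraction : ∀ n .{{_ : ℕ.NonZero n}} → 0# ≤ unitFraction n
  0≤unitFraction n = fromℚ-mono (CauchyLemmas.0≤frac 1 n)

  unitFraction-* : ∀ n m .{{_ : ℕ.NonZero n}} .{{_ : ℕ.NonZero m}} .{{_ : ℕ.NonZero (n ℕ.* m)}} →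
    fromℕ m * unitFraction (n ℕ.* m) ≈ unitFraction n
  unitFraction-* n m = ≈-trans
    (≈-trans (solve 2 (λ m u → m :* u := con 1ℚ :* (m :* u)) ≈-refl (fromℕ m) (unitFraction (n ℕ.* m)))
      (*-cong (≈-sym (n*1/n n)) ≈-refl))
    (≈-trans (solve 4 (λ n v m u → (n :* v) :* (m :* u) := v :* ((n :* m) :* u)) ≈-refl
        (fromℕ n) (unitFraction n) (fromℕ m) (unitFraction (n ℕ.* m)))
      (≈-trans (*-cong ≈-refl (≈-trans (*-cong (≈-sym (fromℕ-* n m)) ≈-refl) (n*1/n (n ℕ.* m))))
        (*-identityʳ (unitFraction n))))

  InCube : ∀ {d} → R → Vec R d → Set
  InCube T = All (λ s → 0# ≤ s × s ≤ T)

  dilate : ℚ → R → R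
  dilate q T = fromℚ q * T

  InCell : R → (n : ℕ) → .{{_ : ℕ.NonZero n}} → Fin n → R → Set
  InCell T n i s = dilate (+ toℕ i ℚ./ n) T ≤ s × s ≤ dilate (+ suc (toℕ i) ℚ./ n) T

  riemannSum : ∀ {d} → R → (Vec R d → R) → (n : ℕ) → .{{_ : ℕ.NonZero n}} → (Vec (Fin n) d → Vec R d) → R
  riemannSum {d} T g n tag = power (dilate (+ 1 ℚ./ n) T) d * multiSum d (λ is → g (tag is))

  IsIntegral : ∀ {d} → R → (Vec R d → R) → R → Set
  IsIntegral {d} T g I = ∀ ε → 0ℚ ℚ.< ε →
    ∃[ N ] (∀ n → .{{_ : ℕ.NonZero n}} → N ℕ.≤ n →
      ∀ (tag : Vec (Fin n) d → Vec R d) → (∀ is → Pointwise (InCell T n) is (tag is)) →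
        Near (fromℚ ε) (riemannSum T g n tag) I)

  near-sym : ∀ {e x y} → Near e x y → Near e y x
  near-sym (p , q) = q , p

  near-trans : ∀ {e e′ x y z} → Near e x y → Near e′ y z → Near (e + e′) x z
  near-trans {e} {e′} {x} {y} {z} (p , p′) (q , q′) =
      ≤-trans p (≤-trans (+-mono-≤ q ≤-refl) (proj₁ (solve 3 (λ z e f → (z :+ f) :+ e := z :+ (e :+ f)) ≈-refl z e e′)))
    , ≤-trans q′ (≤-trans (+-mono-≤ p′ ≤-refl) (proj₁ (+-assoc x e e′)))

  near-weaken : ∀ {e e′ x y} → e ≤ e′ → Near e x y → Near e′ x y
  near-weaken h (p , q) = ≤-trans p (+-mono-≤ ≤-refl h) , ≤-trans q (+-mono-≤ ≤-refl h)

  near-cong : ∀ {e x x′ y y′} → x ≈ x′ → y ≈ y′ → Near e x y → Near e x′ y′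
  near-cong (a , b) (c , d) (p , q) = ≤-trans b (≤-trans p (+-mono-≤ c ≤-refl)) , ≤-trans d (≤-trans q (+-mono-≤ a ≤-refl))

  ≈⇒near : ∀ {e x y} → 0# ≤ e → x ≈ y → Near e x y
  ≈⇒near {e} {x} {y} 0≤e (p , q) = ≤-trans p (≤-by e 0≤e ≈-refl) , ≤-trans q (≤-by e 0≤e ≈-refl)

  -- Phrased as small oscillation on the cells of every fine division: this involves no metric on
  -- vectors and is precisely what the comparison of Riemann sums consumes.
  UniformlyContinuous : ∀ {d} → R → (Vec R d → R) → Set
  UniformlyContinuous {d} T g = ∀ ε → 0ℚ ℚ.< ε →
    ∃[ N ] (∀ n → .{{_ : ℕ.NonZero n}} → N ℕ.≤ n → ∀ (is : Vec (Fin n) d) {s t} →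
      Pointwise (InCell T n) is s → Pointwise (InCell T n) is t → Near (fromℚ ε) (g s) (g t))

  module _ (T : R) (0≤T : 0# ≤ T) where

    cell-refines : ∀ n m .{{_ : ℕ.NonZero n}} .{{_ : ℕ.NonZero m}} .{{_ : ℕ.NonZero (n ℕ.* m)}}
      (i : Fin (n ℕ.* m)) {s} → InCell T (n ℕ.* m) i s → InCell T n (quotient {n} m i) s
    cell-refines n m i (lo , hi) =
        ≤-trans (*-monoʳ 0≤T (fromℚ-mono (frac-≤ {q} {n} {toℕ i} {n ℕ.* m} lower))) lo
      , ≤-trans hi (*-monoʳ 0≤T (fromℚ-mono (frac-≤ {suc (toℕ i)} {n ℕ.* m} {suc q} {n} upper)))
      where
      q = toℕ (quotient {n} m i)
      r = toℕ (remainder {n} m i)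
      i≡ : toℕ i ≡ m ℕ.* q ℕ.+ r
      i≡ = ≡.trans (≡.cong toℕ (≡.sym (FinP.combine-remQuot {n} m i)))
        (FinP.toℕ-combine (quotient {n} m i) (remainder {n} m i))
      lower : q ℕ.* (n ℕ.* m) ℕ.≤ toℕ i ℕ.* n
      lower = ℕP.≤-trans (ℕP.≤-reflexive (≡.trans (≡.cong (q ℕ.*_) (ℕP.*-comm n m)) (≡.trans (≡.sym (ℕP.*-assoc q m n))
          (≡.cong (ℕ._* n) (ℕP.*-comm q m)))))
        (ℕP.*-monoˡ-≤ n (ℕP.≤-trans (ℕP.m≤m+n (m ℕ.* q) r) (ℕP.≤-reflexive (≡.sym i≡))))
      i< : suc (toℕ i) ℕ.≤ suc q ℕ.* m
      i< = ℕP.≤-trans (ℕP.≤-reflexive (≡.cong suc i≡))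
        (ℕP.≤-trans (ℕP.≤-reflexive (≡.trans (≡.sym (ℕP.+-suc (m ℕ.* q) r)) (ℕP.+-comm (m ℕ.* q) (suc r))))
          (ℕP.+-mono-≤ (FinP.toℕ<n (remainder {n} m i)) (ℕP.≤-reflexive (ℕP.*-comm m q))))
      upper : suc (toℕ i) ℕ.* n ℕ.≤ suc q ℕ.* (n ℕ.* m)
      upper = ℕP.≤-trans (ℕP.*-monoˡ-≤ n i<)
        (ℕP.≤-reflexive (≡.trans (ℕP.*-assoc (suc q) m n) (≡.cong (suc q ℕ.*_) (ℕP.*-comm m n))))

    cells-refine : ∀ {d} n m .{{_ : ℕ.NonZero n}} .{{_ : ℕ.NonZero m}} .{{_ : ℕ.NonZero (n ℕ.* m)}}
      {is : Vec (Fin (n ℕ.* m)) d} {s : Vec R d} → Pointwise (InCell T (n ℕ.* m)) is s →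
      Pointwise (InCell T n) (Vec.map (quotient {n} m) is) s
    cells-refine n m []                   = []
    cells-refine n m (_∷_ {x = i} p ps) = cell-refines n m i p ∷ cells-refine n m ps

    leftTag : ∀ {d} n .{{_ : ℕ.NonZero n}} → Vec (Fin n) d → Vec R d
    leftTag n = Vec.map (λ i → fromℚ (+ toℕ i ℚ./ n) * T)

    leftTag-inCell : ∀ {d} n .{{_ : ℕ.NonZero n}} (is : Vec (Fin n) d) → Pointwise (InCell T n) is (leftTag n is)
    leftTag-inCell n []       = []
    leftTag-inCell n (i ∷ is) = (≤-refl , *-monoʳ 0≤T (fromℚ-mono (frac-≤ {toℕ i} {n} {suc (toℕ i)} {n}
      (ℕP.*-monoˡ-≤ n (ℕP.n≤1+n (toℕ i)))))) ∷ leftTag-inCell n is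

    -- The coarse sum is rewritten over the fine cells, each using the tag of the coarse cell around
    -- it. Each of the (n m)ᵈ fine cells then contributes an error e times its volume, in total Tᵈ
    -- e.
    riemannSum-refine : ∀ {d} (g : Vec R d → R) n m .{{_ : ℕ.NonZero n}} .{{_ : ℕ.NonZero m}} .{{_ : ℕ.NonZero (n ℕ.* m)}} e →
      (∀ (is : Vec (Fin n) d) {s t} → Pointwise (InCell T n) is s → Pointwise (InCell T n) is t → Near e (g s) (g t)) →
      ∀ tag tag′ → (∀ is → Pointwise (InCell T n) is (tag is)) → (∀ is → Pointwise (InCell T (n ℕ.* m)) is (tag′ is)) →
      Near (power T d * e) (riemannSum T g n tag) (riemannSum T g (n ℕ.* m) tag′)
    riemannSum-refine {d} g n m e osc tag tag′ tag∈ tag′∈ =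
        (begin
          riemannSum T g n tag
            ≈⟨ coarse ⟩
          V * multiSum d g∘q
            ≤⟨ *-monoˡ 0≤V (≤-trans (multiSum-mono d (λ is → proj₁ (compare is))) (proj₁ (multiSum-+const d (g ∘ tag′) e))) ⟩
          V * (multiSum d (g ∘ tag′) + power (fromℕ (n ℕ.* m)) d * e)
            ≈⟨ error (multiSum d (g ∘ tag′)) ⟩
          riemannSum T g (n ℕ.* m) tag′ + power T d * e
        ∎)
      , (begin
          V * multiSum d (g ∘ tag′)
            ≤⟨ *-monoˡ 0≤V (≤-trans (multiSum-mono d (λ is → proj₂ (compare is))) (proj₁ (multiSum-+const d g∘q e))) ⟩
          V * (multiSum d g∘q + power (fromℕ (n ℕ.* m)) d * e)
            ≈⟨ error (multiSum d g∘q) ⟩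
          V * multiSum d g∘q + power T d * e
            ≈⟨ +-cong (≈-sym coarse) ≈-refl ⟩
          riemannSum T g n tag + power T d * e
        ∎)
      where
      g∘q : Vec (Fin (n ℕ.* m)) d → R
      g∘q is = g (tag (Vec.map (quotient {n} m) is))
      compare : ∀ is → Near e (g∘q is) (g (tag′ is))
      compare is = osc (Vec.map (quotient {n} m) is) (tag∈ (Vec.map (quotient {n} m) is)) (cells-refine n m (tag′∈ is))
      h = unitFraction (n ℕ.* m)
      V = power (h * T) d
      0≤V : 0# ≤ V
      0≤V = 0≤power (0≤* (0≤unitFraction (n ℕ.* m)) 0≤T) d
      coarse : riemannSum T g n tag ≈ V * multiSum d g∘q
      coarse = ≈-trans (*-cong (≈-trans (power-cong d (≈-trans (*-cong (≈-sym (unitFraction-* n m)) ≈-refl)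
            (solve 3 (λ m h T → (m :* h) :* T := (h :* T) :* m) ≈-refl (fromℕ m) h T)))
          (power-* (h * T) (fromℕ m) d)) ≈-refl)
        (≈-trans (*-assoc V (power (fromℕ m) d) (multiSum d (g ∘ tag)))
          (*-cong ≈-refl (≈-sym (multiSum-quotient d n m (g ∘ tag)))))
      error : ∀ S → V * (S + power (fromℕ (n ℕ.* m)) d * e) ≈ V * S + power T d * e
      error S = ≈-trans (solve 4 (λ V S p e → V :* (S :+ p :* e) := V :* S :+ (V :* p) :* e) ≈-refl V S (power (fromℕ (n ℕ.* m)) d) e)
        (+-cong ≈-refl (*-cong (≈-trans (≈-sym (power-* (h * T) (fromℕ (n ℕ.* m)) d))
          (power-cong d (≈-trans (solve 3 (λ h T n → (h :* T) :* n := (n :* h) :* T) ≈-refl h T (fromℕ (n ℕ.* m)))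
            (≈-trans (*-cong (n*1/n (n ℕ.* m)) ≈-refl) (*-identityˡ T))))) ≈-refl))

    -- Both sums are compared with the left-tagged sum of the common refinement into n m parts per
    -- side.
    riemannSum-compare : ∀ {d} (g : Vec R d → R) e N →
      (∀ n → .{{_ : ℕ.NonZero n}} → N ℕ.≤ n → ∀ (is : Vec (Fin n) d) {s t} →
        Pointwise (InCell T n) is s → Pointwise (InCell T n) is t → Near e (g s) (g t)) →
      ∀ n m .{{_ : ℕ.NonZero n}} .{{_ : ℕ.NonZero m}} → N ℕ.≤ n → N ℕ.≤ m →
      ∀ tag tag′ → (∀ is → Pointwise (InCell T n) is (tag is)) → (∀ is → Pointwise (InCell T m) is (tag′ is)) →
      Near (power T d * e + power T d * e) (riemannSum T g n tag) (riemannSum T g m tag′)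
    riemannSum-compare {d} g e N osc n m N≤n N≤m tag tag′ tag∈ tag′∈ = near-trans
      (riemannSum-refine g n m e (osc n N≤n) tag (leftTag (n ℕ.* m)) tag∈ (leftTag-inCell (n ℕ.* m)))
      (near-sym (≡.subst (Near (power T d * e) (riemannSum T g m tag′)) (reindex (m ℕ.* n) (n ℕ.* m) (ℕP.*-comm m n))
        (riemannSum-refine g m n e (osc m N≤m) tag′ (leftTag (m ℕ.* n)) tag′∈ (leftTag-inCell (m ℕ.* n)))))
      where
      instance
        nm≢0 : ℕ.NonZero (n ℕ.* m)
        nm≢0 = ℕP.m*n≢0 n m
        mn≢0 : ℕ.NonZero (m ℕ.* n)
        mn≢0 = ℕP.m*n≢0 m n
      reindex : ∀ L L′ .{{_ : ℕ.NonZero L}} .{{_ : ℕ.NonZero L′}} → L ≡ L′ →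
        riemannSum T g L (leftTag L) ≡ riemannSum T g L′ (leftTag L′)
      reindex L .L ≡.refl = ≡.refl

    -- The left-tagged sums form a Cauchy sequence whose limit exists by completeness; arbitrary
    -- tags are handled by the same comparison.
    uniformlyContinuous⇒integrable : ∀ {d} (g : Vec R d → R) → UniformlyContinuous T g → Σ[ I ∈ R ] IsIntegral T g I
    uniformlyContinuous⇒integrable {d} g uc = I , integral
      where
      s : ℕ → R
      s m = riemannSum T g (suc m) (leftTag (suc m))

      compare : ∀ ε → 0ℚ ℚ.< ε → ∃[ N ] (∀ n m .{{_ : ℕ.NonZero n}} .{{_ : ℕ.NonZero m}} → N ℕ.≤ n → N ℕ.≤ m →
        ∀ tag tag′ → (∀ is → Pointwise (InCell T n) is (tag is)) → (∀ is → Pointwise (InCell T m) is (tag′ is)) →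
        Near (fromℚ ε) (riemannSum T g n tag) (riemannSum T g m tag′))
      compare ε 0<ε =
        let (B , 0<B , Tᵈ≤B , _) = bounded (power T d)
            (e , 0<e , _ , small) = scale-down (B ℚ.+ B) ε (ℚP.+-mono-< {0ℚ} {B} {0ℚ} {B} 0<B 0<B) 0<ε
            (N , osc) = uc e 0<e
        in N , λ n m N≤n N≤m tag tag′ tag∈ tag′∈ →
          near-weaken {x = riemannSum T g n tag} {y = riemannSum T g m tag′} (error B e ε (ℚP.<⇒≤ 0<e) Tᵈ≤B small)
            (riemannSum-compare g (fromℚ e) N osc n m N≤n N≤m tag tag′ tag∈ tag′∈)
        where
        error : ∀ B e ε → 0ℚ ℚ.≤ e → power T d ≤ fromℚ B → (B ℚ.+ B) ℚ.* e ℚ.≤ ε →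
          power T d * fromℚ e + power T d * fromℚ e ≤ fromℚ ε
        error B e ε 0≤e Tᵈ≤B small = ≤-trans (+-mono-≤ (*-monoʳ (fromℚ-mono 0≤e) Tᵈ≤B) (*-monoʳ (fromℚ-mono 0≤e) Tᵈ≤B))
          (≤-trans (proj₂ (distribʳ (fromℚ e) (fromℚ B) (fromℚ B)))
          (≤-trans (*-monoʳ (fromℚ-mono 0≤e) (proj₂ (fromℚ-+ B B)))
          (≤-trans (proj₂ (fromℚ-* (B ℚ.+ B) e)) (fromℚ-mono small))))

      to-s : ∀ ε → 0ℚ ℚ.< ε → ∃[ N ] (∀ n m .{{_ : ℕ.NonZero n}} → N ℕ.≤ n → N ℕ.≤ m →
        ∀ tag → (∀ is → Pointwise (InCell T n) is (tag is)) → Near (fromℚ ε) (riemannSum T g n tag) (s m))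
      to-s ε 0<ε = let (N , h) = compare ε 0<ε in N , λ n m N≤n N≤m tag tag∈ →
        h n (suc m) N≤n (ℕP.m≤n⇒m≤1+n N≤m) tag (leftTag (suc m)) tag∈ (leftTag-inCell (suc m))

      s-cauchy : ∀ ε → 0ℚ ℚ.< ε → ∃[ N ] (∀ m n → N ℕ.≤ m → N ℕ.≤ n → s m ≤ s n + fromℚ ε)
      s-cauchy ε 0<ε = let (N , h) = to-s ε 0<ε in N , λ m n N≤m N≤n →
        proj₁ (h (suc m) n (ℕP.m≤n⇒m≤1+n N≤m) N≤n (leftTag (suc m)) (leftTag-inCell (suc m)))

      limit : Σ[ L ∈ R ] (∀ ε → 0ℚ ℚ.< ε → ∃[ N ] (∀ n → N ℕ.≤ n → Near (fromℚ ε) (s n) L))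
      limit = complete s s-cauchy

      I : R
      I = proj₁ limit

      integral : IsIntegral T g I
      integral ε 0<ε =
        let (N , h) = to-s (½ ℚ.* ε) (0<* 0<½ 0<ε)
            (M , k) = proj₂ limit (½ ℚ.* ε) (0<* 0<½ 0<ε)
        in N , λ n N≤n tag tag∈ → near-weaken {x = riemannSum T g n tag} {y = I} halves
          (near-trans {x = riemannSum T g n tag} {y = s (N ℕ.⊔ M)} {z = I}
            (h n (N ℕ.⊔ M) N≤n (ℕP.m≤m⊔n N M) tag tag∈) (k (N ℕ.⊔ M) (ℕP.m≤n⊔m N M)))
        where
        halves : fromℚ (½ ℚ.* ε) + fromℚ (½ ℚ.* ε) ≤ fromℚ ε
        halves = proj₁ (≈-trans (≈-sym (fromℚ-+ (½ ℚ.* ε) (½ ℚ.* ε))) (≡⇒≈ (≡.cong fromℚ (half+half ε))))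

-- Bounded uniformly continuous functions on the cube

module RegularFunctions (𝓡 : RealStructure) where
  open RealAlgebra 𝓡
  open ComplexAlgebra 𝓡
  open ExponentialSums 𝓡
  open Integration 𝓡
  open Solver using (solve; _:=_; _:+_; _:*_; _:-_; :-_; con)
  open CauchyLemmas using (0<*; 0<½; 0≤½; frac-≤; half+half)
  open RationalLemmas using (scale-down)

  Within : R → R → Set
  Within K x = x ≤ K × - x ≤ K

  -- 2 (K e - x d) = (K - x) (e + d) + (K + x) (e - d)
  *-within : ∀ {K x e d} → Within K x → Within e d → x * d ≤ K * e
  *-within {K} {x} {e} {d} (x≤ , -x≤) (d≤ , -d≤) = ≤-by
    (fromℚ ½ * ((K - x) * (e - - d) + (K - - x) * (e - d)))
    (0≤* (fromℚ-mono 0≤½) (0≤+ (0≤* (0≤diff x≤) (0≤diff -d≤)) (0≤* (0≤diff -x≤) (0≤diff d≤))))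
    (solve 4 (λ K x e d → x :* d :+ con ½ :* ((K :- x) :* (e :- :- d) :+ (K :- :- x) :* (e :- d)) := K :* e) ≈-refl K x e d)

  within-neg : ∀ {K x} → Within K x → Within K (- x)
  within-neg {K} {x} (p , q) = q , ≤-trans (proj₁ (solve 1 (λ x → :- :- x := x) ≈-refl x)) p

  near⇒within : ∀ {e x y} → Near e x y → Within e (x - y)
  near⇒within {e} {x} {y} (p , q) =
      ≤-shift p (solve 3 (λ e x y → (x :- y) :+ (y :+ e :- x) := e) ≈-refl e x y)
    , ≤-shift q (solve 3 (λ e x y → :- (x :- y) :+ (x :+ e :- y) := e) ≈-refl e x y)

  near-+ : ∀ {e e′ x y u v} → Near e x y → Near e′ u v → Near (e + e′) (x + u) (y + v)
  near-+ {e} {e′} {x} {y} {u} {v} (p , p′) (q , q′) =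
      ≤-trans (+-mono-≤ p q) (proj₁ (solve 4 (λ y e v f → (y :+ e) :+ (v :+ f) := (y :+ v) :+ (e :+ f)) ≈-refl y e v e′))
    , ≤-trans (+-mono-≤ p′ q′) (proj₁ (solve 4 (λ y e v f → (y :+ e) :+ (v :+ f) := (y :+ v) :+ (e :+ f)) ≈-refl x e u e′))

  near-neg : ∀ {e x y} → Near e x y → Near e (- x) (- y)
  near-neg {e} {x} {y} (p , q) =
      ≤-shift q (solve 3 (λ e x y → :- x :+ (x :+ e :- y) := :- y :+ e) ≈-refl e x y)
    , ≤-shift p (solve 3 (λ e x y → :- y :+ (y :+ e :- x) := :- x :+ e) ≈-refl e x y)

  -- The splitting x u - y v = x (u - v) + v (x - y) asks for bounds on one factor of each product
  -- only.
  near-* : ∀ {K L e x y u v} → Within K x → Within L v → Near e x y → Near e u v →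
    Near ((K + L) * e) (x * u) (y * v)
  near-* {K} {L} {e} {x} {y} {u} {v} x≤ v≤ p q =
      ≤-by ((K * e - x * (u - v)) + (L * e - v * (x - y)))
        (0≤+ (0≤diff (*-within x≤ (near⇒within q))) (0≤diff (*-within v≤ (near⇒within p))))
        (solve 7 (λ K L e x y u v → x :* u :+ ((K :* e :- x :* (u :- v)) :+ (L :* e :- v :* (x :- y)))
          := y :* v :+ (K :+ L) :* e) ≈-refl K L e x y u v)
    , ≤-by ((K * e - x * (v - u)) + (L * e - v * (y - x)))
        (0≤+ (0≤diff (*-within x≤ (near⇒within (near-sym {e} {u} {v} q)))) (0≤diff (*-within v≤ (near⇒within (near-sym {e} {x} {y} p)))))
        (solve 7 (λ K L e x y u v → y :* v :+ ((K :* e :- x :* (v :- u)) :+ (L :* e :- v :* (y :- x)))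
          := x :* u :+ (K :+ L) :* e) ≈-refl K L e x y u v)

  -- Equal arguments are within every δ, so the Lipschitz estimate makes the values agree up to
  -- every ε.
  cos-sin-cong : ∀ {x y} → x ≈ y → cos x ≈ cos y × sin x ≈ sin y
  cos-sin-cong {x} {y} x≈y =
    let (K , 0<K , x≤ , -x≤) = bounded x
        (B , 0<B , lip) = cos-sin-lipschitz K 0<K
        close : ∀ ε → 0ℚ ℚ.< ε → Near (fromℚ ε) (cos x) (cos y) × Near (fromℚ ε) (sin x) (sin y)
        close ε 0<ε =
          let (δ , 0<δ , _ , Bδ≤ε) = scale-down B ε 0<B 0<ε
              (c , s) = lip x≤ -x≤ (≤-trans (proj₂ x≈y) x≤) (≤-trans (proj₂ (-‿cong x≈y)) -x≤) δ 0<δ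
                          (≈⇒near (fromℚ-mono (ℚP.<⇒≤ 0<δ)) x≈y)
          in near-weaken {x = cos x} {y = cos y} (fromℚ-mono Bδ≤ε) c , near-weaken {x = sin x} {y = sin y} (fromℚ-mono Bδ≤ε) s
    in (≤-limit (λ ε 0<ε → proj₁ (proj₁ (close ε 0<ε))) , ≤-limit (λ ε 0<ε → proj₂ (proj₁ (close ε 0<ε))))
     , (≤-limit (λ ε 0<ε → proj₁ (proj₂ (close ε 0<ε))) , ≤-limit (λ ε 0<ε → proj₂ (proj₂ (close ε 0<ε))))

  cis : R → C
  cis θ = cos θ +i sin θ

  cis-cong : ∀ {x y} → x ≈ y → cis x ≈ᶜ cis y
  cis-cong = cos-sin-cong

  cis-+ : ∀ x y → cis (x + y) ≈ᶜ cis x *ᶜ cis y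
  cis-+ x y = cos-+ x y , sin-+ x y

  -- The slack is 1 - c = ½ ((c - 1)² + (1 - c²)).
  sq≤1⇒≤1 : ∀ {c} → c * c ≤ 1# → c ≤ 1#
  sq≤1⇒≤1 {c} h = ≤-stable λ c≰1 → c≰1 (≤-by
    (fromℚ ½ * ((c - 1#) * (c - 1#) + (1# - c * c)))
    (0≤* (fromℚ-mono 0≤½) (0≤+ (0≤sq (c - 1#)) (0≤diff h)))
    (solve 1 (λ c → c :+ con ½ :* ((c :- con 1ℚ) :* (c :- con 1ℚ) :+ (con 1ℚ :- c :* c)) := con 1ℚ) ≈-refl c))

  within-1 : ∀ {c s} → c * c + s * s ≈ 1# → Within 1# c
  within-1 {c} {s} h = sq≤1⇒≤1 c²≤1 , sq≤1⇒≤1 (≤-trans (proj₁ (solve 1 (λ c → (:- c) :* (:- c) := c :* c) ≈-refl c)) c²≤1)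
    where
    c²≤1 : c * c ≤ 1#
    c²≤1 = ≤-trans (≤-by (s * s) (0≤sq s) ≈-refl) (proj₁ h)

  BoundedOn : ∀ {d} → R → (Vec R d → R) → Set
  BoundedOn T g = Σ[ K ∈ ℚ ] 0ℚ ℚ.< K × (∀ t → InCube T t → Within (fromℚ K) (g t))

  -- Boundedness travels along because products, and cos and sin through their local Lipschitz
  -- constants, need it to preserve uniform continuity.
  Regular : ∀ {d} → R → (Vec R d → R) → Set
  Regular T g = BoundedOn T g × UniformlyContinuous T g

  module _ (T : R) (0≤T : 0# ≤ T) where

    cells⊆cube : ∀ {d} n .{{_ : ℕ.NonZero n}} {is : Vec (Fin n) d} {s : Vec R d} →
      Pointwise (InCell T n) is s → InCube T s
    cells⊆cube n [] = []
    cells⊆cube n (_∷_ {x = i} (lo , hi) ps) =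
        ( ≤-trans (0≤* (fromℚ-mono (CauchyLemmas.0≤frac (toℕ i) n)) 0≤T) lo
        , ≤-trans hi (≤-trans (*-monoʳ 0≤T (fromℚ-mono (frac-≤ {suc (toℕ i)} {n} {1} {1}
            (ℕP.≤-trans (ℕP.≤-reflexive (ℕP.*-identityʳ (suc (toℕ i)))) (ℕP.≤-trans (FinP.toℕ<n i) (ℕP.≤-reflexive (≡.sym (ℕP.*-identityˡ n))))))))
            (proj₁ (*-identityˡ T))))
      ∷ cells⊆cube n ps

    regular-cong : ∀ {d} {g g′ : Vec R d → R} → (∀ t → g t ≈ g′ t) → Regular T g → Regular T g′
    regular-cong {g = g} {g′} h ((K , 0<K , b) , uc) =
        (K , 0<K , λ t t∈ → ≤-trans (proj₂ (h t)) (proj₁ (b t t∈)) , ≤-trans (proj₂ (-‿cong (h t))) (proj₂ (b t t∈)))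
      , (λ ε 0<ε → let (N , u) = uc ε 0<ε in N , λ n N≤n is {s} {t} s∈ t∈ → near-cong (h s) (h t) (u n N≤n is s∈ t∈))

    regular-const : ∀ {d} c → Regular {d} T (λ _ → c)
    regular-const c =
        (let (K , 0<K , c≤ , -c≤) = bounded c in K , 0<K , λ _ _ → c≤ , -c≤)
      , (λ ε 0<ε → 0 , λ n _ is _ _ → ≈⇒near (fromℚ-mono (ℚP.<⇒≤ 0<ε)) ≈-refl)

    regular-neg : ∀ {d} {g : Vec R d → R} → Regular T g → Regular T (λ t → - g t)
    regular-neg ((K , 0<K , b) , uc) =
        (K , 0<K , λ t t∈ → within-neg (b t t∈))
      , (λ ε 0<ε → let (N , u) = uc ε 0<ε in N , λ n N≤n is s∈ t∈ → near-neg (u n N≤n is s∈ t∈))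

    regular-+ : ∀ {d} {f g : Vec R d → R} → Regular T f → Regular T g → Regular T (λ t → f t + g t)
    regular-+ {f = f} {g} ((K , 0<K , b) , uc) ((L , 0<L , b′) , uc′) =
        (K ℚ.+ L , ℚP.+-mono-< {0ℚ} {K} {0ℚ} {L} 0<K 0<L , λ t t∈ →
            ≤-trans (+-mono-≤ (proj₁ (b t t∈)) (proj₁ (b′ t t∈))) (proj₂ (fromℚ-+ K L))
          , ≤-trans (proj₁ (solve 2 (λ x y → :- (x :+ y) := :- x :+ :- y) ≈-refl (f t) (g t)))
              (≤-trans (+-mono-≤ (proj₂ (b t t∈)) (proj₂ (b′ t t∈))) (proj₂ (fromℚ-+ K L))))
      , (λ ε 0<ε →
          let 0<½ε = 0<* 0<½ 0<ε
              (N , u) = uc (½ ℚ.* ε) 0<½ε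
              (M , w) = uc′ (½ ℚ.* ε) 0<½ε
          in N ℕ.⊔ M , λ n le is {s} {t} s∈ t∈ → near-weaken {x = f s + g s} {y = f t + g t}
            (≤-trans (proj₂ (fromℚ-+ (½ ℚ.* ε) (½ ℚ.* ε))) (proj₁ (≡⇒≈ (≡.cong fromℚ (half+half ε)))))
            (near-+ (u n (ℕP.≤-trans (ℕP.m≤m⊔n N M) le) is s∈ t∈) (w n (ℕP.≤-trans (ℕP.m≤n⊔m N M) le) is s∈ t∈)))

    regular-* : ∀ {d} {f g : Vec R d → R} → Regular T f → Regular T g → Regular T (λ t → f t * g t)
    regular-* {f = f} {g} ((K , 0<K , b) , uc) ((L , 0<L , b′) , uc′) =
        (K ℚ.* L , 0<* 0<K 0<L , λ t t∈ →
            ≤-trans (*-within (b t t∈) (b′ t t∈)) (proj₂ (fromℚ-* K L))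
          , ≤-trans (proj₁ (solve 2 (λ x y → :- (x :* y) := (:- x) :* y) ≈-refl (f t) (g t)))
              (≤-trans (*-within (within-neg (b t t∈)) (b′ t t∈)) (proj₂ (fromℚ-* K L))))
      , (λ ε 0<ε →
          let (e , 0<e , _ , small) = scale-down (K ℚ.+ L) ε (ℚP.+-mono-< {0ℚ} {K} {0ℚ} {L} 0<K 0<L) 0<ε
              (N , u) = uc e 0<e
              (M , w) = uc′ e 0<e
          in N ℕ.⊔ M , λ n le is {s} {t} s∈ t∈ → near-weaken {x = f s * g s} {y = f t * g t}
            (≤-trans (*-monoʳ (fromℚ-mono (ℚP.<⇒≤ 0<e)) (proj₂ (fromℚ-+ K L)))
              (≤-trans (proj₂ (fromℚ-* (K ℚ.+ L) e)) (fromℚ-mono small)))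
            (near-* {fromℚ K} {fromℚ L} (b s (cells⊆cube n s∈)) (b′ t (cells⊆cube n t∈))
              (u n (ℕP.≤-trans (ℕP.m≤m⊔n N M) le) is s∈ t∈) (w n (ℕP.≤-trans (ℕP.m≤n⊔m N M) le) is s∈ t∈)))

    regular-cos-sin : ∀ {d} {g : Vec R d → R} → Regular T g → Regular T (cos ∘ g) × Regular T (sin ∘ g)
    regular-cos-sin {g = g} ((K , 0<K , b) , uc) =
        ((1ℚ , CauchyLemmas.0<1 , λ t _ → within-1 (cos²+sin² (g t)))
        , (λ ε 0<ε → let (N , u) = uniform ε 0<ε in N , λ n le is s∈ t∈ → proj₁ (u n le is s∈ t∈)))
      , ((1ℚ , CauchyLemmas.0<1 , λ t _ → within-1 (≈-trans (+-comm (sin (g t) * sin (g t)) (cos (g t) * cos (g t))) (cos²+sin² (g t))))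
        , (λ ε 0<ε → let (N , u) = uniform ε 0<ε in N , λ n le is s∈ t∈ → proj₂ (u n le is s∈ t∈)))
      where
      uniform : ∀ ε → 0ℚ ℚ.< ε → ∃[ N ] (∀ n → .{{_ : ℕ.NonZero n}} → N ℕ.≤ n → ∀ (is : Vec (Fin n) _) {s t} →
        Pointwise (InCell T n) is s → Pointwise (InCell T n) is t →
        Near (fromℚ ε) (cos (g s)) (cos (g t)) × Near (fromℚ ε) (sin (g s)) (sin (g t)))
      uniform ε 0<ε =
        let (B , 0<B , lip) = cos-sin-lipschitz K 0<K
            (δ , 0<δ , _ , Bδ≤ε) = scale-down B ε 0<B 0<ε
            (N , u) = uc δ 0<δ
        in N , λ n le is {s} {t} s∈ t∈ →
          let (p , p′) = b s (cells⊆cube n s∈)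
              (q , q′) = b t (cells⊆cube n t∈)
              (c , s′) = lip p p′ q q′ δ 0<δ (u n le is s∈ t∈)
          in near-weaken {x = cos (g s)} {y = cos (g t)} (fromℚ-mono Bδ≤ε) c
           , near-weaken {x = sin (g s)} {y = sin (g t)} (fromℚ-mono Bδ≤ε) s′

    regular-head : ∀ {d} → Regular {suc d} T head
    regular-head {d} =
        (let (K , 0<K , T≤ , _) = bounded T in K , 0<K , λ { (s ∷ _) ((0≤s , s≤T) ∷ _) →
            ≤-trans s≤T T≤ , ≤-trans (neg-mono 0≤s) (≤-trans (proj₁ (solve 0 (:- con 0ℚ := con 0ℚ) ≈-refl)) (fromℚ-mono (ℚP.<⇒≤ 0<K))) })
      , uniform
      where
      uniform : UniformlyContinuous {suc d} T head
      uniform ε 0<ε =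
        let (K , 0<K , T≤ , _) = bounded T
            (J , h) = CauchyLemmas.archimedean-1/suc K 0<ε
        in suc J , λ { (suc n) (ℕ.s≤s J≤n) (i ∷ _) (_∷_ {y = s} (lo , hi) _) (_∷_ {y = t} (lo′ , hi′) _) →
            let width : unitFraction (suc n) * T ≤ fromℚ ε
                width = ≤-trans (*-monoˡ (0≤unitFraction (suc n)) T≤)
                  (≤-trans (proj₂ (fromℚ-* (1/suc n) K)) (fromℚ-mono (ℚP.≤-trans (ℚP.≤-reflexive (ℚP.*-comm (1/suc n) K)) (h n J≤n))))
            in close (suc n) i s t width lo hi lo′ hi′ , close (suc n) i t s width lo′ hi′ lo hi }
        where
        close : ∀ n .{{_ : ℕ.NonZero n}} (i : Fin n) s t → unitFraction n * T ≤ fromℚ ε →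
          fromℚ (+ toℕ i ℚ./ n) * T ≤ s → s ≤ fromℚ (+ suc (toℕ i) ℚ./ n) * T →
          fromℚ (+ toℕ i ℚ./ n) * T ≤ t → t ≤ fromℚ (+ suc (toℕ i) ℚ./ n) * T → s ≤ t + fromℚ ε
        close n i s t width _ hi lo′ _ = begin
          s                                            ≤⟨ hi ⟩
          fromℚ (+ suc (toℕ i) ℚ./ n) * T              ≈⟨ *-cong (≈-trans (fraction (suc (toℕ i)) n)
                                                            (*-cong (fromℕ-suc (toℕ i)) ≈-refl)) ≈-refl ⟩
          (1# + fromℕ (toℕ i)) * unitFraction n * T    ≈⟨ solve 3 (λ i u T → (con 1ℚ :+ i) :* u :* T := i :* u :* T :+ u :* T) ≈-refl
                                                            (fromℕ (toℕ i)) (unitFraction n) T ⟩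
          fromℕ (toℕ i) * unitFraction n * T + unitFraction n * T
            ≤⟨ +-mono-≤ (≤-trans (proj₂ (*-cong (fraction (toℕ i) n) ≈-refl)) lo′) width ⟩
          t + fromℚ ε ∎

    regular-tail : ∀ {d} {g : Vec R d → R} → Regular T g → Regular T (g ∘ tail)
    regular-tail ((K , 0<K , b) , uc) =
        (K , 0<K , λ { (_ ∷ t) (_ ∷ t∈) → b t t∈ })
      , (λ ε 0<ε → let (N , u) = uc ε 0<ε in N , λ { n le (_ ∷ is) (_ ∷ s∈) (_ ∷ t∈) → u n le is s∈ t∈ })

-- From one-dimensional grids to the maximum over the cube

module Signals (𝓡 : RealStructure) where
  open RealAlgebra 𝓡
  open ComplexAlgebra 𝓡
  open ExponentialSums 𝓡
  open Integration 𝓡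
  open RegularFunctions 𝓡
  private
    module Sᶜ = Solverᶜ
  open Solver using (solve; _:=_; _:+_; _:*_; _:-_; :-_; con)
  open CauchyLemmas using (frac-≤)
  open RationalLemmas using (scale-down)

  dot : ∀ {d} → Vec R d → Vec R d → R
  dot f t = foldr′ _+_ 0# (zipWith _*_ f t)

  dot-∷ : ∀ {d} (f : Vec R (suc d)) s t → dot f (s ∷ t) ≡ head f * s + dot (tail f) t
  dot-∷ (_ ∷ _) s t = ≡.refl

  signal : ∀ {d k} → R → (Fin k → C) → (Fin k → Vec R d) → Vec R d → C
  signal c v f t = finSum (λ l → v l *ᶜ cis (c * dot (f l) t))

  -- With h = T / n and s in cell i₀, this is s moved by i - i₀ cell widths. It lies in cell i at
  -- the same relative position, and i = i₀ gives back s.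
  shiftTag : ∀ {n} → R → R → Fin n → Fin n → R
  shiftTag h s i₀ i = s + (fromℕ (toℕ i) - fromℕ (toℕ i₀)) * h

  shiftTags : ∀ {d n} → R → Vec R d → Vec (Fin n) d → Vec (Fin n) d → Vec R d
  shiftTags h []      []        []       = []
  shiftTags h (s ∷ t) (i₀ ∷ is₀) (i ∷ is) = shiftTag h s i₀ i ∷ shiftTags h t is₀ is

  module _ (T : R) (0≤T : 0# ≤ T) where

    dot-regular : ∀ {d} (f : Vec R d) → Regular T (dot f)
    dot-regular []       = regular-cong T 0≤T (λ { [] → ≈-refl }) (regular-const T 0≤T 0#)
    dot-regular (a ∷ f) = regular-cong T 0≤T (λ { (s ∷ t) → ≈-refl })
      (regular-+ T 0≤T (regular-* T 0≤T (regular-const T 0≤T a) (regular-head T 0≤T)) (regular-tail T 0≤T (dot-regular f)))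

    signal-regular : ∀ {d k} c v (f : Fin k → Vec R d) →
      Regular T (λ t → re (signal c v f t)) × Regular T (λ t → im (signal c v f t))
    signal-regular {k = zero}  c v f = regular-const T 0≤T 0# , regular-const T 0≤T 0#
    signal-regular {k = suc k} c v f =
      let (p , q) = signal-regular c (v ∘ suc) (f ∘ suc)
          (cosθ , sinθ) = regular-cos-sin T 0≤T (regular-* T 0≤T (regular-const T 0≤T c) (dot-regular (f zero)))
          a = regular-const T 0≤T (re (v zero))
          b = regular-const T 0≤T (im (v zero))
      in regular-+ T 0≤T (regular-+ T 0≤T (regular-* T 0≤T a cosθ) (regular-neg T 0≤T (regular-* T 0≤T b sinθ))) p
       , regular-+ T 0≤T (regular-+ T 0≤T (regular-* T 0≤T a sinθ) (regular-* T 0≤T b cosθ)) q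

    energy-regular : ∀ {d k} c v (f : Fin k → Vec R d) → Regular T (λ t → norm² (signal c v f t))
    energy-regular c v f =
      let (p , q) = signal-regular c v f in regular-+ T 0≤T (regular-* T 0≤T p p) (regular-* T 0≤T q q)

    -- Locating s requires comparisons with the cell boundaries, hence the double negation. The
    -- search descends from the right end: if s is not below the lower boundary of a cell, the cell
    -- is found.
    choose-cell : ∀ n .{{_ : ℕ.NonZero n}} {s} → 0# ≤ s → s ≤ T → ¬ ¬ (Σ[ i ∈ Fin n ] InCell T n i s)
    choose-cell n@(suc n′) {s} 0≤s s≤T = below n ℕP.≤-refl (≤-trans s≤T (proj₂ whole))
      where
      whole : fromℚ (+ n ℚ./ n) * T ≈ T
      whole = ≈-trans (*-cong (≈-trans (fraction n n) (n*1/n n)) ≈-refl) (*-identityˡ T)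
      below : ∀ m → m ℕ.≤ n → s ≤ fromℚ (+ m ℚ./ n) * T → ¬ ¬ (Σ[ i ∈ Fin n ] InCell T n i s)
      below zero m≤n s≤ none = none (zero
        , ≤-trans (proj₁ nothing-left) 0≤s
        , ≤-trans s≤ (*-monoʳ 0≤T (fromℚ-mono (frac-≤ {0} {n} {1} {n} ℕ.z≤n))))
        where
        nothing-left : fromℚ (+ 0 ℚ./ n) * T ≈ 0#
        nothing-left = ≈-trans (*-cong (fraction 0 n) ≈-refl)
          (solve 2 (λ u T → (con 0ℚ :* u) :* T := con 0ℚ) ≈-refl (unitFraction n) T)
      below (suc m) m<n s≤ none = none (Fin.fromℕ< m<n
        , ≡.subst (λ j → fromℚ (+ j ℚ./ n) * T ≤ s × s ≤ fromℚ (+ suc j ℚ./ n) * T) (≡.sym (FinP.toℕ-fromℕ< m<n))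
            (≰⇒≥ (λ s≤′ → below m (ℕP.<⇒≤ m<n) s≤′ none) , s≤))

    choose-cells : ∀ {d} n .{{_ : ℕ.NonZero n}} {t : Vec R d} → InCube T t →
      ¬ ¬ (Σ[ is ∈ Vec (Fin n) d ] Pointwise (InCell T n) is t)
    choose-cells n []                   none = none ([] , [])
    choose-cells n ((0≤s , s≤T) ∷ t∈) none = choose-cell n 0≤s s≤T λ (i , p) →
      choose-cells n t∈ λ (is , ps) → none (i ∷ is , p ∷ ps)

    shiftTag-inCell : ∀ n .{{_ : ℕ.NonZero n}} {s} {i₀ : Fin n} → InCell T n i₀ s →
      ∀ i → InCell T n i (shiftTag (unitFraction n * T) s i₀ i)
    shiftTag-inCell n {s} {i₀} (lo , hi) i =
        ≤-trans (proj₁ (*-cong (fraction (toℕ i) n) ≈-refl))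
          (≤-shift (≤-trans (proj₂ (*-cong (fraction (toℕ i₀) n) ≈-refl)) lo)
            (solve 5 (λ i j u T s → (i :* u) :* T :+ (s :- (j :* u) :* T) := s :+ (i :- j) :* (u :* T)) ≈-refl
              (fromℕ (toℕ i)) (fromℕ (toℕ i₀)) (unitFraction n) T s))
      , ≤-trans (≤-shift (≤-trans hi (proj₁ (edge i₀)))
            (solve 5 (λ i j u T s → s :+ (i :- j) :* (u :* T) :+ (((con 1ℚ :+ j) :* u) :* T :- s) := ((con 1ℚ :+ i) :* u) :* T) ≈-refl
              (fromℕ (toℕ i)) (fromℕ (toℕ i₀)) (unitFraction n) T s))
          (proj₂ (edge i))
      where
      edge : ∀ i → fromℚ (+ suc (toℕ i) ℚ./ n) * T ≈ ((1# + fromℕ (toℕ i)) * unitFraction n) * T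
      edge i = *-cong (≈-trans (fraction (suc (toℕ i)) n) (*-cong (fromℕ-suc (toℕ i)) ≈-refl)) ≈-refl

    shiftTags-inCell : ∀ {d} n .{{_ : ℕ.NonZero n}} {t : Vec R d} {is₀ : Vec (Fin n) d} → Pointwise (InCell T n) is₀ t →
      ∀ is → Pointwise (InCell T n) is (shiftTags (unitFraction n * T) t is₀ is)
    shiftTags-inCell n []       []       = []
    shiftTags-inCell n (p ∷ ps) (i ∷ is) = shiftTag-inCell n p i ∷ shiftTags-inCell n ps is

  -- Fixing the first coordinate multiplies each amplitude by a phase and leaves a signal in one
  -- dimension less with the same number of frequencies.
  frozen : ∀ {d k} → R → (Fin k → C) → (Fin k → Vec R (suc d)) → R → Fin k → C
  frozen c v f s l = v l *ᶜ cis (c * (head (f l) * s))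

  signal-∷ : ∀ {d k} c v (f : Fin k → Vec R (suc d)) s t →
    signal c v f (s ∷ t) ≈ᶜ signal c (frozen c v f s) (tail ∘ f) t
  signal-∷ c v f s t = finSum-cong (λ l → ≈ᶜ-trans
    (*ᶜ-cong ≈ᶜ-refl (≈ᶜ-trans (cis-cong (≈-trans (*-cong ≈-refl (≡⇒≈ (dot-∷ (f l) s t)))
        (distribˡ c (head (f l) * s) (dot (tail (f l)) t))))
      (cis-+ (c * (head (f l) * s)) (c * dot (tail (f l)) t))))
    (≈ᶜ-sym (Sᶜ.solve 3 (λ v a b → (v Sᶜ.:* a) Sᶜ.:* b Sᶜ.:= v Sᶜ.:* (a Sᶜ.:* b)) ≈ᶜ-refl
      (v l) (cis (c * (head (f l) * s))) (cis (c * dot (tail (f l)) t)))))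

  signal-cong : ∀ {d k} c v (f : Fin k → Vec R (suc d)) {s s′} t → s ≈ s′ →
    signal c v f (s ∷ t) ≈ᶜ signal c v f (s′ ∷ t)
  signal-cong c v f {s} {s′} t s≈s′ = finSum-cong (λ l → *ᶜ-cong ≈ᶜ-refl (cis-cong (*-cong ≈-refl
    (≈-trans (≡⇒≈ (dot-∷ (f l) s t)) (≈-trans (+-cong (*-cong ≈-refl s≈s′) ≈-refl) (≡⇒≈ (≡.sym (dot-∷ (f l) s′ t))))))))

  -- A step h in the first coordinate multiplies the l-th wave by the phase of its first frequency
  -- component; the other coordinates only affect the starting value. A negative h yields the
  -- backward samples.
  line : ∀ {d k} c v (f : Fin k → Vec R (suc d)) s t h →
    ExponentialSum k (λ j → signal c v f ((s + fromℕ j * h) ∷ t))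
  line c v f s t h = record
    { ratio     = λ l → cis (c * (head (f l) * h))
    ; unit      = λ l → cos²+sin² (c * (head (f l) * h))
    ; component = λ l j → v l *ᶜ cis (c * dot (f l) ((s + fromℕ j * h) ∷ t))
    ; geom      = λ l j → ≈ᶜ-trans
        (*ᶜ-cong ≈ᶜ-refl (≈ᶜ-trans (cis-cong (argument l j))
          (cis-+ (c * (head (f l) * h)) (c * dot (f l) ((s + fromℕ j * h) ∷ t)))))
        (Sᶜ.solve 3 (λ v a b → v Sᶜ.:* (a Sᶜ.:* b) Sᶜ.:= a Sᶜ.:* (v Sᶜ.:* b)) ≈ᶜ-refl
          (v l) (cis (c * (head (f l) * h))) (cis (c * dot (f l) ((s + fromℕ j * h) ∷ t))))
    ; total     = λ j → ≈ᶜ-refl }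
    where
    argument : ∀ l j → c * dot (f l) ((s + fromℕ (suc j) * h) ∷ t)
                     ≈ c * (head (f l) * h) + c * dot (f l) ((s + fromℕ j * h) ∷ t)
    argument l j = ≈-trans
      (*-cong ≈-refl (≈-trans (≡⇒≈ (dot-∷ (f l) (s + fromℕ (suc j) * h) t))
        (+-cong (*-cong ≈-refl (+-cong ≈-refl (*-cong (fromℕ-suc j) ≈-refl))) ≈-refl)))
      (≈-trans (solve 6 (λ c a s j h p → c :* (a :* (s :+ (con 1ℚ :+ j) :* h) :+ p)
          := c :* (a :* h) :+ c :* (a :* (s :+ j :* h) :+ p)) ≈-refl c (head (f l)) s (fromℕ j) h (dot (tail (f l)) t))
        (+-cong ≈-refl (*-cong ≈-refl (≡⇒≈ (≡.sym (dot-∷ (f l) (s + fromℕ j * h) t))))))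

  GridConstant : ℕ → ℕ → Set
  GridConstant k K = ∀ (g : ℕ → R) → (∀ i → 0# ≤ g i) → ∀ i₀ ℓ {forward backward} →
    ExponentialSum k forward → (∀ j → norm² (forward j) ≈ g (i₀ ℕ.+ j)) →
    ExponentialSum k backward → (∀ i j → i ℕ.+ j ≡ i₀ → norm² (backward j) ≈ g i) →
    fromℕ (i₀ ℕ.+ suc ℓ) * g i₀ ≤ fromℕ K * sum (i₀ ℕ.+ suc ℓ) g

  module _ {k K} (constant : GridConstant k K) where

    line-bound : ∀ {d n} c v (f : Fin k → Vec R (suc d)) s t h (i₀ : Fin n) →
      fromℕ n * norm² (signal c v f (s ∷ t)) ≤
        fromℕ K * sum n (λ i → norm² (signal c v f ((s + (fromℕ i - fromℕ (toℕ i₀)) * h) ∷ t)))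
    line-bound {n = n} c v f s t h i₀ = ≤-trans (*-monoˡ (0≤fromℕ n) (proj₁ (norm²-cong (signal-cong c v f t
        (solve 3 (λ s i h → s := s :+ (i :- i) :* h) ≈-refl s (fromℕ (toℕ i₀)) h)))))
      (≡.subst (λ n → fromℕ n * g (toℕ i₀) ≤ fromℕ K * sum n g) n≡
        (constant g (λ i → 0≤norm² (signal c v f ((s + (fromℕ i - fromℕ (toℕ i₀)) * h) ∷ t))) (toℕ i₀) ℓ
          (line c v f s t h)
          (λ j → norm²-cong (signal-cong c v f t (≈-sym (≈-trans
            (+-cong ≈-refl (*-cong (+-cong (fromℕ-+ (toℕ i₀) j) ≈-refl) ≈-refl))
            (solve 4 (λ s i j h → s :+ ((i :+ j) :- i) :* h := s :+ j :* h) ≈-refl s (fromℕ (toℕ i₀)) (fromℕ j) h)))))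
          (line c v f s t (- h))
          (λ i j i+j≡i₀ → norm²-cong (signal-cong c v f t (≈-sym (≈-trans
            (+-cong ≈-refl (*-cong (+-cong ≈-refl (-‿cong (≈-trans (≡⇒≈ (≡.cong fromℕ (≡.sym i+j≡i₀))) (fromℕ-+ i j)))) ≈-refl))
            (solve 4 (λ s i j h → s :+ (i :- (i :+ j)) :* h := s :+ j :* (:- h)) ≈-refl s (fromℕ i) (fromℕ j) h)))))))
      where
      g : ℕ → R
      g i = norm² (signal c v f ((s + (fromℕ i - fromℕ (toℕ i₀)) * h) ∷ t))
      ℓ = n ℕ.∸ suc (toℕ i₀)
      n≡ : toℕ i₀ ℕ.+ suc ℓ ≡ n
      n≡ = ≡.trans (ℕP.+-suc (toℕ i₀) ℓ) (ℕP.m+[n∸m]≡n (FinP.toℕ<n i₀))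

    discrete-bound : ∀ {d n} c v (f : Fin k → Vec R d) t h (is₀ : Vec (Fin n) d) →
      power (fromℕ n) d * norm² (signal c v f t) ≤
        power (fromℕ K) d * multiSum d (λ is → norm² (signal c v f (shiftTags h t is₀ is)))
    discrete-bound {zero} c v f [] h [] = ≤-refl
    discrete-bound {suc d} {n} c v f (s ∷ t) h (i₀ ∷ is₀) = begin
      (fromℕ n * P) * norm² (signal c v f (s ∷ t))
        ≈⟨ solve 3 (λ n p x → (n :* p) :* x := p :* (n :* x)) ≈-refl (fromℕ n) P (norm² (signal c v f (s ∷ t))) ⟩
      P * (fromℕ n * norm² (signal c v f (s ∷ t)))
        ≤⟨ *-monoˡ (0≤power (0≤fromℕ n) d) (line-bound c v f s t h i₀) ⟩
      P * (fromℕ K * sum n g)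
        ≈⟨ solve 3 (λ p k s → p :* (k :* s) := k :* (p :* s)) ≈-refl P (fromℕ K) (sum n g) ⟩
      fromℕ K * (P * sum n g)
        ≈⟨ *-cong ≈-refl (≈-trans (*-cong ≈-refl (≈-sym (sumFin-toℕ n g))) (≈-sym (sumFin-scale {n} P (g ∘ toℕ)))) ⟩
      fromℕ K * sumFin {n} (λ i → P * g (toℕ i))
        ≤⟨ *-monoˡ (0≤fromℕ K) (sumFin-mono each) ⟩
      fromℕ K * sumFin {n} (λ i → Q * M i)
        ≈⟨ *-cong ≈-refl (sumFin-scale Q M) ⟩
      fromℕ K * (Q * sumFin M)
        ≈˘⟨ *-assoc (fromℕ K) Q (sumFin M) ⟩
      (fromℕ K * Q) * sumFin M
      ∎
      where
      P = power (fromℕ n) d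
      Q = power (fromℕ K) d
      g : ℕ → R
      g i = norm² (signal c v f ((s + (fromℕ i - fromℕ (toℕ i₀)) * h) ∷ t))
      M : Fin n → R
      M i = multiSum d (λ is → norm² (signal c v f (shiftTag h s i₀ i ∷ shiftTags h t is₀ is)))
      each : ∀ i → P * g (toℕ i) ≤ Q * M i
      each i = ≤-trans (*-monoˡ (0≤power (0≤fromℕ n) d) (proj₁ (norm²-cong (signal-∷ c v f s′ t))))
        (≤-trans (discrete-bound c (frozen c v f s′) (tail ∘ f) t h is₀)
          (*-monoˡ (0≤power (0≤fromℕ K) d) (multiSum-mono d (λ is →
            proj₂ (norm²-cong (signal-∷ c v f s′ (shiftTags h t is₀ is)))))))
        where s′ = shiftTag h s i₀ i

    -- For each η a single fine grid through t suffices: `discrete-bound` compares g(t) with its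
    -- Riemann sum, which differs from I by at most ε. The loss D ε is made at most η, and η tends
    -- to 0.
    maximum-bound : ∀ {d} T (0≤T : 0# ≤ T) T⁻¹ → 0# ≤ T⁻¹ → T⁻¹ * T ≈ 1# → ∀ c v (f : Fin k → Vec R d)
      (g : Vec R d → R) → (∀ t → g t ≈ norm² (signal c v f t)) → ∀ I → IsIntegral T g I →
      ∀ t → InCube T t → g t ≤ power (fromℕ K) d * (power T⁻¹ d * I)
    maximum-bound {d} T 0≤T T⁻¹ 0≤T⁻¹ T⁻¹T c v f g g≈ I integral t t∈ = ≤-limit λ η 0<η →
      let (B , 0<B , D≤B , _) = bounded D
          (ε , 0<ε , _ , Bε≤η) = scale-down B η 0<B 0<η
          (N , close) = integral ε 0<ε
      -- The goal is a stable inequality, so the cells, known to exist only up to double negation,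
      -- may be used. The grid size is `suc N` because it must be nonzero.
      in ≤-trans (≤-stable (λ no → choose-cells T 0≤T (suc N) t∈ (λ (is₀ , p) → no
           (grid-step (suc N) (fromℚ ε) is₀ (proj₁ (close (suc N) (ℕP.n≤1+n N) (shiftTags (unitFraction (suc N) * T) t is₀)
              (shiftTags-inCell T 0≤T (suc N) p)))))))
         (begin
           A * (power T⁻¹ d * (I + fromℚ ε))
             ≈⟨ solve 4 (λ a b i e → a :* (b :* (i :+ e)) := a :* (b :* i) :+ (a :* b) :* e) ≈-refl A (power T⁻¹ d) I (fromℚ ε) ⟩
           A * (power T⁻¹ d * I) + D * fromℚ ε
             ≤⟨ +-mono-≤ ≤-refl (≤-trans (*-monoʳ (fromℚ-mono (ℚP.<⇒≤ 0<ε)) D≤B)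
                  (≤-trans (proj₂ (fromℚ-* B ε)) (fromℚ-mono Bε≤η))) ⟩
           A * (power T⁻¹ d * I) + fromℚ η
         ∎)
      where
      A = power (fromℕ K) d
      D = A * power T⁻¹ d
      grid-step : ∀ n .{{_ : ℕ.NonZero n}} e is₀ →
        riemannSum T g n (shiftTags (unitFraction n * T) t is₀) ≤ I + e →
        g t ≤ A * (power T⁻¹ d * (I + e))
      grid-step n e is₀ R≤ = begin
        g t
          ≈⟨ ≈-trans (g≈ t) (≈-trans (≈-sym (*-identityˡ (norm² (signal c v f t))))
               (*-cong (≈-sym (power-inverse d (≈-trans (*-comm u (fromℕ n)) (n*1/n n)))) ≈-refl)) ⟩
        (U * power (fromℕ n) d) * norm² (signal c v f t)
          ≈⟨ *-assoc U (power (fromℕ n) d) (norm² (signal c v f t)) ⟩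
        U * (power (fromℕ n) d * norm² (signal c v f t))
          ≤⟨ *-monoˡ (0≤power (0≤unitFraction n) d) (discrete-bound c v f t (u * T) is₀) ⟩
        U * (A * multiSum d (λ is → norm² (signal c v f (shiftTags (u * T) t is₀ is))))
          ≈⟨ *-cong ≈-refl (*-cong ≈-refl (multiSum-cong d (λ is → ≈-sym (g≈ (shiftTags (u * T) t is₀ is))))) ⟩
        U * (A * S)
          ≈⟨ solve 3 (λ u a s → u :* (a :* s) := a :* (con 1ℚ :* (u :* s))) ≈-refl U A S ⟩
        A * (1# * (U * S))
          ≈⟨ *-cong ≈-refl (≈-trans (*-cong (≈-sym (power-inverse d T⁻¹T)) ≈-refl)
               (≈-trans (solve 4 (λ t v u s → (t :* v) :* (u :* s) := t :* ((u :* v) :* s)) ≈-refl (power T⁻¹ d) (power T d) U S)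
                 (*-cong ≈-refl (*-cong (≈-sym (power-* u T d)) ≈-refl)))) ⟩
        A * (power T⁻¹ d * riemannSum T g n (shiftTags (u * T) t is₀))
          ≤⟨ *-monoˡ (0≤power (0≤fromℕ K) d) (*-monoˡ (0≤power 0≤T⁻¹ d) R≤) ⟩
        A * (power T⁻¹ d * (I + e))
        ∎
        where
        u = unitFraction n
        U = power u d
        S = multiSum d (λ is → g (shiftTags (u * T) t is₀ is))

-- The Cauchy reals satisfy the abstract properties

module CauchyReals where
  open Defs
  open import Data.Rational using (∣_∣)
  open import Data.Rational.Solver using (module +-*-Solver)
  open ≡ using (refl; sym; trans; cong; cong₂; subst)
  open RationalLemmas
  open CauchyLemmas using (0<*; 0<½; 0<1; 0≤+; cauchy-bounded; half+half; archimedean-1/suc; cauchy-exp; ∣-∣-sym; *-mono-≤)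
  open +-*-Solver
  open ℚP.≤-Reasoning

  0<½* : ∀ {ε} → 0ℚ ℚ.< ε → 0ℚ ℚ.< ½ ℚ.* ε
  0<½* 0<ε = 0<* 0<½ 0<ε

  private
    weakenˡ : ∀ N {M m} → N ℕ.⊔ M ℕ.≤ m → N ℕ.≤ m
    weakenˡ N {M} = ℕP.≤-trans (ℕP.m≤m⊔n N M)

    weakenʳ : ∀ N {M m} → N ℕ.⊔ M ℕ.≤ m → M ℕ.≤ m
    weakenʳ N {M} = ℕP.≤-trans (ℕP.m≤n⊔m N M)

    weaken : ∀ N {M m} → N ℕ.⊔ M ℕ.≤ m → N ℕ.≤ m × M ℕ.≤ m
    weaken N h = weakenˡ N h , weakenʳ N h

  pointwise-≤ : ∀ x y → (∀ n → seq x n ℚ.≤ seq y n) → x ≤ y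
  pointwise-≤ x y h ε 0<ε = 0 , λ n _ → ≤-by ((seq y n ℚ.- seq x n) ℚ.+ ε)
    (0≤+ (0≤diff (h n)) (ℚP.<⇒≤ 0<ε))
    (solve 3 (λ a b e → a :+ ((b :- a) :+ e) := b :+ e) refl (seq x n) (seq y n) ε)

  pointwise-≈ : ∀ x y → (∀ n → seq x n ≡ seq y n) → x ≈ y
  pointwise-≈ x y h = pointwise-≤ x y (λ n → ℚP.≤-reflexive (h n))
                    , pointwise-≤ y x (λ n → ℚP.≤-reflexive (sym (h n)))

  close⇒≈ : ∀ x y → (∀ ε → 0ℚ ℚ.< ε → ∃[ N ] (∀ n → N ℕ.≤ n → ∣ seq x n ℚ.- seq y n ∣ ℚ.≤ ε)) → x ≈ y
  close⇒≈ x y h = (λ ε 0<ε → proj₁ (h ε 0<ε) , λ n p → ∣-∣-upper {seq x n} (proj₂ (h ε 0<ε) n p))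
                , (λ ε 0<ε → proj₁ (h ε 0<ε) , λ n p → ∣-∣-lower {seq x n} (proj₂ (h ε 0<ε) n p))

  ≈⇒close : ∀ x y → x ≈ y → ∀ ε → 0ℚ ℚ.< ε → ∃[ N ] (∀ n → N ℕ.≤ n → ∣ seq x n ℚ.- seq y n ∣ ℚ.≤ ε)
  ≈⇒close x y (p , q) ε 0<ε =
    let (N , h) = p ε 0<ε
        (M , k) = q ε 0<ε
    in N ℕ.⊔ M , λ n le → ∣-∣-intro (h n (weakenˡ N le)) (k n (weakenʳ N le))

  ≤-refl : ∀ x → x ≤ x
  ≤-refl x = pointwise-≤ x x (λ n → ℚP.≤-refl)

  ≤-trans : ∀ x y z → x ≤ y → y ≤ z → x ≤ z
  ≤-trans x y z p q ε 0<ε =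
    let (N , h) = p (½ ℚ.* ε) (0<½* 0<ε)
        (M , k) = q (½ ℚ.* ε) (0<½* 0<ε)
    in N ℕ.⊔ M , λ n le → begin
    seq x n                             ≤⟨ h n (weakenˡ N le) ⟩
    seq y n ℚ.+ ½ ℚ.* ε                 ≤⟨ ℚP.+-monoˡ-≤ (½ ℚ.* ε) (k n (weakenʳ N le)) ⟩
    seq z n ℚ.+ ½ ℚ.* ε ℚ.+ ½ ℚ.* ε     ≡⟨ trans (ℚP.+-assoc (seq z n) (½ ℚ.* ε) (½ ℚ.* ε))
                                             (cong (λ t → seq z n ℚ.+ t) (half+half ε)) ⟩
    seq z n ℚ.+ ε                       ∎

  +-mono-≤ : ∀ x y u v → x ≤ y → u ≤ v → x + u ≤ y + v
  +-mono-≤ x y u v p q ε 0<ε =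
    let (N , h) = p (½ ℚ.* ε) (0<½* 0<ε)
        (M , k) = q (½ ℚ.* ε) (0<½* 0<ε)
    in N ℕ.⊔ M , λ n le → begin
    seq x n ℚ.+ seq u n
      ≤⟨ ℚP.+-mono-≤ (h n (weakenˡ N le)) (k n (weakenʳ N le)) ⟩
    (seq y n ℚ.+ ½ ℚ.* ε) ℚ.+ (seq v n ℚ.+ ½ ℚ.* ε)
      ≡⟨ solve 3 (λ y v e → (y :+ e) :+ (v :+ e) := (y :+ v) :+ (e :+ e)) refl (seq y n) (seq v n) (½ ℚ.* ε) ⟩
    seq y n ℚ.+ seq v n ℚ.+ (½ ℚ.* ε ℚ.+ ½ ℚ.* ε)
      ≡⟨ cong (λ t → seq y n ℚ.+ seq v n ℚ.+ t) (half+half ε) ⟩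
    seq y n ℚ.+ seq v n ℚ.+ ε ∎

  neg-mono-≤ : ∀ x y → x ≤ y → - y ≤ - x
  neg-mono-≤ x y p ε 0<ε = let (N , h) = p ε 0<ε in N , λ n le → ≤-shift (h n le)
    (solve 3 (λ x y e → (:- y) :+ ((y :+ e) :- x) := (:- x) :+ e) refl (seq x n) (seq y n) ε)

  -- Approximants of nonnegative reals may be negative down to -δ. The bound comes from a b = (a +
  -- δ) (b + δ) - δ (a + b) - δ², with δ² ≤ δ.
  0≤* : ∀ x y → 0ℝ ≤ x → 0ℝ ≤ y → 0ℝ ≤ x * y
  0≤* x y p q ε 0<ε =
    let (K , 0<K , x≤K) = cauchy-bounded (seq x) (cauchy x)
        (L , 0<L , y≤L) = cauchy-bounded (seq y) (cauchy y)
        (δ , 0<δ , δ≤1 , small) = scale-down (K ℚ.+ L ℚ.+ 1ℚ) ε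
          (ℚP.+-mono-< {0ℚ} {K ℚ.+ L} {0ℚ} {1ℚ} (ℚP.+-mono-< {0ℚ} {K} {0ℚ} {L} 0<K 0<L) 0<1) 0<ε
        (N , h) = p δ 0<δ
        (M , k) = q δ 0<δ
    in N ℕ.⊔ M , λ n le → estimate (seq x n) (seq y n) δ K L ε (ℚP.<⇒≤ 0<δ) δ≤1 small
         (h n (weakenˡ N le)) (k n (weakenʳ N le))
         (ℚP.≤-trans (p≤∣p∣ (seq x n)) (x≤K n)) (ℚP.≤-trans (p≤∣p∣ (seq y n)) (y≤L n))
    where
    estimate : ∀ a b δ K L ε → 0ℚ ℚ.≤ δ → δ ℚ.≤ 1ℚ → (K ℚ.+ L ℚ.+ 1ℚ) ℚ.* δ ℚ.≤ ε →
      0ℚ ℚ.≤ a ℚ.+ δ → 0ℚ ℚ.≤ b ℚ.+ δ → a ℚ.≤ K → b ℚ.≤ L → 0ℚ ℚ.≤ a ℚ.* b ℚ.+ ε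
    estimate a b δ K L ε 0≤δ δ≤1 small 0≤a+δ 0≤b+δ a≤K b≤L =
      ≤-by (((a ℚ.+ δ) ℚ.* (b ℚ.+ δ) ℚ.+ δ ℚ.* ((K ℚ.- a) ℚ.+ (L ℚ.- b) ℚ.+ (1ℚ ℚ.- δ)))
              ℚ.+ (ε ℚ.- (K ℚ.+ L ℚ.+ 1ℚ) ℚ.* δ))
         (0≤+ (0≤+ (CauchyLemmas.0≤* 0≤a+δ 0≤b+δ)
             (CauchyLemmas.0≤* 0≤δ (0≤+ (0≤+ (0≤diff a≤K) (0≤diff b≤L)) (0≤diff δ≤1))))
           (0≤diff small))
         (solve 6 (λ a b d K L e → con 0ℚ :+ (((a :+ d) :* (b :+ d)
              :+ d :* ((K :- a) :+ (L :- b) :+ (con 1ℚ :- d))) :+ (e :- (K :+ L :+ con 1ℚ) :* d))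
            := a :* b :+ e) refl a b δ K L ε)

  +-cong : ∀ x y u v → x ≈ y → u ≈ v → x + u ≈ y + v
  +-cong x y u v (p , p′) (q , q′) = +-mono-≤ x y u v p q , +-mono-≤ y x v u p′ q′

  neg-cong : ∀ x y → x ≈ y → - x ≈ - y
  neg-cong x y (p , p′) = neg-mono-≤ y x p′ , neg-mono-≤ x y p

  *-cong : ∀ x y u v → x ≈ y → u ≈ v → x * u ≈ y * v
  *-cong x y u v x≈y u≈v = close⇒≈ (x * u) (y * v) λ ε 0<ε →
    let (K , 0<K , x≤K) = cauchy-bounded (seq x) (cauchy x)
        (L , 0<L , v≤L) = cauchy-bounded (seq v) (cauchy v)
        (δ , 0<δ , _ , small) = scale-down (K ℚ.+ L) ε (ℚP.+-mono-< {0ℚ} {K} {0ℚ} {L} 0<K 0<L) 0<ε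
        (N , h) = ≈⇒close x y x≈y δ 0<δ
        (M , k) = ≈⇒close u v u≈v δ 0<δ
    in N ℕ.⊔ M , λ n le → ℚP.≤-trans
         (estimate (seq x n) (seq y n) (seq u n) (seq v n) δ K L (ℚP.<⇒≤ 0<K) (ℚP.<⇒≤ 0<L) (x≤K n) (v≤L n)
           (h n (weakenˡ N le)) (k n (weakenʳ N le))) small
    where
    estimate : ∀ a b c d δ K L → 0ℚ ℚ.≤ K → 0ℚ ℚ.≤ L → ∣ a ∣ ℚ.≤ K → ∣ d ∣ ℚ.≤ L →
      ∣ a ℚ.- b ∣ ℚ.≤ δ → ∣ c ℚ.- d ∣ ℚ.≤ δ → ∣ a ℚ.* c ℚ.- b ℚ.* d ∣ ℚ.≤ (K ℚ.+ L) ℚ.* δ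
    estimate a b c d δ K L 0≤K 0≤L a≤K d≤L ab cd = begin
      ∣ a ℚ.* c ℚ.- b ℚ.* d ∣
        ≡⟨ cong ∣_∣ (solve 4 (λ a b c d → a :* c :- b :* d := a :* (c :- d) :+ d :* (a :- b)) refl a b c d) ⟩
      ∣ a ℚ.* (c ℚ.- d) ℚ.+ d ℚ.* (a ℚ.- b) ∣
        ≤⟨ ℚP.∣p+q∣≤∣p∣+∣q∣ (a ℚ.* (c ℚ.- d)) (d ℚ.* (a ℚ.- b)) ⟩
      ∣ a ℚ.* (c ℚ.- d) ∣ ℚ.+ ∣ d ℚ.* (a ℚ.- b) ∣
        ≡⟨ cong₂ ℚ._+_ (ℚP.∣p*q∣≡∣p∣*∣q∣ a (c ℚ.- d)) (ℚP.∣p*q∣≡∣p∣*∣q∣ d (a ℚ.- b)) ⟩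
      ∣ a ∣ ℚ.* ∣ c ℚ.- d ∣ ℚ.+ ∣ d ∣ ℚ.* ∣ a ℚ.- b ∣
        ≤⟨ ℚP.+-mono-≤
             (*-mono-≤ 0≤K (ℚP.0≤∣p∣ (c ℚ.- d)) a≤K cd)
             (*-mono-≤ 0≤L (ℚP.0≤∣p∣ (a ℚ.- b)) d≤L ab) ⟩
      K ℚ.* δ ℚ.+ L ℚ.* δ
        ≡⟨ ℚP.*-distribʳ-+ δ K L ⟨
      (K ℚ.+ L) ℚ.* δ ∎

  ≈-refl : ∀ x → x ≈ x
  ≈-refl x = ≤-refl x , ≤-refl x

  ≈-trans : ∀ x y z → x ≈ y → y ≈ z → x ≈ z
  ≈-trans x y z (p , p′) (q , q′) = ≤-trans x y z p q , ≤-trans z y x q′ p′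

  isCommutativeRing : IsCommutativeRing _≈_ _+_ _*_ -_ 0ℝ 1ℝ
  isCommutativeRing = record
    { isRing = record
      { +-isAbelianGroup = record
        { isGroup = record
          { isMonoid = record
            { isSemigroup = record
              { isMagma = record
                { isEquivalence = record
                  { refl  = λ {x} → ≈-refl x
                  ; sym   = λ (p , q) → q , p
                  ; trans = λ {x} {y} {z} → ≈-trans x y z }
                ; ∙-cong = λ {x} {y} {u} {v} → +-cong x y u v }
              ; assoc = λ x y z → pointwise-≈ (x + y + z) (x + (y + z)) (λ n → ℚP.+-assoc (seq x n) (seq y n) (seq z n)) }
            ; identity = (λ x → pointwise-≈ (0ℝ + x) x (λ n → ℚP.+-identityˡ (seq x n)))
                       , (λ x → pointwise-≈ (x + 0ℝ) x (λ n → ℚP.+-identityʳ (seq x n))) }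
          ; inverse = (λ x → pointwise-≈ (- x + x) 0ℝ (λ n → ℚP.+-inverseˡ (seq x n)))
                    , (λ x → pointwise-≈ (x + - x) 0ℝ (λ n → ℚP.+-inverseʳ (seq x n)))
          ; ⁻¹-cong = λ {x} {y} → neg-cong x y }
        ; comm = λ x y → pointwise-≈ (x + y) (y + x) (λ n → ℚP.+-comm (seq x n) (seq y n)) }
      ; *-cong = λ {x} {y} {u} {v} → *-cong x y u v
      ; *-assoc = λ x y z → pointwise-≈ (x * y * z) (x * (y * z)) (λ n → ℚP.*-assoc (seq x n) (seq y n) (seq z n))
      ; *-identity = (λ x → pointwise-≈ (1ℝ * x) x (λ n → ℚP.*-identityˡ (seq x n)))
                   , (λ x → pointwise-≈ (x * 1ℝ) x (λ n → ℚP.*-identityʳ (seq x n)))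
      ; distrib = (λ x y z → pointwise-≈ (x * (y + z)) (x * y + x * z) (λ n → ℚP.*-distribˡ-+ (seq x n) (seq y n) (seq z n)))
                , (λ x y z → pointwise-≈ ((y + z) * x) (y * x + z * x) (λ n → ℚP.*-distribʳ-+ (seq x n) (seq y n) (seq z n))) }
    ; *-comm = λ x y → pointwise-≈ (x * y) (y * x) (λ n → ℚP.*-comm (seq x n) (seq y n)) }

  -- Beyond N each sequence moves by at most ε / 4, so a gap of ε seen at one late index persists as
  -- ε / 2 at all of them. A decidable comparison of two rationals thus controls the order of the
  -- reals.
  gap : ∀ x y ε → 0ℚ ℚ.< ε → ∃[ N ] (∀ n m → N ℕ.≤ n → N ℕ.≤ m →
    seq y n ℚ.+ ε ℚ.< seq x n → seq y m ℚ.+ ½ ℚ.* ε ℚ.≤ seq x m)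
  gap x y ε 0<ε =
    let (N , h) = cauchy x (½ ℚ.* (½ ℚ.* ε)) (0<½* (0<½* 0<ε))
        (M , k) = cauchy y (½ ℚ.* (½ ℚ.* ε)) (0<½* (0<½* 0<ε))
    in N ℕ.⊔ M , λ n m n≥ m≥ lt →
    let q = ½ ℚ.* (½ ℚ.* ε)
        xn = ∣-∣-upper {seq x n} {seq x m} {q} (h n m (weakenˡ N n≥) (weakenˡ N m≥))
        yn = ∣-∣-lower {seq y n} {seq y m} {q} (k n m (weakenʳ N n≥) (weakenʳ N m≥))
    in ≤-by (((seq x m ℚ.+ q) ℚ.- seq x n) ℚ.+ ((seq y n ℚ.+ q) ℚ.- seq y m) ℚ.+ (seq x n ℚ.- (seq y n ℚ.+ ε)))
         (0≤+ (0≤+ (0≤diff xn) (0≤diff yn)) (0≤diff (ℚP.<⇒≤ lt)))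
         (solve 5 (λ a b c d e → let h = con ½ :* e ; q = con ½ :* h in
             (d :+ h) :+ (((b :+ q) :- a) :+ ((c :+ q) :- d) :+ (a :- (c :+ e))) := b) refl
           (seq x n) (seq x m) (seq y n) (seq y m) ε)

  ≰⇒≥ : ∀ x y → ¬ (x ≤ y) → y ≤ x
  ≰⇒≥ x y x≰y ε 0<ε = let (N , g) = gap y x ε 0<ε in N , λ n n≥ → ℚP.≮⇒≥ (λ lt → x≰y (λ η 0<η → N , λ m m≥ →
      ≤-by (((seq y m) ℚ.- (seq x m ℚ.+ ½ ℚ.* ε)) ℚ.+ ½ ℚ.* ε ℚ.+ η)
        (0≤+ (0≤+ (0≤diff (g n m n≥ m≥ lt)) (ℚP.<⇒≤ (0<½* 0<ε))) (ℚP.<⇒≤ 0<η))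
        (solve 4 (λ x y h e → x :+ ((y :- (x :+ h)) :+ h :+ e) := y :+ e) refl
          (seq x m) (seq y m) (½ ℚ.* ε) η)))

  -- A violation at one late index persists by `gap` and refutes x ≤ y; since rational order is
  -- decidable, no violation means the desired inequality.
  ≤-stable : ∀ x y → ¬ ¬ (x ≤ y) → x ≤ y
  ≤-stable x y ¬¬x≤y ε 0<ε = let (N , g) = gap x y ε 0<ε in N , λ n n≥ → ℚP.≮⇒≥ (λ lt → ¬¬x≤y (λ x≤y →
    let (M , h) = x≤y (½ ℚ.* (½ ℚ.* ε)) (0<½* (0<½* 0<ε))
        m = N ℕ.⊔ M
    in contradictory (seq x m) (seq y m) (g n m n≥ (ℕP.m≤m⊔n N M) lt) (h m (ℕP.m≤n⊔m N M))))
    where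
    contradictory : ∀ a b → b ℚ.+ ½ ℚ.* ε ℚ.≤ a → ¬ (a ℚ.≤ b ℚ.+ ½ ℚ.* (½ ℚ.* ε))
    contradictory a b lower upper = ℚP.<-irrefl refl (ℚP.<-≤-trans (0<½* (0<½* 0<ε))
      (≤-by ((a ℚ.- (b ℚ.+ ½ ℚ.* ε)) ℚ.+ ((b ℚ.+ ½ ℚ.* (½ ℚ.* ε)) ℚ.- a))
        (0≤+ (0≤diff lower) (0≤diff upper))
        (solve 3 (λ x y e → let h = con ½ :* e ; q = con ½ :* h in
            q :+ ((x :- (y :+ h)) :+ ((y :+ q) :- x)) := con 0ℚ) refl a b ε)))

  ≤-limit : ∀ x y → (∀ ε → 0ℚ ℚ.< ε → x ≤ y + fromℚ ε) → x ≤ y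
  ≤-limit x y h ε 0<ε = let (N , k) = h (½ ℚ.* ε) (0<½* 0<ε) (½ ℚ.* ε) (0<½* 0<ε) in N , λ n n≥ → ℚP.≤-trans (k n n≥) (ℚP.≤-reflexive
    (trans (ℚP.+-assoc (seq y n) (½ ℚ.* ε) (½ ℚ.* ε)) (cong (λ t → seq y n ℚ.+ t) (half+half ε))))

  bounded : ∀ x → Σ[ q ∈ ℚ ] 0ℚ ℚ.< q × x ≤ fromℚ q × - x ≤ fromℚ q
  bounded x = let (K , 0<K , x≤K) = cauchy-bounded (seq x) (cauchy x) in K , 0<K
    , pointwise-≤ x (fromℚ K) (λ n → ℚP.≤-trans (p≤∣p∣ (seq x n)) (x≤K n))
    , pointwise-≤ (- x) (fromℚ K) (λ n → ℚP.≤-trans (-p≤∣p∣ (seq x n)) (x≤K n))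

  0<1/suc : ∀ n → 0ℚ ℚ.< 1/suc n
  0<1/suc n = ℚP.positive⁻¹ (1/suc n) {{ℚP.normalize-pos 1 (suc n)}}

  module _ (s : ℕ → ℝ)
    (s-cauchy : ∀ ε → 0ℚ ℚ.< ε → ∃[ N ] (∀ m n → N ℕ.≤ m → N ℕ.≤ n → s m ≤ s n + fromℚ ε)) where

    private
      index : ℕ → ℕ
      index n = proj₁ (cauchy (s n) (1/suc n) (0<1/suc n))

      -- The approximant of the n-th real at an index from which on it is accurate to 1 / (n + 1).
      diagonal : ℕ → ℚ
      diagonal n = seq (s n) (index n)

      1/suc-small : ∀ ε → 0ℚ ℚ.< ε → ∃[ J ] (∀ j → J ℕ.≤ j → 1/suc j ℚ.≤ ε)
      1/suc-small ε 0<ε = proj₁ (archimedean-1/suc 1ℚ 0<ε) , λ j J≤j →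
        subst (ℚ._≤ ε) (ℚP.*-identityˡ (1/suc j)) (proj₂ (archimedean-1/suc 1ℚ 0<ε) j J≤j)

      upper : ∀ n p → index n ℕ.≤ p → seq (s n) p ℚ.≤ diagonal n ℚ.+ 1/suc n
      upper n p le = ∣-∣-upper {seq (s n) p} (proj₂ (cauchy (s n) (1/suc n) (0<1/suc n)) p (index n) le ℕP.≤-refl)

      lower : ∀ n p → index n ℕ.≤ p → diagonal n ℚ.≤ seq (s n) p ℚ.+ 1/suc n
      lower n p le = ∣-∣-lower {seq (s n) p} (proj₂ (cauchy (s n) (1/suc n) (0<1/suc n)) p (index n) le ℕP.≤-refl)

      -- Four errors of size q: one from each of the two diagonal approximations, one from the
      -- Cauchy hypothesis, and one from the slack in the definition of ≤ on ℝ.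
      diagonal-close : ∀ q → 0ℚ ℚ.< q → ∃[ N ] (∀ m n → N ℕ.≤ m → N ℕ.≤ n →
        diagonal m ℚ.≤ diagonal n ℚ.+ (q ℚ.+ q ℚ.+ (q ℚ.+ q)))
      diagonal-close q 0<q = N ℕ.⊔ J , λ m n m≥ n≥ →
          step m n m≥ n≥ (h m n (weakenˡ N m≥) (weakenˡ N n≥) q 0<q)
        where
        N = proj₁ (s-cauchy q 0<q)
        h = proj₂ (s-cauchy q 0<q)
        J = proj₁ (1/suc-small q 0<q)
        j = proj₂ (1/suc-small q 0<q)
        step : ∀ m n → N ℕ.⊔ J ℕ.≤ m → N ℕ.⊔ J ℕ.≤ n →
          ∃[ P ] (∀ p → P ℕ.≤ p → seq (s m) p ℚ.≤ seq (s n) p ℚ.+ q ℚ.+ q) →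
          diagonal m ℚ.≤ diagonal n ℚ.+ (q ℚ.+ q ℚ.+ (q ℚ.+ q))
        step m n m≥ n≥ (P , k) = begin
          diagonal m
            ≤⟨ lower m p (proj₁ (weaken (index m) (proj₁ (weaken (index m ℕ.⊔ index n) ℕP.≤-refl)))) ⟩
          seq (s m) p ℚ.+ 1/suc m
            ≤⟨ ℚP.+-mono-≤ (k p (proj₂ (weaken (index m ℕ.⊔ index n) ℕP.≤-refl))) (j m (weakenʳ N m≥)) ⟩
          (seq (s n) p ℚ.+ q ℚ.+ q) ℚ.+ q
            ≤⟨ ℚP.+-monoˡ-≤ q (ℚP.+-monoˡ-≤ q (ℚP.+-monoˡ-≤ q
                 (ℚP.≤-trans (upper n p (proj₂ (weaken (index m) (proj₁ (weaken (index m ℕ.⊔ index n) ℕP.≤-refl)))))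
                   (ℚP.+-monoʳ-≤ (diagonal n) (j n (weakenʳ N n≥)))))) ⟩
          (diagonal n ℚ.+ q ℚ.+ q ℚ.+ q) ℚ.+ q
            ≡⟨ solve 2 (λ d q → d :+ q :+ q :+ q :+ q := d :+ (q :+ q :+ (q :+ q))) refl (diagonal n) q ⟩
          diagonal n ℚ.+ (q ℚ.+ q ℚ.+ (q ℚ.+ q)) ∎
          where p = index m ℕ.⊔ index n ℕ.⊔ P

      quarters : ∀ ε → ½ ℚ.* (½ ℚ.* ε) ℚ.+ ½ ℚ.* (½ ℚ.* ε) ℚ.+ (½ ℚ.* (½ ℚ.* ε) ℚ.+ ½ ℚ.* (½ ℚ.* ε)) ≡ ε
      quarters ε = trans (cong₂ ℚ._+_ (half+half (½ ℚ.* ε)) (half+half (½ ℚ.* ε))) (half+half ε)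

      diagonal-close′ : ∀ ε → 0ℚ ℚ.< ε → ∃[ N ] (∀ m n → N ℕ.≤ m → N ℕ.≤ n → diagonal m ℚ.≤ diagonal n ℚ.+ ε)
      diagonal-close′ ε 0<ε = let (N , h) = diagonal-close (½ ℚ.* (½ ℚ.* ε)) (0<½* (0<½* 0<ε)) in N , λ m n m≥ n≥ → ℚP.≤-trans (h m n m≥ n≥)
                      (ℚP.≤-reflexive (cong (λ t → diagonal n ℚ.+ t) (quarters ε)))

      diagonal-cauchy : IsCauchy diagonal
      diagonal-cauchy ε 0<ε = let (N , h) = diagonal-close′ ε 0<ε in N , λ m n m≥ n≥ → ∣-∣-intro (h m n m≥ n≥) (h n m n≥ m≥)

      limit : ℝ
      limit = mkℝ diagonal diagonal-cauchy

      near-limit : ∀ ε → 0ℚ ℚ.< ε → ∃[ N ] (∀ n → N ℕ.≤ n → s n ≤ limit + fromℚ ε × limit ≤ s n + fromℚ ε)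
      near-limit ε 0<ε =
        let (N , h) = diagonal-close′ (½ ℚ.* ε) (0<½* 0<ε)
            (J , j) = 1/suc-small (½ ℚ.* ε) (0<½* 0<ε)
        in N ℕ.⊔ J , λ n n≥ →
          (λ η 0<η → N ℕ.⊔ index n , λ p p≥ → begin
            seq (s n) p                                ≤⟨ upper n p (weakenʳ N p≥) ⟩
            diagonal n ℚ.+ 1/suc n                     ≤⟨ ℚP.+-mono-≤ (h n p (weakenˡ N n≥) (weakenˡ N p≥))
                                                            (j n (weakenʳ N n≥)) ⟩
            diagonal p ℚ.+ ½ ℚ.* ε ℚ.+ ½ ℚ.* ε         ≡⟨ trans (ℚP.+-assoc (diagonal p) (½ ℚ.* ε) (½ ℚ.* ε))
                                                            (cong (λ t → diagonal p ℚ.+ t) (half+half ε)) ⟩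
            diagonal p ℚ.+ ε                           ≤⟨ ≤-by η (ℚP.<⇒≤ 0<η) refl ⟩
            diagonal p ℚ.+ ε ℚ.+ η                     ∎)
        , (λ η 0<η → N ℕ.⊔ index n , λ p p≥ → begin
            diagonal p                                 ≤⟨ h p n (weakenˡ N p≥) (weakenˡ N n≥) ⟩
            diagonal n ℚ.+ ½ ℚ.* ε                     ≤⟨ ℚP.+-monoˡ-≤ (½ ℚ.* ε) (ℚP.≤-trans (lower n p (weakenʳ N p≥))
                                                            (ℚP.+-monoʳ-≤ (seq (s n) p) (j n (weakenʳ N n≥)))) ⟩
            seq (s n) p ℚ.+ ½ ℚ.* ε ℚ.+ ½ ℚ.* ε        ≡⟨ trans (ℚP.+-assoc (seq (s n) p) (½ ℚ.* ε) (½ ℚ.* ε))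
                                                            (cong (λ t → seq (s n) p ℚ.+ t) (half+half ε)) ⟩
            seq (s n) p ℚ.+ ε                          ≤⟨ ≤-by η (ℚP.<⇒≤ 0<η) refl ⟩
            seq (s n) p ℚ.+ ε ℚ.+ η                    ∎)

    complete : Σ[ L ∈ ℝ ] (∀ ε → 0ℚ ℚ.< ε →
      ∃[ N ] (∀ n → N ℕ.≤ n → s n ≤ L + fromℚ ε × L ≤ s n + fromℚ ε))
    complete = limit , near-limit

  open Trigonometry
  open CauchyLemmas using (∣cosCoeff∣≤1; ∣sinCoeff∣≤1)

  private
    tail-small : ∀ M → 0ℚ ℚ.≤ M → ∀ ε → 0ℚ ℚ.< ε → ∃[ N ] (∀ n → N ℕ.≤ n →
      partialSum (expTerm M) (n ℕ.+ n) ℚ.- partialSum (expTerm M) n ℚ.≤ ε)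
    tail-small M 0≤M ε 0<ε = let (N , h) = cauchy-exp M 0≤M ε 0<ε in N , λ n n≥ → ℚP.≤-trans (p≤∣p∣ (partialSum (expTerm M) (n ℕ.+ n) ℚ.- partialSum (expTerm M) n))
                        (h (n ℕ.+ n) n (ℕP.≤-trans n≥ (ℕP.m≤m+n n n)) n≥)

    addition-small : ∀ σ (C c c′ s s′ : ℕ → ℚ) → ∣ σ ∣ ≡ 1ℚ →
      (∀ i j → C (i ℕ.+ j) ≡ c i ℚ.* c′ j ℚ.+ σ ℚ.* (s i ℚ.* s′ j)) →
      (∀ m → ∣ c m ∣ ℚ.≤ 1ℚ) → (∀ m → ∣ c′ m ∣ ℚ.≤ 1ℚ) → (∀ m → ∣ s m ∣ ℚ.≤ 1ℚ) → (∀ m → ∣ s′ m ∣ ℚ.≤ 1ℚ) →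
      ∀ x y ε → 0ℚ ℚ.< ε → ∃[ N ] (∀ n → N ℕ.≤ n →
        ∣ (series c (seq x n) n ℚ.* series c′ (seq y n) n ℚ.+ σ ℚ.* (series s (seq x n) n ℚ.* series s′ (seq y n) n))
            ℚ.- series C (seq x n ℚ.+ seq y n) n ∣ ℚ.≤ ε)
    addition-small σ C c c′ s s′ ∣σ∣ h c≤ c′≤ s≤ s′≤ x y ε 0<ε =
      let (K , 0<K , x≤K) = cauchy-bounded (seq x) (cauchy x)
          (L , 0<L , y≤L) = cauchy-bounded (seq y) (cauchy y)
          0≤KL = 0≤+ (ℚP.<⇒≤ 0<K) (ℚP.<⇒≤ 0<L)
          (N , t) = tail-small (K ℚ.+ L ℚ.+ (K ℚ.+ L)) (0≤+ 0≤KL 0≤KL) (½ ℚ.* ε) (0<½* 0<ε)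
      in N , λ n n≥ → ℚP.≤-trans
      (series-+-bound σ C c c′ s s′ ∣σ∣ h c≤ c′≤ s≤ s′≤ (seq x n) (seq y n) (K ℚ.+ L) n
        (ℚP.≤-trans (x≤K n) (≤-by L (ℚP.<⇒≤ 0<L) refl))
        (ℚP.≤-trans (y≤L n) (≤-by K (ℚP.<⇒≤ 0<K) (ℚP.+-comm L K))))
      (ℚP.≤-trans (ℚP.+-mono-≤ (t n n≥) (t n n≥)) (ℚP.≤-reflexive (half+half ε)))

  cos-+ : ∀ x y → cos (x + y) ≈ cos x * cos y - sin x * sin y
  cos-+ x y = close⇒≈ (cos (x + y)) (cos x * cos y - sin x * sin y) bound
    where
    bound : ∀ ε → 0ℚ ℚ.< ε → ∃[ N ] (∀ n → N ℕ.≤ n →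
      ∣ seq (cos (x + y)) n ℚ.- seq (cos x * cos y - sin x * sin y) n ∣ ℚ.≤ ε)
    bound ε 0<ε = let (N , h) = addition-small (ℚ.- 1ℚ) cosCoeff cosCoeff cosCoeff sinCoeff sinCoeff refl
                          (λ i j → proj₁ (coeff-+ i j)) ∣cosCoeff∣≤1 ∣cosCoeff∣≤1 ∣sinCoeff∣≤1 ∣sinCoeff∣≤1 x y ε 0<ε
      in N , λ n n≥ →
      let c = series cosCoeff (seq x n) n ; c′ = series cosCoeff (seq y n) n
          s = series sinCoeff (seq x n) n ; s′ = series sinCoeff (seq y n) n
          C = series cosCoeff (seq x n ℚ.+ seq y n) n
      in subst (ℚ._≤ ε) (trans
           (∣-∣-sym (c ℚ.* c′ ℚ.+ (ℚ.- 1ℚ) ℚ.* (s ℚ.* s′)) C)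
           (cong ∣_∣ (solve 5 (λ C c c′ s s′ → C :- (c :* c′ :+ (:- con 1ℚ) :* (s :* s′)) := C :- (c :* c′ :- s :* s′))
             refl C c c′ s s′))) (h n n≥)

  sin-+ : ∀ x y → sin (x + y) ≈ cos x * sin y + sin x * cos y
  sin-+ x y = close⇒≈ (sin (x + y)) (cos x * sin y + sin x * cos y) bound
    where
    bound : ∀ ε → 0ℚ ℚ.< ε → ∃[ N ] (∀ n → N ℕ.≤ n →
      ∣ seq (sin (x + y)) n ℚ.- seq (cos x * sin y + sin x * cos y) n ∣ ℚ.≤ ε)
    bound ε 0<ε = let (N , h) = addition-small 1ℚ sinCoeff cosCoeff sinCoeff sinCoeff cosCoeff refl
                          (λ i j → proj₂ (coeff-+ i j)) ∣cosCoeff∣≤1 ∣sinCoeff∣≤1 ∣sinCoeff∣≤1 ∣cosCoeff∣≤1 x y ε 0<ε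
      in N , λ n n≥ →
      let c = series cosCoeff (seq x n) n ; c′ = series cosCoeff (seq y n) n
          s = series sinCoeff (seq x n) n ; s′ = series sinCoeff (seq y n) n
          C = series sinCoeff (seq x n ℚ.+ seq y n) n
      in subst (ℚ._≤ ε) (trans
           (∣-∣-sym (c ℚ.* s′ ℚ.+ 1ℚ ℚ.* (s ℚ.* c′)) C)
           (cong ∣_∣ (solve 5 (λ C c c′ s s′ → C :- (c :* s′ :+ con 1ℚ :* (s :* c′)) := C :- (c :* s′ :+ s :* c′))
             refl C c c′ s s′))) (h n n≥)

  -- The addition formula for x + (- x), with the parity of cos and sin, which holds exactly on
  -- approximants.
  cos²+sin² : ∀ x → cos x * cos x + sin x * sin x ≈ 1ℝ
  cos²+sin² x = ≈-trans (cos x * cos x + sin x * sin x) (cos (x + (- x))) 1ℝ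
    (≈-trans (cos x * cos x + sin x * sin x) (cos x * cos (- x) - sin x * sin (- x)) (cos (x + (- x)))
      (pointwise-≈ (cos x * cos x + sin x * sin x) (cos x * cos (- x) - sin x * sin (- x)) parity)
      (let (p , q) = cos-+ x (- x) in q , p))
    -- The zeroth partial sum is empty, so the approximants equal 1 only from index 1 on.
    (close⇒≈ (cos (x + (- x))) 1ℝ λ ε 0<ε → 1 , at-0 ε 0<ε)
    where
    parity : ∀ n → seq (cos x * cos x + sin x * sin x) n ≡ seq (cos x * cos (- x) - sin x * sin (- x)) n
    parity n = sym (trans
      (cong₂ (λ a b → series cosCoeff (seq x n) n ℚ.* a ℚ.- series sinCoeff (seq x n) n ℚ.* b)
        (cos-series-neg (seq x n) n) (sin-series-neg (seq x n) n))
      (solve 2 (λ c s → c :* c :- s :* (:- s) := c :* c :+ s :* s) refl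
        (series cosCoeff (seq x n) n) (series sinCoeff (seq x n) n)))
    at-0 : ∀ ε → 0ℚ ℚ.< ε → ∀ n → 1 ℕ.≤ n → ∣ seq (cos (x + (- x))) n ℚ.- 1ℚ ∣ ℚ.≤ ε
    at-0 ε 0<ε (suc n) _ = ℚP.≤-trans (ℚP.≤-reflexive (trans
      (cong (λ q → ∣ series cosCoeff q (suc n) ℚ.- 1ℚ ∣) (ℚP.+-inverseʳ (seq x (suc n))))
      (cong (λ q → ∣ q ℚ.- 1ℚ ∣) (cos-series-0 n)))) (ℚP.<⇒≤ 0<ε)

  cos-sin-lipschitz : ∀ K → 0ℚ ℚ.< K → Σ[ B ∈ ℚ ] 0ℚ ℚ.< B ×
    (∀ x y → x ≤ fromℚ K → - x ≤ fromℚ K → y ≤ fromℚ K → - y ≤ fromℚ K →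
     ∀ δ → 0ℚ ℚ.< δ → (x ≤ y + fromℚ δ × y ≤ x + fromℚ δ) →
     (cos x ≤ cos y + fromℚ (B ℚ.* δ) × cos y ≤ cos x + fromℚ (B ℚ.* δ))
     × (sin x ≤ sin y + fromℚ (B ℚ.* δ) × sin y ≤ sin x + fromℚ (B ℚ.* δ)))
  cos-sin-lipschitz K 0<K =
    let (B , 0<B , S≤B) = cauchy-bounded (partialSum (expTerm M)) (cauchy-exp M 0≤M)
    in B , 0<B , λ x y x≤ -x≤ y≤ -y≤ δ 0<δ x~y →
        conclude B 0<B S≤B cosCoeff ∣cosCoeff∣≤1 x y x≤ -x≤ y≤ -y≤ δ x~y
      , conclude B 0<B S≤B sinCoeff ∣sinCoeff∣≤1 x y x≤ -x≤ y≤ -y≤ δ x~y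
    where
    -- One unit absorbs the slack by which approximants of x and y may exceed K, the other is the
    -- margin that `series-lipschitz` demands.
    M = K ℚ.+ 1ℚ ℚ.+ 1ℚ
    0≤M = 0≤+ (0≤+ (ℚP.<⇒≤ 0<K) (ℚP.<⇒≤ 0<1)) (ℚP.<⇒≤ 0<1)
    estimate : ∀ B → 0ℚ ℚ.< B → (∀ n → ∣ partialSum (expTerm M) n ∣ ℚ.≤ B) → ∀ (c : ℕ → ℚ) → (∀ m → ∣ c m ∣ ℚ.≤ 1ℚ) →
      ∀ n a b δ η ε → B ℚ.* η ℚ.≤ ε → a ℚ.≤ b ℚ.+ δ ℚ.+ η → b ℚ.≤ a ℚ.+ δ ℚ.+ η →
      a ℚ.≤ K ℚ.+ 1ℚ → ℚ.- a ℚ.≤ K ℚ.+ 1ℚ → b ℚ.≤ K ℚ.+ 1ℚ → ℚ.- b ℚ.≤ K ℚ.+ 1ℚ →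
      ∣ series c a n ℚ.- series c b n ∣ ℚ.≤ B ℚ.* δ ℚ.+ ε
    estimate B 0<B S≤B c c≤1 n a b δ η ε small p q a≤ -a≤ b≤ -b≤ = begin
      ∣ series c a n ℚ.- series c b n ∣
        ≤⟨ series-lipschitz c c≤1 a b M (ℚP.+-monoˡ-≤ 1ℚ (∣∣≤ a≤ -a≤))
             (ℚP.≤-trans (∣∣≤ b≤ -b≤) (≤-by 1ℚ (ℚP.<⇒≤ 0<1) refl)) n ⟩
      ∣ a ℚ.- b ∣ ℚ.* partialSum (expTerm M) n
        ≤⟨ ℚP.*-monoˡ-≤-nonNeg ∣ a ℚ.- b ∣ {{ℚ.nonNegative (ℚP.0≤∣p∣ (a ℚ.- b))}}
             (ℚP.≤-trans (p≤∣p∣ (partialSum (expTerm M) n)) (S≤B n)) ⟩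
      ∣ a ℚ.- b ∣ ℚ.* B
        ≤⟨ ℚP.*-monoʳ-≤-nonNeg B {{ℚ.nonNegative (ℚP.<⇒≤ 0<B)}} (∣-∣-intro {a} {b} {δ ℚ.+ η}
             (subst (a ℚ.≤_) (ℚP.+-assoc b δ η) p) (subst (b ℚ.≤_) (ℚP.+-assoc a δ η) q)) ⟩
      (δ ℚ.+ η) ℚ.* B
        ≡⟨ solve 3 (λ d e B → (d :+ e) :* B := B :* d :+ B :* e) refl δ η B ⟩
      B ℚ.* δ ℚ.+ B ℚ.* η
        ≤⟨ ℚP.+-monoʳ-≤ (B ℚ.* δ) small ⟩
      B ℚ.* δ ℚ.+ ε ∎

    conclude : ∀ B → 0ℚ ℚ.< B → (∀ n → ∣ partialSum (expTerm M) n ∣ ℚ.≤ B) →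
      ∀ c (c≤1 : ∀ m → ∣ c m ∣ ℚ.≤ 1ℚ) x y →
      x ≤ fromℚ K → - x ≤ fromℚ K → y ≤ fromℚ K → - y ≤ fromℚ K →
      ∀ δ → (x ≤ y + fromℚ δ × y ≤ x + fromℚ δ) →
      (expSeries c c≤1 x ≤ expSeries c c≤1 y + fromℚ (B ℚ.* δ)
       × expSeries c c≤1 y ≤ expSeries c c≤1 x + fromℚ (B ℚ.* δ))
    conclude B 0<B S≤B c c≤1 x y x≤ -x≤ y≤ -y≤ δ (p , q) =
        (λ ε 0<ε → let (N , h) = close ε 0<ε in N , λ n n≥ →
          ℚP.≤-trans (∣-∣-upper {series c (seq x n) n} {series c (seq y n) n} (h n n≥))
            (ℚP.≤-reflexive (sym (ℚP.+-assoc (series c (seq y n) n) (B ℚ.* δ) ε))))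
      , (λ ε 0<ε → let (N , h) = close ε 0<ε in N , λ n n≥ →
          ℚP.≤-trans (∣-∣-lower {series c (seq x n) n} {series c (seq y n) n} (h n n≥))
            (ℚP.≤-reflexive (sym (ℚP.+-assoc (series c (seq x n) n) (B ℚ.* δ) ε))))
      where
      close : ∀ ε → 0ℚ ℚ.< ε → ∃[ N ] (∀ n → N ℕ.≤ n →
        ∣ series c (seq x n) n ℚ.- series c (seq y n) n ∣ ℚ.≤ B ℚ.* δ ℚ.+ ε)
      close ε 0<ε =
        let (η , 0<η , _ , small) = scale-down B ε 0<B 0<ε
            (N₁ , h₁) = p η 0<η
            (N₂ , h₂) = q η 0<η
            (N₃ , h₃) = x≤ 1ℚ 0<1
            (N₄ , h₄) = -x≤ 1ℚ 0<1
            (N₅ , h₅) = y≤ 1ℚ 0<1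
            (N₆ , h₆) = -y≤ 1ℚ 0<1
        in (N₁ ℕ.⊔ N₂) ℕ.⊔ ((N₃ ℕ.⊔ N₄) ℕ.⊔ (N₅ ℕ.⊔ N₆)) , λ n n≥ →
          let (n₁₂ , n₃₆) = weaken (N₁ ℕ.⊔ N₂) n≥
              (n₁ , n₂) = weaken N₁ n₁₂
              (n₃₄ , n₅₆) = weaken (N₃ ℕ.⊔ N₄) n₃₆
              (n₃ , n₄) = weaken N₃ n₃₄
              (n₅ , n₆) = weaken N₅ n₅₆
          in estimate B 0<B S≤B c c≤1 n (seq x n) (seq y n) δ η ε small (h₁ n n₁) (h₂ n n₂)
               (h₃ n n₃) (h₄ n n₄) (h₅ n n₅) (h₆ n n₆)

  structure : RealStructure
  structure = record
    { R = ℝ ; _≤_ = _≤_ ; _+_ = _+_ ; _*_ = _*_ ; -_ = -_ ; fromℚ = fromℚ ; cos = cos ; sin = sin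
    ; isCommutativeRing = isCommutativeRing
    ; ≤-refl = λ {x} → ≤-refl x
    ; ≤-trans = λ {x} {y} {z} → ≤-trans x y z
    ; +-mono-≤ = λ {x} {y} {u} {v} → +-mono-≤ x y u v
    ; 0≤* = λ {x} {y} → 0≤* x y
    ; fromℚ-+ = λ p q → pointwise-≈ (fromℚ (p ℚ.+ q)) (fromℚ p + fromℚ q) (λ _ → refl)
    ; fromℚ-* = λ p q → pointwise-≈ (fromℚ (p ℚ.* q)) (fromℚ p * fromℚ q) (λ _ → refl)
    ; fromℚ-neg = λ p → pointwise-≈ (fromℚ (ℚ.- p)) (- fromℚ p) (λ _ → refl)
    ; fromℚ-mono = λ {p} {q} h → pointwise-≤ (fromℚ p) (fromℚ q) (λ _ → h)
    ; ≰⇒≥ = λ {x} {y} → ≰⇒≥ x y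
    ; ≤-stable = λ {x} {y} → ≤-stable x y
    ; ≤-limit = λ {x} {y} → ≤-limit x y
    ; bounded = bounded
    ; complete = complete
    ; cos-+ = cos-+
    ; sin-+ = sin-+
    ; cos²+sin² = cos²+sin²
    ; cos-sin-lipschitz = λ K 0<K → let (B , 0<B , h) = cos-sin-lipschitz K 0<K in
        B , 0<B , λ {x} {y} → h x y
    }

-- Transfer of the abstract result to the concrete reals

-- Comparing two reals for definitional equality unfolds their Cauchy proofs,
-- so the passage from the abstract structure to ℝ is made on approximants.
module Transfer where
  open CauchyReals using (structure; pointwise-≤; close⇒≈)
  open RealStructure structure using () renaming (_*_ to _*ᴳ_; _+_ to _+ᴳ_; fromℚ to fromℚᴳ)
  open RealAlgebra structure using (power)
  module ℂᴳ = ComplexAlgebra structure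
  module Expᴳ = ExponentialSums structure
  module Intᴳ = Integration structure
  module Sigᴳ = Signals structure
  open Defs

  infix 4 _≗_

  _≗_ : ℝ → ℝ → Set
  a ≗ b = ∀ m → seq a m ≡ seq b m

  ≤-resp-≗ : ∀ a b c d → a ≗ b → c ≗ d → b ≤ d → a ≤ c
  ≤-resp-≗ a b c d a≗b c≗d b≤d ε 0<ε = let (N , h) = b≤d ε 0<ε in N , λ n N≤n →
    ≡.subst₂ (λ p q → p ℚ.≤ q ℚ.+ ε) (≡.sym (a≗b n)) (≡.sym (c≗d n)) (h n N≤n)

  ≈-resp-≗ : ∀ a b c → b ≗ c → a ≈ b → RealStructure._≈_ structure a c
  ≈-resp-≗ a b c b≗c (p , q) =
      ≤-resp-≗ a a c b (λ _ → ≡.refl) (λ m → ≡.sym (b≗c m)) p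
    , ≤-resp-≗ c b a a (λ m → ≡.sym (b≗c m)) (λ _ → ≡.refl) q

  ^≗power : ∀ x y n → x ≗ y → x ^ n ≗ power y n
  ^≗power x y zero    h m = ≡.refl
  ^≗power x y (suc n) h m = ≡.cong₂ ℚ._*_ (h m) (^≗power x y n h m)

  sum≗ : ∀ {n} (f g : Fin n → ℝ) → (∀ i → f i ≗ g i) → sum f ≗ Intᴳ.sumFin g
  sum≗ {zero}  f g h m = ≡.refl
  sum≗ {suc n} f g h m = ≡.cong₂ ℚ._+_ (h zero m) (sum≗ {n} (λ i → f (suc i)) (λ i → g (suc i)) (λ i → h (suc i)) m)

  multiSum≗ : ∀ d {n} (f g : Vec (Fin n) d → ℝ) → (∀ is → f is ≗ g is) → multiSum d f ≗ Intᴳ.multiSum d g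
  multiSum≗ zero    f g h = h []
  multiSum≗ (suc d) {n} f g h = sum≗ {n} (λ i → multiSum d (λ is → f (i ∷ is))) (λ i → Intᴳ.multiSum d (λ is → g (i ∷ is)))
    (λ i → multiSum≗ d {n} (λ is → f (i ∷ is)) (λ is → g (i ∷ is)) (λ is → h (i ∷ is)))

  dilate≗ : ∀ q T → fromℚ q * T ≗ Intᴳ.dilate q T
  dilate≗ q T m = ≡.refl

  dilate^≗ : ∀ q T d → (fromℚ q * T) ^ d ≗ power (Intᴳ.dilate q T) d
  dilate^≗ q T d = ^≗power (fromℚ q * T) (Intᴳ.dilate q T) d (dilate≗ q T)

  -- The instance arguments are written out because an unsolved one makes the
  -- type checker compare normal forms of fractions.
  riemannSum≗ : ∀ {d} T (f g : Vec ℝ d → ℝ) → (∀ t → f t ≗ g t) → ∀ n .{{_ : ℕ.NonZero n}} tag →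
    riemannSum T f n tag ≗ Intᴳ.riemannSum T g n tag
  riemannSum≗ {d} T f g h n {{n≢0}} tag m = ≡.cong₂ ℚ._*_ (dilate^≗ (ℚ._/_ (+ 1) n {{n≢0}}) T d m)
    (multiSum≗ d {n} (λ is → f (tag is)) (λ is → g (tag is)) (λ is → h (tag is)) m)

  dilate-lower : ∀ q T s → fromℚ q * T ≤ s → Intᴳ.dilate q T ≤ s
  dilate-lower q T s = ≤-resp-≗ (Intᴳ.dilate q T) (fromℚ q * T) s s (λ m → ≡.sym (dilate≗ q T m)) (λ _ → ≡.refl)

  dilate-upper : ∀ q T s → s ≤ fromℚ q * T → s ≤ Intᴳ.dilate q T
  dilate-upper q T s = ≤-resp-≗ s s (Intᴳ.dilate q T) (fromℚ q * T) (λ _ → ≡.refl) (λ m → ≡.sym (dilate≗ q T m))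

  inCell : ∀ {d} T n .{{_ : ℕ.NonZero n}} {is : Vec (Fin n) d} {t : Vec ℝ d} →
    Pointwise (InCell T n) is t → Pointwise (Intᴳ.InCell T n) is t
  inCell T n {{n≢0}} [] = []
  inCell T n {{n≢0}} (_∷_ {x = i} {y = s} (lo , hi) ps) =
      ( dilate-lower (ℚ._/_ (+ toℕ i) n {{n≢0}}) T s lo
      , dilate-upper (ℚ._/_ (+ suc (toℕ i)) n {{n≢0}}) T s hi)
    ∷ inCell T n {{n≢0}} ps

  isIntegral : ∀ {d} T (f g : Vec ℝ d → ℝ) → (∀ t → f t ≗ g t) → ∀ I → Intᴳ.IsIntegral T g I → IsIntegral T f I
  isIntegral T f g h I int ε 0<ε = let (N , close) = int ε 0<ε in N , λ n {{n≢0}} N≤n tag tag∈ →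
    let R = riemannSum T f n {{n≢0}} tag
        Rᴳ = Intᴳ.riemannSum T g n {{n≢0}} tag
        (p , q) = close n {{n≢0}} N≤n tag (λ is → inCell T n {{n≢0}} (tag∈ is))
    in ≤-resp-≗ R Rᴳ (I + fromℚ ε) (I +ᴳ fromℚᴳ ε) (riemannSum≗ T f g h n {{n≢0}} tag) (λ _ → ≡.refl) p
     , ≤-resp-≗ I I (R + fromℚ ε) (Rᴳ +ᴳ fromℚᴳ ε)
         (λ _ → ≡.refl) (λ m → ≡.cong (ℚ._+ ε) (riemannSum≗ T f g h n {{n≢0}} tag m)) q

  toᴳ : ℂ → ℂᴳ.C
  toᴳ z = re z ℂᴳ.+i im z

  amplitude : ∀ {k} → (Fin k → ℂ) → Fin k → ℂᴳ.C
  amplitude v l = toᴳ (v l)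

  norm²≈ : ∀ y z w → re z ≗ ℂᴳ.re w → im z ≗ ℂᴳ.im w → y ≈ᶜ z →
    RealStructure._≈_ structure (ℂᴳ.norm² (toᴳ y)) (ℂᴳ.norm² w)
  norm²≈ y z w p q (r , s) = ℂᴳ.norm²-cong {toᴳ y} {w}
    (≈-resp-≗ (re y) (re z) (ℂᴳ.re w) p r , ≈-resp-≗ (im y) (im z) (ℂᴳ.im w) q s)

  sumᶜ≗ : ∀ {k} (z : Fin k → ℂ) (w : Fin k → ℂᴳ.C) →
    (∀ l → re (z l) ≗ ℂᴳ.re (w l)) → (∀ l → im (z l) ≗ ℂᴳ.im (w l)) →
    (re (sumᶜ z) ≗ ℂᴳ.re (Expᴳ.finSum w)) × (im (sumᶜ z) ≗ ℂᴳ.im (Expᴳ.finSum w))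
  sumᶜ≗ {zero}  z w p q = (λ _ → ≡.refl) , (λ _ → ≡.refl)
  sumᶜ≗ {suc k} z w p q = let (r , s) = sumᶜ≗ (λ l → z (suc l)) (λ l → w (suc l)) (λ l → p (suc l)) (λ l → q (suc l)) in
      (λ m → ≡.cong₂ ℚ._+_ (p zero m) (r m)) , (λ m → ≡.cong₂ ℚ._+_ (q zero m) (s m))

  signal≗ : ∀ {d k} c (v : Fin k → ℂ) (f : Fin k → Vec ℝ d) t →
    let z = sumᶜ (λ j → v j *ᶜ cis (c * ⟨ f j , t ⟩))
        w = Sigᴳ.signal c (amplitude v) f t
    in (re z ≗ ℂᴳ.re w) × (im z ≗ ℂᴳ.im w)
  signal≗ c v f t = sumᶜ≗ (λ j → v j *ᶜ cis (c * ⟨ f j , t ⟩))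
    (λ l → amplitude v l ℂᴳ.*ᶜ RegularFunctions.cis structure (c *ᴳ Sigᴳ.dot (f l) t)) (λ _ _ → ≡.refl) (λ _ _ → ≡.refl)

  fromℕ-^≗ : ∀ K d → fromℕ (K ℕ.^ d) ≗ power (fromℕ K) d
  fromℕ-^≗ K zero    m = ≡.refl
  fromℕ-^≗ K (suc d) m = ≡.trans (RationalLemmas.fromℕ-* K (K ℕ.^ d)) (≡.cong ((+ K ℚ./ 1) ℚ.*_) (fromℕ-^≗ K d m))

  module Inverse (T : ℝ) (0<T : 0ℝ < T) where
    private
      ε = proj₁ 0<T
      0<ε = proj₁ (proj₂ 0<T)
      N = proj₁ (proj₂ (proj₂ 0<T))
      ε≤T : ∀ n → N ℕ.≤ n → ε ℚ.≤ seq T n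
      ε≤T n N≤n = ≡.subst (ℚ._≤ seq T n) (ℚP.+-identityˡ ε) (proj₂ (proj₂ (proj₂ 0<T)) n N≤n)

    0≤T : 0ℝ ≤ T
    0≤T η 0<η = N , λ n N≤n → ℚP.≤-trans (ℚP.<⇒≤ 0<ε) (ℚP.≤-trans (ε≤T n N≤n)
      (RationalLemmas.≤-by η (ℚP.<⇒≤ 0<η) ≡.refl))

    0≤1/T : 0ℝ ≤ 1/ T 0<T
    0≤1/T = pointwise-≤ 0ℝ (1/ T 0<T) (λ n →
      ℚP.<⇒≤ (CauchyLemmas.0<recip (seq T n ℚ.⊔ ε) (CauchyLemmas.0<p⊔ε (seq T n) 0<ε)))

    -- From index N on the truncation max (Tₙ, ε) equals Tₙ, so the product of approximants is
    -- exactly 1.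
    1/T*T : 1/ T 0<T *ᴳ T ≈ fromℚᴳ 1ℚ
    1/T*T = close⇒≈ (1/ T 0<T *ᴳ T) (fromℚᴳ 1ℚ) λ η 0<η → N , λ n N≤n →
      let u = seq (1/ T 0<T) n
          uT≡1 : u ℚ.* seq T n ≡ 1ℚ
          uT≡1 = ≡.trans (ℚP.*-comm u (seq T n)) (≡.trans
            (≡.cong (ℚ._* u) (≡.sym (ℚP.p≥q⇒p⊔q≡p (ε≤T n N≤n))))
            (CauchyLemmas.p*recip (seq T n ℚ.⊔ ε) (CauchyLemmas.0<p⊔ε (seq T n) 0<ε)))
      in ℚP.≤-trans (ℚP.≤-reflexive (≡.cong (λ q → ℚ.∣ q ℚ.- 1ℚ ∣) uT≡1)) (ℚP.<⇒≤ 0<η)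

  module _ {d k : ℕ} (x : Vec ℝ d → ℂ) (c : ℝ) (v : Fin k → ℂ) (f : Fin k → Vec ℝ d)
    (x≈ : ∀ t → x t ≈ᶜ sumᶜ (λ j → v j *ᶜ cis (c * ⟨ f j , t ⟩))) where
    energy : Vec ℝ d → ℝ
    energy t = ℂᴳ.norm² (toᴳ (x t))

    energy≈ : ∀ t → RealStructure._≈_ structure (energy t) (ℂᴳ.norm² (Sigᴳ.signal c (amplitude v) f t))
    energy≈ t = norm²≈ (x t) (sumᶜ (λ j → v j *ᶜ cis (c * ⟨ f j , t ⟩))) (Sigᴳ.signal c (amplitude v) f t)
      (proj₁ (signal≗ c v f t)) (proj₂ (signal≗ c v f t)) (x≈ t)

    module _ (T : ℝ) (0<T : 0ℝ < T) where
      open Inverse T 0<T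

      integrable : Σ[ I ∈ ℝ ] Intᴳ.IsIntegral T energy I
      integrable = Intᴳ.uniformlyContinuous⇒integrable T 0≤T energy
        (proj₂ (RegularFunctions.regular-cong structure T 0≤T
          {g = λ t → ℂᴳ.norm² (Sigᴳ.signal c (amplitude v) f t)} {g′ = energy}
          (λ t → let (p , q) = energy≈ t in q , p) (Sigᴳ.energy-regular T 0≤T c (amplitude v) f)))

      norm²-T : ℝ
      norm²-T = (1/ T 0<T) ^ d * proj₁ integrable

      isNorm² : IsNorm² T 0<T x norm²-T
      isNorm² = proj₁ integrable
        , isIntegral T (λ t → ∣ x t ∣²) energy (λ _ _ → ≡.refl) (proj₁ integrable) (proj₂ integrable)
        , CauchyReals.≈-refl norm²-T

      maximum≤norm² : ∀ C → Sigᴳ.GridConstant k (k ℕ.^ C) → ∀ t → InCube T t →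
        ∣ x t ∣² ≤ fromℕ (k ℕ.^ (C ℕ.* d)) * norm²-T
      maximum≤norm² C constant t t∈ = ≤-resp-≗ (∣ x t ∣²) (energy t)
        (fromℕ (k ℕ.^ (C ℕ.* d)) * norm²-T)
        (power (fromℕ (k ℕ.^ C)) d *ᴳ (power (1/ T 0<T) d *ᴳ proj₁ integrable))
        (λ _ → ≡.refl)
        (λ m → ≡.cong₂ ℚ._*_
          (≡.trans (≡.cong (λ n → + n ℚ./ 1) (≡.sym (ℕP.^-*-assoc k C d))) (fromℕ-^≗ (k ℕ.^ C) d m))
          (≡.cong (ℚ._* seq (proj₁ integrable) m) (^≗power (1/ T 0<T) (1/ T 0<T) d (λ _ → ≡.refl) m)))
        (Sigᴳ.maximum-bound {k} {k ℕ.^ C} constant T 0≤T (1/ T 0<T) 0≤1/T 1/T*T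
          c (amplitude v) f energy energy≈ (proj₁ integrable) (proj₂ integrable) t t∈)

  gridConstant : ∀ k → Sigᴳ.GridConstant k (k ℕ.^ 21)
  gridConstant = Expᴳ.grid-bound

open import Defs
open import Data.Nat using (ℕ) renaming (_*_ to _*ℕ_; _^_ to _^ℕ_)
open import Data.Vec using (Vec)
open import Data.Product using (Σ-syntax; _×_)

theorem5p3 : Σ[ C ∈ ℕ ] (∀ (d k : ℕ) (x : Vec ℝ d → ℂ) → FourierSparse k x →
    ∀ (T : ℝ) (0<T : 0ℝ < T) →
    Σ[ ‖x‖² ∈ ℝ ] (IsNorm² T 0<T x ‖x‖² ×
    (∀ (t : Vec ℝ d) → InCube T t → ∣ x t ∣² ≤ fromℕ (k ^ℕ (C *ℕ d)) * ‖x‖²)))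
-- The one-dimensional constant k²¹ enters once per coordinate, which gives k to the power 21 d.
theorem5p3 = 21 , λ d k x (v , f , x≈) T 0<T →
    Transfer.norm²-T x (fromℕ 2 * π) v f x≈ T 0<T
  , Transfer.isNorm² x (fromℕ 2 * π) v f x≈ T 0<T
  , Transfer.maximum≤norm² x (fromℕ 2 * π) v f x≈ T 0<T 21 (Transfer.gridConstant k)
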